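{- Assume $SRP(\omega_2)$ and the Tree Property at $\omega_2$. Then there is no ideal which concentrates on $GIS_{\omega_1}$ and bounds its own completeness.
   Context: The base theory is ZFC. $[X]^\omega$ is the set of countable subsets of $X$; a club in $[X]^\omega$ is a $\subseteq$-cofinal subset closed under unions of countable increasing chains, and stationary means meeting every club. For $X\supseteq\omega_1$, a set $P\subset[X]^\omega$ is projective stationary iff for every stationary $T\subset\omega_1$, $\{Y\in P: Y\cap\omega_1\in T\}$ is stationary in $[X]^\omega$. $SRP(\omega_2)$: for every projective stationary $P\subset[H_{\omega_2}]^\omega$ there is a continuous elementary chain $\langle N_\xi:\xi<\omega_1\rangle$ of countable elementary submodels of $H_{\omega_2}$ (i.e. $N_\xi\in N_{\xi+1}$, $N_\xi\subset N_{\xi+1}$, and $N_\xi=\bigcup_{\zeta<\xi}N_\zeta$ for limit $\xi$) with $N_\xi\in P$ for every $\xi<\omega_1$. Tree Property at $\omega_2$: every tree of height $\omega_2$ all of whose levels have size $<\omega_2$ has a cofinal branch. $GIS_{\omega_1}$. $ZF^-$ is ZF without Power Set. A transitive $ZF^-$ model $H$ with $\omega_1\in H$ has the $\omega_1$-approximation property iff for every $\eta\in H$ and $A\subseteq\eta$: if $z\cap A\in H$ for every $z\in H$ which is countable in $H$, then $A\in H$. A set $M$ with $\omega_1\subset M\prec H_\theta$ for some regular uncountable $\theta$ is $\omega_1$-guessing iff its transitive collapse has the $\omega_1$-approximation property. $G_{\omega_1}$ is the class of $\omega_1$-guessing $M$ with $|M|=\omega_1\subset M$. $IS_{\omega_1}$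 (internally stationary sets) is the class of $M$ with $(M,\in)\models ZF^-$, $\omega_1\subseteq M$, $|M|=\omega_1$, such that $M\cap[M]^\omega$ is stationary in $[M]^\omega$. $GIS_{\omega_1}=G_{\omega_1}\cap IS_{\omega_1}$. Ideals. Here an ideal is an ideal $I\subset\wp(Z)$ with $Z=\wp_{\omega_2}(H_\theta)$ for some regular $\theta\ge\omega_2$, which is proper, countably complete, fine (for every $b\in H_\theta$, $\{M\in Z: b\notin M\}\in I$) and normal (if $S\notin I$ and $g$ is a function on $S$ with $g(M)\in M$ for all $M\in S$, then $g$ is constant on some $S'\subseteq S$ with $S'\notin I$). $\breve I$ is the dual filter. $I$ concentrates on a class $\Gamma$ iff some $A\subseteq\Gamma$ belongs to $\breve I$. The completeness of $I$ is the cardinal $\mu$ such that $I$ is closed under unions of fewer than $\mu$ of its members but not under unions of $\mu$ of its members. $I$, with completeness $\mu\subseteq H_\theta$, bounds its completeness iff for every $f:\mu\to\mu$ the set of $M\in Z$ with $otp(M\cap ORD)>f(M\cap\mu)$ belongs to $\breve I$ (note $M\cap\mu\in\mu$ for $\breve I$-almost all $M$). -}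

module Defs where

open import Data.Fin using (Fin)
open import Data.Nat using (ℕ; zero; suc)
open import Data.Product using (∃; ∃-syntax; _×_)
open import Data.Sum using (_⊎_)
open import Data.Vec using (Vec; _∷_; lookup)
open import Function.Bundles using (_⇔_)
open import Level using () renaming (suc to lsuc; _⊔_ to _⊔ˡ_)
open import Relation.Binary.PropositionalEquality using (_≡_; _≢_)
open import Relation.Nullary using (¬_)
open import Relation.Unary using (Pred; U)

-- Formulas of the language of set theory with n free variables (de Bruijn).
-- They serve only to state the axiom schemas of ZFC.
data Formula : ℕ → Set where
  _∈′_ _≡′_ : ∀ {n} → Fin n → Fin n → Formula n
  ¬′_       : ∀ {n} → Formula n → Formula n
  _∧′_      : ∀ {n} → Formula n → Formula n → Formula n
  ∃′_       : ∀ {n} → Formula (suc n) → Formula n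

-- A theorem of ZFC is rendered as a statement about all models of ZFC: V is
-- the universe of sets, classes are predicates on V, and everything said
-- about sets is said inside V.
record Structure ℓ : Set (lsuc ℓ) where
  infix 4 _∈_
  field
    V   : Set ℓ
    _∈_ : V → V → Set ℓ

module SetTheory {ℓ} (𝔐 : Structure ℓ) where
  open Structure 𝔐 public

  Class : Set (lsuc ℓ)
  Class = Pred V ℓ

  infix 4 _∉_ _⊆_

  _∉_ : V → V → Set ℓ
  x ∉ y = ¬ (x ∈ y)

  _⊆_ : V → V → Set ℓ
  x ⊆ y = ∀ z → z ∈ x → z ∈ y

  All∈ Ex∈ : V → Class → Set ℓ
  All∈ a P = ∀ x → x ∈ a → P x
  Ex∈ a P = ∃[ x ] (x ∈ a × P x)

  infix 2 All∈ Ex∈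
  syntax All∈ a (λ x → P) = ∀[ x ∈ a ] P
  syntax Ex∈ a (λ x → P) = ∃[ x ∈ a ] P

  ----------------------------------------------------------------------
  -- Axioms, relativised to a class D (D = U gives the axioms for V).

  module _ {d} (D : Pred V d) where

    Extensionality Foundation Pairing Union Infinity : Set (ℓ ⊔ˡ d)

    Extensionality = ∀ x y → D x → D y → (∀ z → D z → z ∈ x ⇔ z ∈ y) → x ≡ y

    Foundation = ∀ x → D x → (∃[ y ] (D y × y ∈ x)) →
      ∃[ y ] (D y × y ∈ x × (∀ z → D z → z ∈ y → z ∉ x))

    Pairing = ∀ a b → D a → D b →
      ∃[ p ] (D p × (∀ x → D x → x ∈ p ⇔ (x ≡ a ⊎ x ≡ b)))

    Union = ∀ a → D a →
      ∃[ u ] (D u × (∀ x → D x → x ∈ u ⇔ (∃[ y ] (D y × y ∈ a × x ∈ y))))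

    Infinity = ∃[ i ] (D i
      × (∃[ e ] (D e × e ∈ i × (∀ x → D x → x ∉ e)))
      × (∀ x → D x → x ∈ i →
           ∃[ y ] (D y × y ∈ i × (∀ z → D z → z ∈ y ⇔ (z ∈ x ⊎ z ≡ x)))))

    Separation : Class → Set (ℓ ⊔ˡ d)
    Separation P = ∀ a → D a →
      ∃[ b ] (D b × (∀ x → D x → x ∈ b ⇔ (x ∈ a × P x)))

    Replacement : (V → V → Set ℓ) → Set (ℓ ⊔ˡ d)
    Replacement R = ∀ a → D a →
      (∀ x y y′ → D x → D y → D y′ → x ∈ a → R x y → R x y′ → y ≡ y′) →
      ∃[ b ] (D b × (∀ y → D y → y ∈ b ⇔ (∃[ x ] (D x × x ∈ a × R x y))))

  PowerSet : Set ℓ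
  PowerSet = ∀ a → ∃[ p ] (∀ x → x ∈ p ⇔ x ⊆ a)

  -- Every set of nonempty pairwise disjoint sets has a transversal.
  Choice : Set ℓ
  Choice = ∀ a →
    (∀[ x ∈ a ] ∃[ y ] y ∈ x) →
    (∀[ x ∈ a ] ∀[ x′ ∈ a ] ∀ y → y ∈ x → y ∈ x′ → x ≡ x′) →
    ∃[ t ] (∀[ x ∈ a ] ∃[ y ] ((y ∈ x × y ∈ t) × (∀ z → z ∈ x → z ∈ t → z ≡ y)))

  ⟦_⟧ : ∀ {n} → Formula n → Vec V n → Set ℓ
  ⟦ i ∈′ j ⟧ ρ = lookup ρ i ∈ lookup ρ j
  ⟦ i ≡′ j ⟧ ρ = lookup ρ i ≡ lookup ρ j
  ⟦ ¬′ φ ⟧   ρ = ¬ ⟦ φ ⟧ ρ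
  ⟦ φ ∧′ ψ ⟧ ρ = ⟦ φ ⟧ ρ × ⟦ ψ ⟧ ρ
  ⟦ ∃′ φ ⟧   ρ = ∃[ x ] ⟦ φ ⟧ (x ∷ ρ)

  record ZFC : Set ℓ where
    field
      extensionality : Extensionality U
      foundation     : Foundation U
      pairing        : Pairing U
      union          : Union U
      infinity       : Infinity U
      powerSet       : PowerSet
      separation     : ∀ {n} (φ : Formula (suc n)) (ρ : Vec V n) →
                       Separation U (λ x → ⟦ φ ⟧ (x ∷ ρ))
      replacement    : ∀ {n} (φ : Formula (suc (suc n))) (ρ : Vec V n) →
                       Replacement U (λ x y → ⟦ φ ⟧ (x ∷ y ∷ ρ))
      choice         : Choice

  ----------------------------------------------------------------------
  -- Sets given by a defining property are described by predicates
  -- "IsX x …": the set x is the object X.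

  IsSetOf : V → Class → Set ℓ
  IsSetOf a P = ∀ x → x ∈ a ⇔ P x

  IsEmpty : V → Set ℓ
  IsEmpty a = ∀ x → x ∉ a

  IsSuc : V → V → Set ℓ
  IsSuc b a = IsSetOf b (λ x → x ∈ a ⊎ x ≡ a)

  IsUnion : V → V → Set ℓ
  IsUnion u a = IsSetOf u (λ x → ∃[ y ∈ a ] x ∈ y)

  IsIntersection : V → V → V → Set ℓ
  IsIntersection c a b = IsSetOf c (λ x → x ∈ a × x ∈ b)

  IsUnorderedPair : V → V → V → Set ℓ
  IsUnorderedPair p a b = IsSetOf p (λ x → x ≡ a ⊎ x ≡ b)

  -- Kuratowski pair p = {{a},{a,b}}.
  IsPair : V → V → V → Set ℓ
  IsPair p a b = ∃[ s ] ∃[ d ]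
    (IsUnorderedPair s a a × IsUnorderedPair d a b × IsUnorderedPair p s d)

  infix 4 ⟨_,_⟩∈_
  ⟨_,_⟩∈_ : V → V → V → Set ℓ
  ⟨ a , b ⟩∈ r = ∃[ p ∈ r ] IsPair p a b

  FunctionOn : V → V → Set ℓ
  FunctionOn a f =
      (∀[ p ∈ f ] ∃[ x ∈ a ] ∃[ y ] IsPair p x y)
    × (∀[ x ∈ a ] ∃[ y ] ⟨ x , y ⟩∈ f)
    × (∀ x y y′ → ⟨ x , y ⟩∈ f → ⟨ x , y′ ⟩∈ f → y ≡ y′)

  Function : V → V → V → Set ℓ
  Function a b f = FunctionOn a f × (∀ x y → ⟨ x , y ⟩∈ f → y ∈ b)

  Injection : V → V → V → Set ℓ
  Injection a b f = Function a b f
    × (∀ x x′ y → ⟨ x , y ⟩∈ f → ⟨ x′ , y ⟩∈ f → x ≡ x′)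

  Bijection : V → V → V → Set ℓ
  Bijection a b f = Injection a b f × (∀[ y ∈ b ] ∃[ x ] ⟨ x , y ⟩∈ f)

  ----------------------------------------------------------------------
  -- Ordinals and cardinals

  Transitive : V → Set ℓ
  Transitive a = ∀[ x ∈ a ] x ⊆ a

  -- By Foundation, ∈ well-orders such a set.
  Ordinal : Class
  Ordinal α = Transitive α × (∀[ x ∈ α ] ∀[ y ∈ α ] (x ∈ y ⊎ x ≡ y ⊎ y ∈ x))

  Limit : Class
  Limit δ = Ordinal δ × (∃[ α ] α ∈ δ) × (∀[ α ∈ δ ] ∃[ β ∈ δ ] α ∈ β)

  SameSize : V → V → Set ℓ
  SameSize a b = ∃[ f ] Bijection a b f

  Cardinal : Class
  Cardinal κ = Ordinal κ × (∀[ α ∈ κ ] ¬ SameSize α κ)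

  -- |a| < κ, for κ a cardinal.
  Smaller : V → V → Set ℓ
  Smaller a κ = ∃[ α ∈ κ ] SameSize a α

  IsSuccessorCardinal : V → V → Set ℓ
  IsSuccessorCardinal ν κ =
    Cardinal ν × κ ∈ ν × (∀[ α ∈ ν ] (κ ∈ α → ¬ Cardinal α))

  Inductive : Class
  Inductive i = (∀ e → IsEmpty e → e ∈ i)
              × (∀[ x ∈ i ] ∀ y → IsSuc y x → y ∈ i)

  IsOmega : Class
  IsOmega w = Inductive w × (∀ i → Inductive i → w ⊆ i)

  IsTransitiveClosure : V → V → Set ℓ
  IsTransitiveClosure t x =
    x ⊆ t × Transitive t × (∀ u → x ⊆ u → Transitive u → t ⊆ u)

  -- h = H_θ
  IsH : V → V → Set ℓ
  IsH θ h = IsSetOf h (λ x → ∃[ t ] (IsTransitiveClosure t x × Smaller t θ))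

  -- α is the order type of the class A under R.
  IsOrderType : V → Class → (V → V → Set ℓ) → Set ℓ
  IsOrderType α A R = Ordinal α × (∃[ f ]
    ( FunctionOn α f
    × (∀ ξ y → ⟨ ξ , y ⟩∈ f → A y)
    × (∀ y → A y → ∃[ ξ ] ⟨ ξ , y ⟩∈ f)
    × (∀ ξ η x y → ⟨ ξ , x ⟩∈ f → ⟨ η , y ⟩∈ f → (x ≡ y → ξ ≡ η) × (ξ ∈ η ⇔ R x y))))

  ----------------------------------------------------------------------
  -- Formulas coded as sets of V: variables are elements of ω, and formulas
  -- v_i ∈ v_j, v_i = v_j, ¬φ, φ ∧ ψ, ∃v_i φ are coded by
  -- ⟨0,⟨i,j⟩⟩, ⟨1,⟨i,j⟩⟩, ⟨2,φ⟩, ⟨3,⟨φ,ψ⟩⟩, ⟨4,⟨i,φ⟩⟩.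

  IsNumeral : ℕ → Class
  IsNumeral zero    x = IsEmpty x
  IsNumeral (suc n) x = ∃[ y ] (IsNumeral n y × IsSuc x y)

  Tagged : ℕ → V → V → Set ℓ
  Tagged n c b = ∃[ k ] (IsNumeral n k × IsPair c k b)

  Tagged₂ : ℕ → V → V → V → Set ℓ
  Tagged₂ n c a b = ∃[ p ] (IsPair p a b × Tagged n c p)

  Code∈ Code≡ Code∧ Code∃ : V → V → V → Set ℓ
  Code∈ = Tagged₂ 0
  Code≡ = Tagged₂ 1
  Code∧ = Tagged₂ 3
  Code∃ = Tagged₂ 4

  Code¬ : V → V → Set ℓ
  Code¬ = Tagged 2

  module Alephs (ω ω₁ ω₂ : V) where

    record FormulaClosed (F : V) : Set ℓ where
      field
        mem  : ∀ c → ∀[ i ∈ ω ] ∀[ j ∈ ω ] (Code∈ c i j → c ∈ F)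
        eq   : ∀ c → ∀[ i ∈ ω ] ∀[ j ∈ ω ] (Code≡ c i j → c ∈ F)
        neg  : ∀ c → ∀[ φ ∈ F ] (Code¬ c φ → c ∈ F)
        conj : ∀ c → ∀[ φ ∈ F ] ∀[ ψ ∈ F ] (Code∧ c φ ψ → c ∈ F)
        ex   : ∀ c → ∀[ i ∈ ω ] ∀[ φ ∈ F ] (Code∃ c i φ → c ∈ F)

    IsFormula : Class
    IsFormula φ = ∀ F → FormulaClosed F → φ ∈ F

    Assignment : V → Class
    Assignment A s = Function ω A s

    -- s′ = s[i ↦ a]
    IsUpdate : V → V → V → V → V → Set ℓ
    IsUpdate A s′ s i a = Assignment A s′ × ⟨ i , a ⟩∈ s′
      × (∀[ j ∈ ω ] (j ≢ i → ∀ y → ⟨ j , y ⟩∈ s ⇔ ⟨ j , y ⟩∈ s′))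

    -- T is a satisfaction relation for the structure (A, ∈).
    record IsSatisfaction (A T : V) : Set ℓ where
      field
        mem  : ∀ c s → Assignment A s → ∀[ i ∈ ω ] ∀[ j ∈ ω ] (Code∈ c i j →
               ⟨ c , s ⟩∈ T ⇔ (∃[ x ] ∃[ y ] (⟨ i , x ⟩∈ s × ⟨ j , y ⟩∈ s × x ∈ y)))
        eq   : ∀ c s → Assignment A s → ∀[ i ∈ ω ] ∀[ j ∈ ω ] (Code≡ c i j →
               ⟨ c , s ⟩∈ T ⇔ (∃[ x ] ∃[ y ] (⟨ i , x ⟩∈ s × ⟨ j , y ⟩∈ s × x ≡ y)))
        neg  : ∀ c s → Assignment A s → ∀ φ → IsFormula φ → Code¬ c φ →
               ⟨ c , s ⟩∈ T ⇔ (¬ ⟨ φ , s ⟩∈ T)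
        conj : ∀ c s → Assignment A s → ∀ φ ψ → IsFormula φ → IsFormula ψ → Code∧ c φ ψ →
               ⟨ c , s ⟩∈ T ⇔ (⟨ φ , s ⟩∈ T × ⟨ ψ , s ⟩∈ T)
        ex   : ∀ c s → Assignment A s → ∀[ i ∈ ω ] ∀ φ → IsFormula φ → Code∃ c i φ →
               ⟨ c , s ⟩∈ T ⇔ (∃[ a ∈ A ] ∃[ s′ ] (IsUpdate A s′ s i a × ⟨ φ , s′ ⟩∈ T))

    infix 4 _⊨_[_] _≺_

    _⊨_[_] : V → V → V → Set ℓ
    A ⊨ φ [ s ] = ∃[ T ] (IsSatisfaction A T × ⟨ φ , s ⟩∈ T)

    -- Nonemptiness is not automatic: there are no assignments into ∅.
    _≺_ : V → V → Set ℓ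
    M ≺ H = M ⊆ H × (∃[ x ] x ∈ M)
      × (∀ φ s → IsFormula φ → Assignment M s → (M ⊨ φ [ s ]) ⇔ (H ⊨ φ [ s ]))

    -- (M, ∈) ⊨ ZF⁻; M need not be transitive.
    record ZF⁻ (M : V) : Set ℓ where
      field
        extensionality : Extensionality (_∈ M)
        foundation     : Foundation (_∈ M)
        pairing        : Pairing (_∈ M)
        union          : Union (_∈ M)
        infinity       : Infinity (_∈ M)
        separation     : ∀ φ s → IsFormula φ → Assignment M s → ∀[ i ∈ ω ]
          Separation (_∈ M) (λ x → ∃[ s′ ] (IsUpdate M s′ s i x × M ⊨ φ [ s′ ]))
        replacement    : ∀ φ s → IsFormula φ → Assignment M s → ∀[ i ∈ ω ] ∀[ j ∈ ω ] (i ≢ j →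
          Replacement (_∈ M) (λ x y → ∃[ s′ ] ∃[ s″ ]
            (IsUpdate M s′ s i x × IsUpdate M s″ s′ j y × M ⊨ φ [ s″ ])))

    --------------------------------------------------------------------
    -- Clubs and stationary sets

    Countable : Class
    Countable a = ∃[ f ] Injection a ω f

    [_]^ω : V → Class
    [ X ]^ω x = x ⊆ X × Countable x

    record Club (X C : V) : Set ℓ where
      field
        subset   : ∀[ x ∈ C ] [ X ]^ω x
        cofinal  : ∀ x → [ X ]^ω x → ∃[ c ∈ C ] x ⊆ c
        closed   : ∀ D → D ⊆ C → Countable D → (∃[ x ] x ∈ D) →
                   (∀[ x ∈ D ] ∀[ y ∈ D ] (x ⊆ y ⊎ y ⊆ x)) →
                   ∀ u → IsUnion u D → u ∈ C

    -- The set {Y ∈ [X]^ω : S Y} is stationary in [X]^ω.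
    Stationary : V → Class → Set ℓ
    Stationary X S = ∀ C → Club X C → ∃[ Y ∈ C ] S Y

    record Club₁ (C : V) : Set ℓ where
      field
        subset    : C ⊆ ω₁
        unbounded : ∀[ α ∈ ω₁ ] ∃[ β ∈ C ] α ∈ β
        closed    : ∀[ δ ∈ ω₁ ] (Limit δ → (∀[ α ∈ δ ] ∃[ β ∈ C ] (α ∈ β × β ∈ δ)) → δ ∈ C)

    Stationary₁ : Class
    Stationary₁ T = T ⊆ ω₁ × (∀ C → Club₁ C → ∃[ α ∈ C ] α ∈ T)

    ProjectiveStationary : V → V → Set ℓ
    ProjectiveStationary X P = (∀[ Y ∈ P ] [ X ]^ω Y) × (∀ T → Stationary₁ T →
      Stationary X (λ Y → Y ∈ P × (∃[ α ∈ T ] IsIntersection α Y ω₁)))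

    --------------------------------------------------------------------
    -- SRP(ω₂)

    -- The function N on ω₁ is a continuous elementary chain in H.
    record ContinuousElementaryChain (H N : V) : Set ℓ where
      field
        function   : FunctionOn ω₁ N
        elementary : ∀ ξ M → ⟨ ξ , M ⟩∈ N → Countable M × M ≺ H
        successor  : ∀ ξ ξ⁺ M M⁺ → IsSuc ξ⁺ ξ → ⟨ ξ , M ⟩∈ N → ⟨ ξ⁺ , M⁺ ⟩∈ N →
                     M ∈ M⁺ × M ⊆ M⁺
        limit      : ∀ ξ M → Limit ξ → ⟨ ξ , M ⟩∈ N →
                     IsSetOf M (λ x → ∃[ ζ ∈ ξ ] ∃[ K ] (⟨ ζ , K ⟩∈ N × x ∈ K))

    SRP[ω₂] : Set ℓ
    SRP[ω₂] = ∀ h → IsH ω₂ h → ∀ P → ProjectiveStationary h P →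
      ∃[ N ] (ContinuousElementaryChain h N × (∀ ξ M → ⟨ ξ , M ⟩∈ N → M ∈ P))

    --------------------------------------------------------------------
    -- Tree property at ω₂

    Predecessors : V → V → V → Class
    Predecessors T r x y = y ∈ T × ⟨ y , x ⟩∈ r

    record IsTree (T r : V) : Set ℓ where
      field
        onT         : ∀ x y → ⟨ x , y ⟩∈ r → x ∈ T × y ∈ T
        irreflexive : ∀[ x ∈ T ] ¬ (⟨ x , x ⟩∈ r)
        transitive  : ∀ x y z → ⟨ x , y ⟩∈ r → ⟨ y , z ⟩∈ r → ⟨ x , z ⟩∈ r
        linear      : ∀[ x ∈ T ] ∀ y z → Predecessors T r x y → Predecessors T r x z →
                      ⟨ y , z ⟩∈ r ⊎ y ≡ z ⊎ ⟨ z , y ⟩∈ r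
        wellFounded : ∀[ x ∈ T ] ∀ u → (∀[ y ∈ u ] Predecessors T r x y) →
                      (∃[ y ] y ∈ u) → ∃[ y ∈ u ] ∀[ z ∈ u ] ¬ (⟨ z , y ⟩∈ r)

    Level : V → V → V → Class
    Level T r α x = x ∈ T × IsOrderType α (Predecessors T r x) (λ y z → ⟨ y , z ⟩∈ r)

    Height-ω₂ : V → V → Set ℓ
    Height-ω₂ T r = (∀[ α ∈ ω₂ ] ∃[ x ] Level T r α x)
                  × (∀[ x ∈ T ] ∃[ α ∈ ω₂ ] Level T r α x)

    Comparable : V → V → V → Set ℓ
    Comparable r x y = ⟨ x , y ⟩∈ r ⊎ x ≡ y ⊎ ⟨ y , x ⟩∈ r

    -- A maximal chain of T meeting every level α < ω₂.
    record CofinalBranch (T r b : V) : Set ℓ where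
      field
        subset  : b ⊆ T
        chain   : ∀[ x ∈ b ] ∀[ y ∈ b ] Comparable r x y
        maximal : ∀[ x ∈ T ] ((∀[ y ∈ b ] Comparable r x y) → x ∈ b)
        cofinal : ∀[ α ∈ ω₂ ] ∃[ x ∈ b ] Level T r α x

    TreeProperty[ω₂] : Set ℓ
    TreeProperty[ω₂] = ∀ T r → IsTree T r → Height-ω₂ T r →
      (∀[ α ∈ ω₂ ] ∃[ l ] (IsSetOf l (Level T r α) × Smaller l ω₂)) →
      ∃[ b ] CofinalBranch T r b

    --------------------------------------------------------------------
    -- GIS_{ω₁}

    Regular : Class
    Regular θ = Cardinal θ × ω ⊆ θ
      × (∀[ α ∈ θ ] ∀ f → Function α θ f → ∃[ β ∈ θ ] ∀ ξ γ → ⟨ ξ , γ ⟩∈ f → γ ∈ β)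

    -- H is the image of M under π(x) = {π(u) : u ∈ x ∩ M}.
    IsTransitiveCollapse : V → V → Set ℓ
    IsTransitiveCollapse M H = ∃[ π ]
      ( FunctionOn M π
      × (∀ x y → ⟨ x , y ⟩∈ π → IsSetOf y (λ z → ∃[ u ∈ M ] (u ∈ x × ⟨ u , z ⟩∈ π)))
      × IsSetOf H (λ z → ∃[ u ] ⟨ u , z ⟩∈ π))

    -- z is countable in H, for H a transitive model of ZF⁻ (being an injection
    -- into ω is absolute for such H).
    CountableIn : V → V → Set ℓ
    CountableIn H z = ∃[ f ∈ H ] Injection z ω f

    record ω₁-Approximation (H : V) : Set ℓ where
      field
        transitive : Transitive H
        model      : ZF⁻ H
        ω₁∈H       : ω₁ ∈ H
        approx     : ∀[ η ∈ H ] ∀ A → A ⊆ η →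
                     (∀[ z ∈ H ] (CountableIn H z → ∃[ w ∈ H ] IsIntersection w z A)) →
                     A ∈ H

    ω₁-Guessing : Class
    ω₁-Guessing M =
        (∃[ θ ] ∃[ h ] (Regular θ × ω ∈ θ × IsH θ h × ω₁ ⊆ M × M ≺ h))
      × (∃[ H ] (IsTransitiveCollapse M H × ω₁-Approximation H))

    G : Class
    G M = ω₁-Guessing M × SameSize M ω₁ × ω₁ ⊆ M

    IS : Class
    IS M = ZF⁻ M × ω₁ ⊆ M × SameSize M ω₁ × Stationary M (λ Y → Y ∈ M × [ M ]^ω Y)

    GIS : Class
    GIS M = G M × IS M

    --------------------------------------------------------------------
    -- Ideals

    -- I is an ideal on Z = ℘_{ω₂}(h), where h = H_θ.
    record IsIdeal (θ h Z I : V) : Set ℓ where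
      field
        regular           : Regular θ
        ω₂≤θ              : ω₂ ⊆ θ
        isH               : IsH θ h
        base              : IsSetOf Z (λ M → M ⊆ h × Smaller M ω₂)
        subsets           : ∀[ S ∈ I ] S ⊆ Z
        empty             : ∀ S → IsEmpty S → S ∈ I
        downward          : ∀[ S ∈ I ] ∀ S′ → S′ ⊆ S → S′ ∈ I
        unions            : ∀[ S ∈ I ] ∀[ S′ ∈ I ] ∀ u →
                            IsSetOf u (λ M → M ∈ S ⊎ M ∈ S′) → u ∈ I
        proper            : Z ∉ I
        countablyComplete : ∀ D → D ⊆ I → Countable D → ∀ u → IsUnion u D → u ∈ I
        fine              : ∀[ b ∈ h ] ∃[ S ∈ I ] IsSetOf S (λ M → M ∈ Z × b ∉ M)
        normal            : ∀ S → S ⊆ Z → S ∉ I → ∀ g → FunctionOn S g →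
                            (∀ M y → ⟨ M , y ⟩∈ g → y ∈ M) →
                            ∃[ S′ ] (S′ ⊆ S × S′ ∉ I × (∃[ c ] ∀[ M ∈ S′ ] ⟨ M , c ⟩∈ g))

    DualFilter : V → V → Class
    DualFilter Z I A = A ⊆ Z × (∃[ S ∈ I ] IsSetOf S (λ M → M ∈ Z × M ∉ A))

    ConcentratesOn : V → V → Class → Set ℓ
    ConcentratesOn Z I Γ = ∃[ A ] (DualFilter Z I A × (∀[ M ∈ A ] Γ M))

    IsCompleteness : V → V → Set ℓ
    IsCompleteness I μ = Cardinal μ
      × (∀ D → D ⊆ I → Smaller D μ → ∀ u → IsUnion u D → u ∈ I)
      × ¬ (∀ D → D ⊆ I → SameSize D μ → ∀ u → IsUnion u D → u ∈ I)

    -- otp(M ∩ ORD) > f(M ∩ μ), which includes M ∩ μ ∈ μ = dom f.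
    OrderTypeExceeds : V → V → Class
    OrderTypeExceeds μ f M = ∃[ κ ∈ μ ] ∃[ β ] ∃[ o ]
      ( IsIntersection κ M μ
      × ⟨ κ , β ⟩∈ f
      × IsOrderType o (λ x → x ∈ M × Ordinal x) _∈_
      × β ∈ o )

    BoundsCompleteness : V → V → V → Set ℓ
    BoundsCompleteness h Z I = ∃[ μ ] (IsCompleteness I μ × μ ⊆ h ×
      (∀ f → Function μ μ f →
        ∃[ A ] (DualFilter Z I A × IsSetOf A (λ M → M ∈ Z × OrderTypeExceeds μ f M))))

-- Say that P holds for almost all M if the set of M where it fails is in the ideal. Normality makes almost all
-- M closed under any definable set function, and bounding its completeness forces M ∩ ω₂ to be an ordinal below
-- ω₂ from which M can be measured; so ω₂ is regular and every element of H(ω₂) lies in almost all M.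
-- Fix for each δ < ω₂ an injection into ω₁; it cuts δ into countable pieces. SRP(ω₂) implies that a family of sets
-- of ordinals that captures stationarily many pieces of every α < ω₂ contains 2^ω subsets of one α: press down on
-- the closures of points of cofinality ω and follow the branches of the resulting binary tree.
-- Applied to the pieces themselves this gives 2^ω ≤ ω₂, so that a model M of the ideal is determined, as far as
-- countable sets of ordinals below it go, by M ∩ ω₂. By the approximation property the subsets of β in the collapse
-- of M are then determined by the stationary set of i for which the i-th piece of β is countable in the collapse,
-- and two such sets that meet stationarily often come from the same collapse; a second use of SRP(ω₂) shows that
-- at each β there are at most ω₁ of them. A last application, to the sets of the collapses, puts all reals into
-- some M; then approximation puts every subset of ω₁ into a collapse of size ω₁, contradicting Cantor's theorem.
module Submission where

open import Axiom.ExcludedMiddle using (ExcludedMiddle)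
open import Data.Empty using (⊥; ⊥-elim)
open import Data.Fin using (Fin; zero; suc; _↑ˡ_; _↑ʳ_)
open import Data.Nat using (ℕ; zero; suc; _+_)
open import Data.Product using (Σ; ∃-syntax; _×_; _,_; proj₁; proj₂)
open import Data.Sum using (_⊎_; inj₁; inj₂; [_,_]′)
open import Data.Unit.Polymorphic using (⊤; tt)
open import Data.Vec using (Vec; []; _∷_; lookup; _++_)
open import Data.Vec.Properties using (lookup-++ˡ; lookup-++ʳ)
open import Function using (_∘_; id)
open import Function.Bundles using (_⇔_; mk⇔; Equivalence)
open import Function.Construct.Composition using (_⇔-∘_)
open import Relation.Binary.PropositionalEquality using (_≡_; _≢_; refl; sym; trans; subst)
open import Relation.Nullary using (¬_; yes; no)
open import Defs

-- The bound on the completeness is used a second time, to fix one κ: if for each κ < ω₂ some height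
-- f(κ) < ω₂ were missed by all collapses of models M with M ∩ ω₂ = κ, then f would contradict the
-- bound. So one κ carries models of every height below ω₂. They contain the same countable subsets
-- of ω₁, which makes their collapses comparable. That all reals fit into one M is a count. Coded in
-- the collapses over κ, they become subsets of a single α < ω₂. There are at most ω₁ ordinals β ≤
-- α, at each β at most ω₁ recorded stationary sets, and each of these determines one family of at
-- most ω₁ subsets of β; a model that contains α contains everything listed in this way.
-- Stationarity in ω₁ and ω₂ is handled through closed points of total relations (`Meets`), because
-- a diagonal intersection is then again given by one relation. The axiom schemas speak of formulas
-- while the arguments speak of Agda predicates, so every use of separation or choice needs a
-- formula; instance search supplies it.

infix 0 case_of_

case_of_ : ∀ {a b} {A : Set a} {B : Set b} → A → (A → B) → B
case x of f = f x

module _ {ℓ} {A B : Set ℓ} where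
  to : A ⇔ B → A → B
  to = Equivalence.to

  from : A ⇔ B → B → A
  from = Equivalence.from

-- Definable predicates, with formulas found by instance search

module Definability {ℓ} (em : ExcludedMiddle ℓ) (𝔐 : Structure ℓ) (v : Structure.V 𝔐) where
  open SetTheory 𝔐

  byContra : {A : Set ℓ} → ¬ ¬ A → A
  byContra {A} nna with em {A}
  ... | yes a = a
  ... | no na = ⊥-elim (nna na)

  ext : ∀ {m n} → (Fin m → Fin n) → Fin (suc m) → Fin (suc n)
  ext f zero    = zero
  ext f (suc i) = suc (f i)

  ren : ∀ {m n} → (Fin m → Fin n) → Formula m → Formula n
  ren f (i ∈′ j) = f i ∈′ f j
  ren f (i ≡′ j) = f i ≡′ f j
  ren f (¬′ φ)   = ¬′ ren f φ
  ren f (φ ∧′ ψ) = ren f φ ∧′ ren f ψ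
  ren f (∃′ φ)   = ∃′ ren (ext f) φ

  ⟦ren⟧ : ∀ {m n} (f : Fin m → Fin n) (φ : Formula m) {ρ : Vec V n} {σ : Vec V m} →
          (∀ i → lookup ρ (f i) ≡ lookup σ i) → ⟦ ren f φ ⟧ ρ ⇔ ⟦ φ ⟧ σ
  ⟦ren⟧ f (i ∈′ j) h rewrite h i | h j = mk⇔ id id
  ⟦ren⟧ f (i ≡′ j) h rewrite h i | h j = mk⇔ id id
  ⟦ren⟧ f (¬′ φ) h = let e = ⟦ren⟧ f φ h in mk⇔ (_∘ from e) (_∘ to e)
  ⟦ren⟧ f (φ ∧′ ψ) h = let e = ⟦ren⟧ f φ h; e′ = ⟦ren⟧ f ψ h in
    mk⇔ (λ (p , q) → to e p , to e′ q) (λ (p , q) → from e p , from e′ q)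
  ⟦ren⟧ f (∃′ φ) {ρ} {σ} h =
    mk⇔ (λ (x , p) → x , to (e x) p) (λ (x , p) → x , from (e x) p)
    where
    h′ : ∀ x i → lookup (x ∷ ρ) (ext f i) ≡ lookup (x ∷ σ) i
    h′ x zero    = refl
    h′ x (suc i) = h i
    e = λ x → ⟦ren⟧ (ext f) φ (h′ x)

  -- Environments are nested pairs rather than vectors so that, thanks to η,
  -- instance search can recognise the variables of a predicate.
  Env : ℕ → Set ℓ
  Env zero    = ⊤
  Env (suc n) = V × Env n

  vec : ∀ {n} → Env n → Vec V n
  vec {zero}  _       = []
  vec {suc n} (x , γ) = x ∷ vec γ

  record Def {n} (P : Env n → Set ℓ) : Set ℓ where
    constructor def
    field
      {m} : ℕ
      ps  : Vec V m
      φ   : Formula (n + m)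
      ok  : ∀ γ → ⟦ φ ⟧ (vec γ ++ ps) ⇔ P γ

  record Term {n} (t : Env n → V) : Set ℓ where
    constructor term
    field
      {m} : ℕ
      ps  : Vec V m
      i   : Fin (n + m)
      ok  : ∀ γ → lookup (vec γ ++ ps) i ≡ t γ

  opaque
    -- Opaque, so that its components stay neutral and `P pt` displays the outermost connective or
    -- atom of `P`.
    pt : ∀ {n} → Env n
    pt {zero}  = tt
    pt {suc n} = v , pt

  -- Instance search determines P from P pt, whose head symbol selects the candidates.
  record Is {n} (P : Env n → Set ℓ) (A : Set ℓ) : Set ℓ where
    constructor is
    field get : Def P

  open Is public

  -- When two formulas are combined, their parameter lists are concatenated behind the n shared
  -- variables; `inˡ` and `inʳ` rename into the two halves.
  inˡ : ∀ n {m m′} → Fin (n + m) → Fin (n + (m + m′))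
  inˡ zero    {m} {m′} i = i ↑ˡ m′
  inˡ (suc n) zero     = zero
  inˡ (suc n) (suc i)  = suc (inˡ n i)

  inʳ : ∀ n {m m′} → Fin (n + m′) → Fin (n + (m + m′))
  inʳ zero    {m} i   = m ↑ʳ i
  inʳ (suc n) zero    = zero
  inʳ (suc n) (suc i) = suc (inʳ n i)

  lookup-inˡ : ∀ {n m m′} (γ : Vec V n) (ps : Vec V m) (qs : Vec V m′) i →
               lookup (γ ++ (ps ++ qs)) (inˡ n i) ≡ lookup (γ ++ ps) i
  lookup-inˡ []      ps qs i       = lookup-++ˡ ps qs i
  lookup-inˡ (x ∷ γ) ps qs zero    = refl
  lookup-inˡ (x ∷ γ) ps qs (suc i) = lookup-inˡ γ ps qs i

  lookup-inʳ : ∀ {n m m′} (γ : Vec V n) (ps : Vec V m) (qs : Vec V m′) i →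
               lookup (γ ++ (ps ++ qs)) (inʳ n i) ≡ lookup (γ ++ qs) i
  lookup-inʳ []      ps qs i       = lookup-++ʳ ps qs i
  lookup-inʳ (x ∷ γ) ps qs zero    = refl
  lookup-inʳ (x ∷ γ) ps qs (suc i) = lookup-inʳ γ ps qs i

  variable
    n : ℕ

  opaque
    def-× : {P Q : Env n → Set ℓ} → Def P → Def Q → Def (λ γ → P γ × Q γ)
    def-× {n} (def ps φ ok) (def qs ψ ok′) = def (ps ++ qs) (ren (inˡ n) φ ∧′ ren (inʳ n) ψ) λ γ →
      let e  = ok γ  ⇔-∘ ⟦ren⟧ (inˡ n) φ (lookup-inˡ (vec γ) ps qs)
          e′ = ok′ γ ⇔-∘ ⟦ren⟧ (inʳ n) ψ (lookup-inʳ (vec γ) ps qs)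
      in mk⇔ (λ (p , q) → to e p , to e′ q) (λ (p , q) → from e p , from e′ q)

    def-¬ : {P : Env n → Set ℓ} → Def P → Def (λ γ → ¬ P γ)
    def-¬ (def ps φ ok) = def ps (¬′ φ) λ γ → mk⇔ (_∘ from (ok γ)) (_∘ to (ok γ))

    def-∃ : {P : V → Env n → Set ℓ} → Def {suc n} (λ γ → P (proj₁ γ) (proj₂ γ)) →
            Def (λ γ → Σ V (λ x → P x γ))
    def-∃ (def ps φ ok) = def ps (∃′ φ) λ γ →
      mk⇔ (λ (x , p) → x , to (ok (x , γ)) p) (λ (x , p) → x , from (ok (x , γ)) p)

    def-resp : {P Q : Env n → Set ℓ} → (∀ γ → P γ ⇔ Q γ) → Def P → Def Q
    def-resp h (def ps φ ok) = def ps φ λ γ → h γ ⇔-∘ ok γ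

    -- Formulas have only negation, conjunction and existence. The other connectives are replaced by
    -- classical equivalents, which is where excluded middle enters definability.
    def-→ : {P Q : Env n → Set ℓ} → Def P → Def Q → Def (λ γ → P γ → Q γ)
    def-→ d d′ = def-resp (λ γ → mk⇔ (λ h p → byContra λ nq → h (p , nq)) (λ h (p , nq) → nq (h p)))
      (def-¬ (def-× d (def-¬ d′)))

    def-∈ : {s t : Env n → V} → Term s → Term t → Def (λ γ → s γ ∈ t γ)
    def-∈ {n} {s} {t} (term ps i ok) (term qs j ok′) =
      def (ps ++ qs) (inˡ n i ∈′ inʳ n j) λ γ → subst (λ x → (x ∈ _) ⇔ _)
        (sym (trans (lookup-inˡ (vec γ) ps qs i) (ok γ))) (subst (λ y → (s γ ∈ y) ⇔ _)
        (sym (trans (lookup-inʳ (vec γ) ps qs j) (ok′ γ))) (mk⇔ id id))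

    def-≡ : {s t : Env n → V} → Term s → Term t → Def (λ γ → s γ ≡ t γ)
    def-≡ {n} {s} {t} (term ps i ok) (term qs j ok′) =
      def (ps ++ qs) (inˡ n i ≡′ inʳ n j) λ γ → subst (λ x → (x ≡ _) ⇔ _)
        (sym (trans (lookup-inˡ (vec γ) ps qs i) (ok γ))) (subst (λ y → (s γ ≡ y) ⇔ _)
        (sym (trans (lookup-inʳ (vec γ) ps qs j) (ok′ γ))) (mk⇔ id id))

    def-⊎ : {P Q : Env n → Set ℓ} → Def P → Def Q → Def (λ γ → P γ ⊎ Q γ)
    def-⊎ d d′ = def-resp (λ γ → mk⇔
      (λ h → byContra λ no → h ((λ p → no (inj₁ p)) , (λ q → no (inj₂ q))))
      [ (λ p (np , _) → np p) , (λ q (_ , nq) → nq q) ]′)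
      (def-¬ (def-× (def-¬ d) (def-¬ d′)))

    def-⇔ : {P Q : Env n → Set ℓ} → Def P → Def Q → Def (λ γ → P γ ⇔ Q γ)
    def-⇔ d d′ = def-resp (λ γ → mk⇔ (λ (f , g) → mk⇔ f g) (λ e → to e , from e))
      (def-× (def-→ d d′) (def-→ d′ d))

    def-∀ : {P : V → Env n → Set ℓ} → Def {suc n} (λ γ → P (proj₁ γ) (proj₂ γ)) → Def (λ γ → ∀ x → P x γ)
    def-∀ d = def-resp (λ γ → mk⇔ (λ h x → byContra λ np → h (x , np)) (λ h (x , np) → np (h x)))
      (def-¬ (def-∃ (def-¬ d)))

  record Sub {n k} (σ : Env n → Env k) : Set ℓ where
    constructor sub
    field
      {m} : ℕ
      ps  : Vec V m
      ix  : Fin k → Fin (n + m)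
      ok  : ∀ γ i → lookup (vec γ ++ ps) (ix i) ≡ lookup (vec (σ γ)) i

  nil : Sub {n} {0} (λ _ → tt)
  nil = sub [] (λ ()) λ _ ()

  cons : ∀ {k} {t : Env n → V} {σ : Env n → Env k} → Term t → Sub σ → Sub (λ γ → t γ , σ γ)
  cons {n} {k} {t} {σ} (term ps i ok) (sub qs ix ok′) = sub (ps ++ qs)
    (λ { zero → inˡ n i ; (suc j) → inʳ n (ix j) })
    λ { γ zero → trans (lookup-inˡ (vec γ) ps qs i) (ok γ)
      ; γ (suc j) → trans (lookup-inʳ (vec γ) ps qs (ix j)) (ok′ γ j) }

  -- Terms are only variables and parameters, so substituting them into a formula is a renaming.
  def-sub : ∀ {k} {R : Env k → Set ℓ} {σ : Env n → Env k} → Sub σ → Def R → Def (λ γ → R (σ γ))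
  def-sub {n} {k} {R} {σ} (sub qs ix ok) (def {m} ps φ ok′) =
    def (qs ++ ps) (ren f φ) λ γ → ok′ (σ γ) ⇔-∘ ⟦ren⟧ f φ (h γ)
    where
    split : ∀ k {m} {X : Set} → (Fin k → X) → (Fin m → X) → Fin (k + m) → X
    split zero    a b i       = b i
    split (suc k) a b zero    = a zero
    split (suc k) a b (suc i) = split k (λ j → a (suc j)) b i
    f : Fin (k + m) → Fin (n + (_ + m))
    f i = split k (λ j → inˡ n (ix j)) (λ j → inʳ n (n ↑ʳ j)) i
    h : ∀ γ i → lookup (vec γ ++ (qs ++ ps)) (f i) ≡ lookup (vec (σ γ) ++ ps) i
    h γ = go k (vec (σ γ)) _ _ (λ j → trans (lookup-inˡ (vec γ) qs ps (ix j)) (ok γ j))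
      (λ j → trans (lookup-inʳ (vec γ) qs ps (n ↑ʳ j)) (lookup-++ʳ (vec γ) ps j))
      where
      go : ∀ k (xs : Vec V k) (a : Fin k → Fin _) (b : Fin m → Fin _) →
           (∀ j → lookup (vec γ ++ (qs ++ ps)) (a j) ≡ lookup xs j) →
           (∀ j → lookup (vec γ ++ (qs ++ ps)) (b j) ≡ lookup ps j) →
           ∀ i → lookup (vec γ ++ (qs ++ ps)) (split k a b i) ≡ lookup (xs ++ ps) i
      go zero    []       a b p q i       = q i
      go (suc k) (x ∷ xs) a b p q zero    = p zero
      go (suc k) (x ∷ xs) a b p q (suc i) = go k xs _ b (λ j → p (suc j)) q i

  Def₁ : (V → Set ℓ) → Set ℓ
  Def₁ P = Def {1} (λ γ → P (proj₁ γ))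

  Def₂ : (V → V → Set ℓ) → Set ℓ
  Def₂ R = Def {2} (λ γ → R (proj₁ γ) (proj₁ (proj₂ γ)))

  Def₃ : (V → V → V → Set ℓ) → Set ℓ
  Def₃ R = Def {3} (λ γ → R (proj₁ γ) (proj₁ (proj₂ γ)) (proj₁ (proj₂ (proj₂ γ))))

  -- A definable predicate may be used as an atom, in particular on the left of _×_ and _→_, which have
  -- one instance per head symbol of their left argument to keep them apart from the quantifiers over V.
  module _ {P : V → Set ℓ} (d : Def₁ P) where
    Atom₁ : Set _
    Atom₁ = ∀ {n} {s : Env n → V} → {{Term s}} → Is (λ γ → P (s γ)) (P (s pt))

    opaque
      atom₁ : Atom₁
      atom₁ {{a}} = is (def-sub (cons a nil) d)

  module _ {R : V → V → Set ℓ} (d : Def₂ R) where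
    Atom₂ Atom₂× Atom₂→ : Set _
    Atom₂  = ∀ {n} {s t : Env n → V} → {{Term s}} → {{Term t}} → Is (λ γ → R (s γ) (t γ)) (R (s pt) (t pt))
    Atom₂× = ∀ {n} {s t : Env n → V} {Q : Env n → Set ℓ} → {{Term s}} → {{Term t}} → {{Is Q (Q pt)}} →
             Is (λ γ → R (s γ) (t γ) × Q γ) (R (s pt) (t pt) × Q pt)
    Atom₂→ = ∀ {n} {s t : Env n → V} {Q : Env n → Set ℓ} → {{Term s}} → {{Term t}} → {{Is Q (Q pt)}} →
             Is (λ γ → R (s γ) (t γ) → Q γ) (R (s pt) (t pt) → Q pt)

    opaque
      atom₂ : Atom₂
      atom₂ {{a}} {{b}} = is (def-sub (cons a (cons b nil)) d)

      atom₂× : Atom₂×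
      atom₂× {{_}} {{_}} {{e}} = is (def-× (get atom₂) (get e))

      atom₂→ : Atom₂→
      atom₂→ {{_}} {{_}} {{e}} = is (def-→ (get atom₂) (get e))

  module _ {R : V → V → V → Set ℓ} (d : Def₃ R) where
    Atom₃ Atom₃× Atom₃→ : Set _
    Atom₃  = ∀ {n} {s t u : Env n → V} → {{Term s}} → {{Term t}} → {{Term u}} → Is (λ γ → R (s γ) (t γ) (u γ)) (R (s pt) (t pt) (u pt))
    Atom₃× = ∀ {n} {s t u : Env n → V} {Q : Env n → Set ℓ} → {{Term s}} → {{Term t}} → {{Term u}} → {{Is Q (Q pt)}} →
             Is (λ γ → R (s γ) (t γ) (u γ) × Q γ) (R (s pt) (t pt) (u pt) × Q pt)
    Atom₃→ = ∀ {n} {s t u : Env n → V} {Q : Env n → Set ℓ} → {{Term s}} → {{Term t}} → {{Term u}} → {{Is Q (Q pt)}} →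
             Is (λ γ → R (s γ) (t γ) (u γ) → Q γ) (R (s pt) (t pt) (u pt) → Q pt)

    opaque
      atom₃ : Atom₃
      atom₃ {{a}} {{b}} {{c}} = is (def-sub (cons a (cons b (cons c nil))) d)

      atom₃× : Atom₃×
      atom₃× {{_}} {{_}} {{_}} {{e}} = is (def-× (get atom₃) (get e))

      atom₃→ : Atom₃→
      atom₃→ {{_}} {{_}} {{_}} {{e}} = is (def-→ (get atom₃) (get e))

  instance
    i-Def : {P : Env n → Set ℓ} → {{Is P (P pt)}} → Def P
    i-Def {{d}} = get d

  opaque
    instance
      i∈ : {s t : Env n → V} → {{Term s}} → {{Term t}} → Is (λ γ → s γ ∈ t γ) (s pt ∈ t pt)
      i∈ {{a}} {{b}} = is (def-∈ a b)

      i≡ : {s t : Env n → V} → {{Term s}} → {{Term t}} → Is (λ γ → s γ ≡ t γ) (s pt ≡ t pt)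
      i≡ {{a}} {{b}} = is (def-≡ a b)

      i¬ : {P : Env n → Set ℓ} → {{Is P (P pt)}} → Is (λ γ → ¬ P γ) (¬ P pt)
      i¬ {{d}} = is (def-¬ (get d))

      i⊎ : {P Q : Env n → Set ℓ} → {{Is P (P pt)}} → {{Is Q (Q pt)}} → Is (λ γ → P γ ⊎ Q γ) (P pt ⊎ Q pt)
      i⊎ {{d}} {{e}} = is (def-⊎ (get d) (get e))

      i⇔ : {P Q : Env n → Set ℓ} → {{Is P (P pt)}} → {{Is Q (Q pt)}} → Is (λ γ → P γ ⇔ Q γ) (P pt ⇔ Q pt)
      i⇔ {{d}} {{e}} = is (def-⇔ (get d) (get e))

      i∃ : {P : V → Env n → Set ℓ} → {{Is {suc n} (λ γ → P (proj₁ γ) (proj₂ γ)) (P (proj₁ (pt {suc n})) (proj₂ (pt {suc n})))}} →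
           Is (λ γ → Σ V (λ x → P x γ)) (Σ V (λ x → P x pt))
      i∃ {{d}} = is (def-∃ (get d))

      i∀ : {P : V → Env n → Set ℓ} → {{Is {suc n} (λ γ → P (proj₁ γ) (proj₂ γ)) (P (proj₁ (pt {suc n})) (proj₂ (pt {suc n})))}} →
           Is (λ γ → ∀ x → P x γ) (∀ x → P x pt)
      i∀ {{d}} = is (def-∀ (get d))

      ×∈ : {s t : Env n → V} {Q : Env n → Set ℓ} → {{Is (λ γ → s γ ∈ t γ) (s pt ∈ t pt)}} → {{Is Q (Q pt)}} →
           Is (λ γ → (s γ ∈ t γ) × Q γ) ((s pt ∈ t pt) × Q pt)
      ×∈ {{d}} {{e}} = is (def-× (get d) (get e))

      →∈ : {s t : Env n → V} {Q : Env n → Set ℓ} → {{Is (λ γ → s γ ∈ t γ) (s pt ∈ t pt)}} → {{Is Q (Q pt)}} →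
           Is (λ γ → (s γ ∈ t γ) → Q γ) ((s pt ∈ t pt) → Q pt)
      →∈ {{d}} {{e}} = is (def-→ (get d) (get e))

      ×≡ : {s t : Env n → V} {Q : Env n → Set ℓ} → {{Is (λ γ → s γ ≡ t γ) (s pt ≡ t pt)}} → {{Is Q (Q pt)}} →
           Is (λ γ → (s γ ≡ t γ) × Q γ) ((s pt ≡ t pt) × Q pt)
      ×≡ {{d}} {{e}} = is (def-× (get d) (get e))

      →≡ : {s t : Env n → V} {Q : Env n → Set ℓ} → {{Is (λ γ → s γ ≡ t γ) (s pt ≡ t pt)}} → {{Is Q (Q pt)}} →
           Is (λ γ → (s γ ≡ t γ) → Q γ) ((s pt ≡ t pt) → Q pt)
      →≡ {{d}} {{e}} = is (def-→ (get d) (get e))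

      ×Σ : {A : Env n → Set ℓ} {B : ∀ γ → A γ → Set ℓ} {Q : Env n → Set ℓ} → {{Is (λ γ → Σ (A γ) (B γ)) (Σ (A pt) (B pt))}} → {{Is Q (Q pt)}} →
           Is (λ γ → (Σ (A γ) (B γ)) × Q γ) ((Σ (A pt) (B pt)) × Q pt)
      ×Σ {{d}} {{e}} = is (def-× (get d) (get e))

      →Σ : {A : Env n → Set ℓ} {B : ∀ γ → A γ → Set ℓ} {Q : Env n → Set ℓ} → {{Is (λ γ → Σ (A γ) (B γ)) (Σ (A pt) (B pt))}} → {{Is Q (Q pt)}} →
           Is (λ γ → (Σ (A γ) (B γ)) → Q γ) ((Σ (A pt) (B pt)) → Q pt)
      →Σ {{d}} {{e}} = is (def-→ (get d) (get e))

      ×Π : {A : Env n → Set ℓ} {B : ∀ γ → A γ → Set ℓ} {Q : Env n → Set ℓ} → {{Is (λ γ → ∀ a → B γ a) (∀ a → B pt a)}} → {{Is Q (Q pt)}} →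
           Is (λ γ → (∀ a → B γ a) × Q γ) ((∀ a → B pt a) × Q pt)
      ×Π {{d}} {{e}} = is (def-× (get d) (get e))

      →Π : {A : Env n → Set ℓ} {B : ∀ γ → A γ → Set ℓ} {Q : Env n → Set ℓ} → {{Is (λ γ → ∀ a → B γ a) (∀ a → B pt a)}} → {{Is Q (Q pt)}} →
           Is (λ γ → (∀ a → B γ a) → Q γ) ((∀ a → B pt a) → Q pt)
      →Π {{d}} {{e}} = is (def-→ (get d) (get e))

      ×¬ : {A : Env n → Set ℓ} {Q : Env n → Set ℓ} → {{Is (λ γ → ¬ A γ) (¬ A pt)}} → {{Is Q (Q pt)}} →
           Is (λ γ → (¬ A γ) × Q γ) ((¬ A pt) × Q pt)
      ×¬ {{d}} {{e}} = is (def-× (get d) (get e))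

      →¬ : {A : Env n → Set ℓ} {Q : Env n → Set ℓ} → {{Is (λ γ → ¬ A γ) (¬ A pt)}} → {{Is Q (Q pt)}} →
           Is (λ γ → (¬ A γ) → Q γ) ((¬ A pt) → Q pt)
      →¬ {{d}} {{e}} = is (def-→ (get d) (get e))

      ×⊎ : {A B : Env n → Set ℓ} {Q : Env n → Set ℓ} → {{Is (λ γ → A γ ⊎ B γ) (A pt ⊎ B pt)}} → {{Is Q (Q pt)}} →
           Is (λ γ → (A γ ⊎ B γ) × Q γ) ((A pt ⊎ B pt) × Q pt)
      ×⊎ {{d}} {{e}} = is (def-× (get d) (get e))

      →⊎ : {A B : Env n → Set ℓ} {Q : Env n → Set ℓ} → {{Is (λ γ → A γ ⊎ B γ) (A pt ⊎ B pt)}} → {{Is Q (Q pt)}} →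
           Is (λ γ → (A γ ⊎ B γ) → Q γ) ((A pt ⊎ B pt) → Q pt)
      →⊎ {{d}} {{e}} = is (def-→ (get d) (get e))

      ×⇔ : {A B : Env n → Set ℓ} {Q : Env n → Set ℓ} → {{Is (λ γ → A γ ⇔ B γ) (A pt ⇔ B pt)}} → {{Is Q (Q pt)}} →
           Is (λ γ → (A γ ⇔ B γ) × Q γ) ((A pt ⇔ B pt) × Q pt)
      ×⇔ {{d}} {{e}} = is (def-× (get d) (get e))

      →⇔ : {A B : Env n → Set ℓ} {Q : Env n → Set ℓ} → {{Is (λ γ → A γ ⇔ B γ) (A pt ⇔ B pt)}} → {{Is Q (Q pt)}} →
           Is (λ γ → (A γ ⇔ B γ) → Q γ) ((A pt ⇔ B pt) → Q pt)
      →⇔ {{d}} {{e}} = is (def-→ (get d) (get e))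

      -- Any set that does not depend on the environment enters the formula as a parameter.
      con : {c : V} → Term {n} (λ _ → c)
      con {n} {c} = term (c ∷ []) (last n) λ γ → h γ
        where
        last : ∀ n → Fin (n + 1)
        last zero = zero
        last (suc n) = suc (last n)
        h : ∀ {n} (γ : Env n) → lookup (vec γ ++ (c ∷ [])) (last n) ≡ c
        h {zero} γ = refl
        h {suc n} (_ , γ) = h γ

      v₀ : Term {1 + n} (λ γ → proj₁ γ)
      v₀ = term [] zero λ _ → refl
      v₁ : Term {2 + n} (λ γ → proj₁ (proj₂ γ))
      v₁ = term [] (suc zero) λ _ → refl
      v₂ : Term {3 + n} (λ γ → proj₁ (proj₂ (proj₂ γ)))
      v₂ = term [] (suc (suc zero)) λ _ → refl
      v₃ : Term {4 + n} (λ γ → proj₁ (proj₂ (proj₂ (proj₂ γ))))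
      v₃ = term [] (suc (suc (suc zero))) λ _ → refl
      v₄ : Term {5 + n} (λ γ → proj₁ (proj₂ (proj₂ (proj₂ (proj₂ γ)))))
      v₄ = term [] (suc (suc (suc (suc zero)))) λ _ → refl
      v₅ : Term {6 + n} (λ γ → proj₁ (proj₂ (proj₂ (proj₂ (proj₂ (proj₂ γ))))))
      v₅ = term [] (suc (suc (suc (suc (suc zero))))) λ _ → refl
      v₆ : Term {7 + n} (λ γ → proj₁ (proj₂ (proj₂ (proj₂ (proj₂ (proj₂ (proj₂ γ)))))))
      v₆ = term [] (suc (suc (suc (suc (suc (suc zero)))))) λ _ → refl
      v₇ : Term {8 + n} (λ γ → proj₁ (proj₂ (proj₂ (proj₂ (proj₂ (proj₂ (proj₂ (proj₂ γ))))))))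
      v₇ = term [] (suc (suc (suc (suc (suc (suc (suc zero))))))) λ _ → refl
      v₈ : Term {9 + n} (λ γ → proj₁ (proj₂ (proj₂ (proj₂ (proj₂ (proj₂ (proj₂ (proj₂ (proj₂ γ)))))))))
      v₈ = term [] (suc (suc (suc (suc (suc (suc (suc (suc zero)))))))) λ _ → refl
      v₉ : Term {10 + n} (λ γ → proj₁ (proj₂ (proj₂ (proj₂ (proj₂ (proj₂ (proj₂ (proj₂ (proj₂ (proj₂ γ))))))))))
      v₉ = term [] (suc (suc (suc (suc (suc (suc (suc (suc (suc zero))))))))) λ _ → refl

  auto : {X : Set ℓ} → {{X}} → X
  auto {{x}} = x

  def₁-¬ : ∀ {P} → Def₁ P → Def₁ (λ x → ¬ P x)
  def₁-¬ = def-¬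

-- Elementary set theory: pairs, relations, choice

module Sets {ℓ} (em : ExcludedMiddle ℓ) (𝔐 : Structure ℓ) (zfc : SetTheory.ZFC 𝔐) where
  open SetTheory 𝔐
  open ZFC zfc public
  open Definability em 𝔐 (proj₁ infinity) public

  opaque
    ⊆-antisym : ∀ {x y} → x ⊆ y → y ⊆ x → x ≡ y
    ⊆-antisym h h′ = extensionality _ _ _ _ λ z _ → mk⇔ (h z) (h′ z)

    IsSetOf-unique : ∀ {x y P} → IsSetOf x P → IsSetOf y P → x ≡ y
    IsSetOf-unique h h′ = ⊆-antisym (λ z p → from (h′ z) (to (h z) p)) (λ z p → from (h z) (to (h′ z) p))

    sep : ∀ a (P : V → Set ℓ) {{_ : Def₁ P}} → ∃[ b ] (∀ x → x ∈ b ⇔ (x ∈ a × P x))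
    sep a P {{def ps φ ok}} =
      case separation φ ps a _ of λ (b , _ , h) → b , λ x →
        mk⇔ (λ p → let (q , r) = to (h x _) p in q , to (ok (x , _)) r)
            (λ (q , r) → from (h x _) (q , from (ok (x , _)) r))

    ∃∅ : ∃[ e ] IsEmpty e
    ∃∅ = case infinity of λ (_ , _ , (e , _ , _ , h) , _) → e , λ x → h x _

    upair : ∀ a b → ∃[ p ] IsUnorderedPair p a b
    upair a b = case pairing a b _ _ of λ (p , _ , h) → p , λ x → h x _

    sing : ∀ a → ∃[ p ] IsSetOf p (_≡ a)
    sing a = case upair a a of λ (p , h) → p , λ x →
      mk⇔ (λ q → [ id , id ]′ (to (h x) q)) (λ q → from (h x) (inj₁ q))

    ⋃ : ∀ a → ∃[ u ] IsUnion u a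
    ⋃ a = case union a _ of λ (u , _ , h) → u , λ x →
      mk⇔ (λ p → let (y , _ , q , r) = to (h x _) p in y , q , r)
          (λ (y , q , r) → from (h x _) (y , _ , q , r))

    _∪_ : ∀ a b → ∃[ u ] IsSetOf u (λ x → x ∈ a ⊎ x ∈ b)
    a ∪ b =
      case upair a b of λ (p , hp) → case ⋃ p of λ (u , hu) → u , λ x → mk⇔
        (λ q → case to (hu x) q of λ { (y , y∈p , x∈y) →
          [ (λ { refl → inj₁ x∈y }) , (λ { refl → inj₂ x∈y }) ]′ (to (hp y) y∈p) })
        [ (λ q → from (hu x) (a , from (hp a) (inj₁ refl) , q))
        , (λ q → from (hu x) (b , from (hp b) (inj₂ refl) , q)) ]′

    ∃suc : ∀ a → ∃[ s ] IsSuc s a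
    ∃suc a = case sing a of λ (p , hp) → case a ∪ p of λ (u , hu) → u , λ x → mk⇔
      (λ q → [ inj₁ , (λ r → inj₂ (to (hp x) r)) ]′ (to (hu x) q))
      [ (λ q → from (hu x) (inj₁ q)) , (λ q → from (hu x) (inj₂ (from (hp x) q))) ]′

    private
      upair-sing : ∀ {s a c d} → IsUnorderedPair s a a → IsUnorderedPair s c d → a ≡ c × a ≡ d
      upair-sing h h′ = sym ([ id , id ]′ (to (h _) (from (h′ _) (inj₁ refl)))) ,
        sym ([ id , id ]′ (to (h _) (from (h′ _) (inj₂ refl))))

      upair-cancel : ∀ {s a b c} → IsUnorderedPair s a b → IsUnorderedPair s a c → b ≡ c
      upair-cancel {s} {a} {b} {c} h h′ with to (h′ b) (from (h b) (inj₂ refl))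
      ... | inj₂ p = p
      ... | inj₁ refl = [ sym , sym ]′ (to (h c) (from (h′ c) (inj₂ refl)))

    IsPair-injective : ∀ {p a b c d} → IsPair p a b → IsPair p c d → a ≡ c × b ≡ d
    IsPair-injective {p} {a} {b} {c} {d} (s , t , hs , ht , hp) (s′ , t′ , hs′ , ht′ , hp′)
      with a≡c
      where
      a≡c : a ≡ c
      a≡c with to (hp′ s) (from (hp s) (inj₁ refl))
      ... | inj₁ refl = proj₁ (upair-sing hs hs′)
      ... | inj₂ refl = proj₁ (upair-sing hs ht′)
    ... | refl with IsSetOf-unique hs hs′
    ... | refl = refl , upair-cancel ht (subst (λ u → IsUnorderedPair u _ _) (sym (upair-cancel hp hp′)) ht′)

    IsPair-unique : ∀ {p q a b} → IsPair p a b → IsPair q a b → p ≡ q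
    IsPair-unique (s , t , hs , ht , hp) (s′ , t′ , hs′ , ht′ , hp′)
      with IsSetOf-unique hs hs′ | IsSetOf-unique ht ht′
    ... | refl | refl = IsSetOf-unique hp hp′

    pair : ∀ a b → ∃[ p ] IsPair p a b
    pair a b = case upair a a of λ (s , hs) → case upair a b of λ (t , ht) →
      case upair s t of λ (p , hp) → p , s , t , hs , ht , hp

  opaque
    -- Opaque copies of application and pairing: instance search meets an atom instead of an
    -- unfolded Kuratowski pair.
    _[_]≈_ : V → V → V → Set ℓ
    f [ x ]≈ y = ⟨ x , y ⟩∈ f

    Pr : V → V → V → Set ℓ
    Pr = IsPair

    ap : ∀ {f x y} → ⟨ x , y ⟩∈ f → f [ x ]≈ y
    ap h = h

    pa : ∀ {f x y} → f [ x ]≈ y → ⟨ x , y ⟩∈ f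
    pa h = h

    pr : ∀ {p a b} → IsPair p a b → Pr p a b
    pr h = h

    rp : ∀ {p a b} → Pr p a b → IsPair p a b
    rp h = h

    def-Pr : Def₃ Pr
    def-Pr = auto {X = Def₃ IsPair}

    def-ap : Def₃ _[_]≈_
    def-ap = auto {X = Def₃ (λ f x y → ⟨ x , y ⟩∈ f)}

  infix 4 _[_]≈_

  instance
    i-Pr : Atom₃ def-Pr
    i-Pr = atom₃ def-Pr

    i-ap : Atom₃ def-ap
    i-ap = atom₃ def-ap

    ×Pr : Atom₃× def-Pr
    ×Pr = atom₃× def-Pr

    →Pr : Atom₃→ def-Pr
    →Pr = atom₃→ def-Pr

    ×ap : Atom₃× def-ap
    ×ap = atom₃× def-ap

    →ap : Atom₃→ def-ap
    →ap = atom₃→ def-ap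

  opaque
    prod : ∀ a b → ∃[ c ] IsSetOf c (λ p → ∃[ x ∈ a ] ∃[ y ∈ b ] Pr p x y)
    prod a b = case a ∪ b of λ (u , hu) → case powerSet u of λ (v , hv) → case powerSet v of λ (w , hw) →
      case sep w (λ p → ∃[ x ∈ a ] ∃[ y ∈ b ] Pr p x y) of λ (c , hc) → c , λ p → mk⇔
        (λ q → proj₂ (to (hc p) q))
        λ (x , x∈a , y , y∈b , q) → from (hc p) (
          (case rp q of λ (s , t , hs , ht , hp) →
            from (hw p) λ z z∈p → from (hv z) λ i i∈z → from (hu i)
              ([ (λ { refl → [ (λ { refl → inj₁ x∈a }) , (λ { refl → inj₁ x∈a }) ]′ (to (hs i) i∈z) })
               , (λ { refl → [ (λ { refl → inj₁ x∈a }) , (λ { refl → inj₂ y∈b }) ]′ (to (ht i) i∈z) }) ]′ (to (hp z) z∈p)))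
          , x , x∈a , y , y∈b , q)

    rel : ∀ a b (R : V → V → Set ℓ) {{_ : Def₂ R}} →
          ∃[ r ] ((∀ x y → r [ x ]≈ y ⇔ (x ∈ a × y ∈ b × R x y)) × (∀ p → p ∈ r → ∃[ x ∈ a ] ∃[ y ∈ b ] Pr p x y))
    rel a b R {{d}} = case prod a b of λ (c , hc) → case sep c (λ p → ∃[ x ] ∃[ y ] (Pr p x y × R x y)) of λ (r , hr) →
      r , (λ x y → mk⇔
        (λ q → case pa q of λ (p , p∈r , p≈) → case to (hr p) p∈r of λ (p∈c , x′ , y′ , p≈′ , Rxy) →
           case to (hc p) p∈c of λ (x″ , x∈a , y″ , y∈b , p≈″) →
           case (IsPair-injective p≈ (rp p≈′) , IsPair-injective p≈ (rp p≈″)) of λ { ((refl , refl) , (refl , refl)) →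
             x∈a , y∈b , Rxy })
        λ (x∈a , y∈b , Rxy) → case pair x y of λ (p , p≈) →
           ap (p , from (hr p) (from (hc p) (x , x∈a , y , y∈b , pr p≈) , x , y , pr p≈ , Rxy) , p≈))
      , λ p p∈r → to (hc p) (proj₁ (to (hr p) p∈r))
      where
      instance
        _ : Atom₂ d
        _ = atom₂ d

  record Fn (a b f : V) : Set ℓ where
    constructor mkFn
    field
      tot : ∀ x → x ∈ a → ∃[ y ] f [ x ]≈ y
      dom : ∀ {x y} → f [ x ]≈ y → x ∈ a
      cod : ∀ {x y} → f [ x ]≈ y → y ∈ b
      fun : ∀ {x y y′} → f [ x ]≈ y → f [ x ]≈ y′ → y ≡ y′
      prs : ∀ p → p ∈ f → ∃[ x ∈ a ] ∃[ y ∈ b ] Pr p x y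

  opaque
    Fn→Function : ∀ {a b f} → Fn a b f → Function a b f
    Fn→Function (mkFn tot dom cod fun prs) =
      ( (λ p p∈f → case prs p p∈f of λ (x , x∈a , y , _ , q) → x , x∈a , y , rp q)
      , (λ x x∈a → case tot x x∈a of λ (y , q) → y , pa q)
      , (λ x y y′ q q′ → fun (ap q) (ap q′)))
      , λ x y q → cod (ap q)

    FunctionOn-dom : ∀ {a f x y} → FunctionOn a f → f [ x ]≈ y → x ∈ a
    FunctionOn-dom (prs , _) q = case pa q of λ (p , p∈f , p≈) → case prs p p∈f of λ (x′ , x∈a , y′ , p≈′) →
      case IsPair-injective p≈ p≈′ of λ { (refl , _) → x∈a }

  private
    Fib : V → V → V → Set ℓ
    Fib r x s = ∀ p → p ∈ s ⇔ (p ∈ r × ∃[ y ] Pr p x y)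

    IsTransversal : V → V → Set ℓ
    IsTransversal A t = ∀[ s ∈ A ] ∃[ y ] ((y ∈ s × y ∈ t) × (∀ z → z ∈ s → z ∈ t → z ≡ y))

    opaque
      fibre : ∀ r x → ∃[ s ] Fib r x s
      fibre r x = sep r (λ p → ∃[ y ] Pr p x y)

      fibres : ∀ a r → ∃[ A ] ((∀ s → s ∈ A → ∃[ x ∈ a ] Fib r x s) × (∀ x → x ∈ a → ∃[ s ∈ A ] Fib r x s))
      fibres a r = case powerSet r of λ (w , hw) → case sep w (λ s → ∃[ x ∈ a ] Fib r x s) of λ (A , hA) →
        A , (λ s s∈A → proj₂ (to (hA s) s∈A)) ,
        λ x x∈a → case fibre r x of λ (s , hs) →
          s , from (hA s) (from (hw s) (λ p q → proj₁ (to (hs p) q)) , x , x∈a , hs) , hs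

      transversal : ∀ a r A → (∀ x → x ∈ a → ∃[ y ] r [ x ]≈ y) →
        (∀ s → s ∈ A → ∃[ x ∈ a ] Fib r x s) → ∃[ t ] IsTransversal A t
      transversal a r A h hA = choice A
        (λ s s∈A → case hA s s∈A of λ { (x , x∈a , hs) → case h x x∈a of λ { (y , q) →
           case pa q of λ { (p , p∈r , p≈) → p , from (hs p) (p∈r , y , pr p≈) } } })
        (λ s s∈A s′ s′∈A p p∈s p∈s′ → case hA s s∈A of λ { (x , x∈a , hs) → case hA s′ s′∈A of λ { (x′ , x′∈a , hs′) →
           case to (hs p) p∈s of λ { (_ , y , q) → case to (hs′ p) p∈s′ of λ { (_ , y′ , q′) →
           case IsPair-injective (rp q) (rp q′) of λ { (refl , _) → IsSetOf-unique hs hs′ } } } } })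

      uniformise : ∀ a b r A t → (∀ x → x ∈ a → ∃[ s ∈ A ] Fib r x s) → IsTransversal A t →
        (∀ {x y} → r [ x ]≈ y → x ∈ a × y ∈ b) → (∀ p → p ∈ r → ∃[ x ∈ a ] ∃[ y ∈ b ] Pr p x y) →
        ∃[ f ] (Fn a b f × (∀ x y → f [ x ]≈ y → r [ x ]≈ y))
      uniformise a b r A t fib ht hr rprs = case sep r (λ p → p ∈ t) of λ (f , hf) → f , fn f hf , λ x y → f⊆r f hf
        where
        module _ (f : V) (hf : ∀ p → p ∈ f ⇔ (p ∈ r × p ∈ t)) where
          f⊆r : ∀ {x y} → f [ x ]≈ y → r [ x ]≈ y
          f⊆r q = case pa q of λ { (p , p∈f , p≈) → ap (p , proj₁ (to (hf p) p∈f) , p≈) }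
          fn : Fn a b f
          fn .Fn.tot x x∈a with fib x x∈a
          ... | s , s∈A , hs with ht s s∈A
          ... | p , (p∈s , p∈t) , _ with to (hs p) p∈s
          ... | p∈r , y , p≈ = y , ap (p , from (hf p) (p∈r , p∈t) , rp p≈)
          fn .Fn.dom q = proj₁ (hr (f⊆r q))
          fn .Fn.cod q = proj₂ (hr (f⊆r q))
          fn .Fn.fun {x} {y} {y′} q q′ with fib x (proj₁ (hr (f⊆r q))) | pa q | pa q′
          ... | s , s∈A , hs | p , p∈f , p≈ | p′ , p′∈f , p≈′
            with ht s s∈A | to (hf p) p∈f | to (hf p′) p′∈f
          ... | _ , _ , u | p∈r , p∈t | p′∈r , p′∈t
            with u p (from (hs p) (p∈r , y , pr p≈)) p∈t | u p′ (from (hs p′) (p′∈r , y′ , pr p≈′)) p′∈t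
          ... | refl | refl = proj₂ (IsPair-injective p≈ p≈′)
          fn .Fn.prs p p∈f = rprs p (proj₁ (to (hf p) p∈f))

  opaque
    -- The transversal of the disjoint sets {x} × {y : R x y} is a choice function.
    choose : ∀ a b (R : V → V → Set ℓ) {{_ : Def₂ R}} → (∀[ x ∈ a ] ∃[ y ∈ b ] R x y) →
             ∃[ f ] (Fn a b f × (∀ x y → f [ x ]≈ y → R x y))
    choose a b R {{d}} h with rel a b R {{d}}
    ... | r , hr , rprs with fibres a r
    ... | A , hA , fib
      with transversal a r A (λ x x∈a → case h x x∈a of λ { (y , y∈b , q) → y , from (hr x y) (x∈a , y∈b , q) }) hA
    ... | t , ht with uniformise a b r A t fib ht
      (λ {x} {y} q → let (p , p′ , _) = to (hr x y) q in p , p′) rprs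
    ... | f , fn , f⊆r = f , fn , λ x y q → proj₂ (proj₂ (to (hr x y) (f⊆r x y q)))

  -- Foundation and ordinals

  infix 4 _≤_
  _≤_ : V → V → Set ℓ
  x ≤ y = x ∈ y ⊎ x ≡ y

  opaque
    ∈-min : ∀ {x a} → x ∈ a → ∃[ y ∈ a ] (∀ z → z ∈ y → z ∉ a)
    ∈-min {x} {a} p = case foundation a _ (x , _ , p) of λ (y , _ , q , h) → y , q , λ z → h z _

    ∈-irrefl : ∀ {x} → x ∉ x
    ∈-irrefl {x} p = case sing x of λ (s , hs) → case ∈-min (from (hs x) refl) of
      λ { (y , y∈s , h) → case to (hs y) y∈s of λ { refl → h x p y∈s } }

    ∈-asym : ∀ {x y} → x ∈ y → y ∉ x
    ∈-asym {x} {y} p q = case upair x y of λ (s , hs) → case ∈-min (from (hs x) (inj₁ refl)) of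
      λ { (z , z∈s , h) → case to (hs z) z∈s of λ
        { (inj₁ refl) → h y q (from (hs y) (inj₂ refl)) ; (inj₂ refl) → h x p (from (hs x) (inj₁ refl)) } }

    ∈-acyclic₃ : ∀ {x y z} → x ∈ y → y ∈ z → z ∉ x
    ∈-acyclic₃ {x} {y} {z} p q r = case upair x y of λ (s , hs) → case sing z of λ (t , ht) →
      case s ∪ t of λ (u , hu) →
      let x∈u = from (hu x) (inj₁ (from (hs x) (inj₁ refl)))
          y∈u = from (hu y) (inj₁ (from (hs y) (inj₂ refl)))
          z∈u = from (hu z) (inj₂ (from (ht z) refl))
      in case ∈-min x∈u of λ { (w , w∈u , h) → case to (hu w) w∈u of λ
        { (inj₁ w∈s) → case to (hs w) w∈s of λ { (inj₁ refl) → h z r z∈u ; (inj₂ refl) → h x p x∈u }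
        ; (inj₂ w∈t) → case to (ht w) w∈t of λ { refl → h y q y∈u } } }

    ∈-ind : ∀ a (P : V → Set ℓ) {{_ : Def₁ P}} →
            (∀ x → x ∈ a → (∀ y → y ∈ x → y ∈ a → P y) → P x) → ∀ x → x ∈ a → P x
    ∈-ind a P {{d}} step x x∈a = byContra λ nPx →
      case sep a (λ x → ¬ P x) {{def₁-¬ d}} of λ (b , hb) →
      case ∈-min (from (hb x) (x∈a , nPx)) of λ (y , y∈b , h) → case to (hb y) y∈b of λ (y∈a , nPy) →
      nPy (step y y∈a λ z z∈y z∈a → byContra λ nPz → h z z∈y (from (hb z) (z∈a , nPz)))

    Ordinal-∈ : ∀ {α x} → Ordinal α → x ∈ α → Ordinal x
    Ordinal-∈ {α} {x} (tr , tri) x∈α =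
      (λ y y∈x z z∈y → case tri z (tr y (tr x x∈α y y∈x) z z∈y) x x∈α of λ
        { (inj₁ p) → p ; (inj₂ (inj₁ refl)) → ⊥-elim (∈-asym y∈x z∈y)
        ; (inj₂ (inj₂ p)) → ⊥-elim (∈-acyclic₃ z∈y y∈x p) })
      , λ y y∈x z z∈x → tri y (tr x x∈α y y∈x) z (tr x x∈α z z∈x)

    -- If `u` is not all of α, then the least element of α outside `u` is `u` itself.
    transitive-⊆ : ∀ {α u} → Ordinal α → Transitive u → u ⊆ α → u ≤ α
    transitive-⊆ {α} {u} (tr , tri) tu u⊆α with em {α ⊆ u}
    ... | yes α⊆u = inj₂ (⊆-antisym u⊆α α⊆u)
    ... | no α⊈u = inj₁ (byContra λ u∉α → α⊈u λ x x∈α → byContra λ x∉u →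
      case sep α (λ x → x ∉ u) of λ (d , hd) → case ∈-min (from (hd x) (x∈α , x∉u)) of λ { (y , y∈d , h) →
      case to (hd y) y∈d of λ { (y∈α , y∉u) →
      u∉α (subst (_∈ α) (⊆-antisym
        (λ z z∈y → byContra λ z∉u → h z z∈y (from (hd z) (tr y y∈α z z∈y , z∉u)))
        (λ z z∈u → case tri z (u⊆α z z∈u) y y∈α of λ
           { (inj₁ p) → p ; (inj₂ (inj₁ refl)) → ⊥-elim (y∉u z∈u) ; (inj₂ (inj₂ p)) → ⊥-elim (y∉u (tu z z∈u y p)) }))
        y∈α) } })

    -- The intersection of α and β is transitive, so it is an element of, or equal to, each of them;
    -- it cannot be an element of both.
    ∈-tri : ∀ {α β} → Ordinal α → Ordinal β → α ∈ β ⊎ α ≡ β ⊎ β ∈ α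
    ∈-tri {α} {β} oα oβ = case sep α (_∈ β) of λ (u , hu) →
      let tu : Transitive u
          tu x x∈u z z∈x = let (p , q) = to (hu x) x∈u in from (hu z) (proj₁ oα x p z z∈x , proj₁ oβ x q z z∈x)
      in case (transitive-⊆ oα tu (λ x p → proj₁ (to (hu x) p)) , transitive-⊆ oβ tu (λ x p → proj₂ (to (hu x) p))) of λ
        { (inj₁ p , inj₁ q) → ⊥-elim (∈-irrefl (from (hu u) (p , q)))
        ; (inj₂ refl , q) → case q of λ { (inj₁ r) → inj₁ r ; (inj₂ r) → inj₂ (inj₁ r) }
        ; (inj₁ p , inj₂ refl) → inj₂ (inj₂ p) }

    ≤-or-> : ∀ {α β} → Ordinal α → Ordinal β → α ≤ β ⊎ β ∈ α
    ≤-or-> oα oβ = case ∈-tri oα oβ of λ { (inj₁ p) → inj₁ (inj₁ p) ; (inj₂ (inj₁ p)) → inj₁ (inj₂ p) ; (inj₂ (inj₂ p)) → inj₂ p }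

    ≤⇒⊆ : ∀ {α β} → Ordinal β → α ≤ β → α ⊆ β
    ≤⇒⊆ oβ (inj₁ p) = proj₁ oβ _ p
    ≤⇒⊆ oβ (inj₂ refl) _ p = p

    ⊆⇒≤ : ∀ {α β} → Ordinal α → Ordinal β → α ⊆ β → α ≤ β
    ⊆⇒≤ oα oβ h = transitive-⊆ oβ (proj₁ oα) h

    mkOrdinal : ∀ {a} → Transitive a → (∀ x → x ∈ a → Ordinal x) → Ordinal a
    mkOrdinal tr h = tr , λ x x∈a y y∈a → ∈-tri (h x x∈a) (h y y∈a)

    Ordinal-suc : ∀ {α s} → Ordinal α → IsSuc s α → Ordinal s
    Ordinal-suc {α} {s} oα hs = mkOrdinal
      (λ x x∈s y y∈x → from (hs y) (inj₁ (case to (hs x) x∈s of λ { (inj₁ p) → proj₁ oα x p y y∈x ; (inj₂ refl) → y∈x })))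
      (λ x x∈s → case to (hs x) x∈s of λ { (inj₁ p) → Ordinal-∈ oα p ; (inj₂ refl) → oα })

  -- Recursion along ∈ on a set B, with values in X; g computes the value at x
  -- from the restriction to x ∩ B of the function being defined.
  IsRestriction : V → V → V → Set ℓ
  IsRestriction p f x = IsSetOf p (λ z → z ∈ f × ∃[ u ∈ x ] ∃[ v ] Pr z u v)

  private
    module Rec (B X c q g : V) (hc : IsSetOf c (λ p → ∃[ x ∈ B ] ∃[ y ∈ X ] Pr p x y))
               (hq : ∀ p → p ∈ q ⇔ p ⊆ c) (fg : Fn q X g) where

      FnOn : V → V → Set ℓ
      FnOn p x = (∀ u → u ∈ x → u ∈ B → ∃[ v ] p [ u ]≈ v) ×
                 (∀ u v → p [ u ]≈ v → u ∈ x × (∀ v′ → p [ u ]≈ v′ → v ≡ v′))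

      -- The function defined by recursion is obtained as the least relation with this property,
      -- rather than as a union of approximations.
      Closed : V → Set ℓ
      Closed F = ∀ x → x ∈ B → ∀ p → p ∈ q → p ⊆ F → FnOn p x → ∀ y → g [ p ]≈ y → F [ x ]≈ y

      ap⊆ : ∀ {p f x y} → p ⊆ f → p [ x ]≈ y → f [ x ]≈ y
      ap⊆ h r = case pa r of λ (z , z∈p , z≈) → ap (z , h z z∈p , z≈)

      opaque
        hull : ∃[ f ] (∀ z → z ∈ f ⇔ (z ∈ c × (∀ F → F ⊆ c → Closed F → z ∈ F)))
        hull = sep c (λ z → ∀ F → F ⊆ c → Closed F → z ∈ F)

      module Hull (f : V) (hf : ∀ z → z ∈ f ⇔ (z ∈ c × (∀ F → F ⊆ c → Closed F → z ∈ F))) where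
        opaque
          f⊆c : f ⊆ c
          f⊆c z p = proj₁ (to (hf z) p)

          inB : ∀ {x y} → f [ x ]≈ y → x ∈ B × y ∈ X
          inB r = case pa r of λ { (z , z∈f , z≈) → case to (hc z) (f⊆c z z∈f) of λ { (x , x∈B , y , y∈X , z≈′) →
            case IsPair-injective z≈ (rp z≈′) of λ { (refl , refl) → x∈B , y∈X } } }

          closed : Closed f
          closed x x∈B p p∈q p⊆f fn y gy = case pair x y of λ (z , z≈) → ap (z , from (hf z)
            ( from (hc z) (x , x∈B , y , Fn.cod fg gy , pr z≈)
            , (λ F F⊆c cF → case pa (cF x x∈B p p∈q (λ w w∈p → proj₂ (to (hf w) (p⊆f w w∈p)) F F⊆c cF) fn y gy) of
                λ { (z′ , z′∈F , z≈′) → subst (_∈ F) (IsPair-unique z≈′ z≈) z′∈F })) , z≈)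

          restrict : ∀ x → ∃[ p ] IsRestriction p f x
          restrict x = sep f (λ z → ∃[ u ∈ x ] ∃[ v ] Pr z u v)

          Restriction→ : ∀ {p x u v} → IsRestriction p f x → p [ u ]≈ v → f [ u ]≈ v × u ∈ x
          Restriction→ hp r = case pa r of λ { (z , z∈p , z≈) → case to (hp z) z∈p of λ { (z∈f , u , u∈x , v , z≈′) →
            case IsPair-injective z≈ (rp z≈′) of λ { (refl , _) → ap (z , z∈f , z≈) , u∈x } } }

          Restriction← : ∀ {p x u v} → IsRestriction p f x → f [ u ]≈ v → u ∈ x → p [ u ]≈ v
          Restriction← {u = u} {v} hp r u∈x = case pa r of λ { (z , z∈f , z≈) →
            ap (z , from (hp z) (z∈f , u , u∈x , v , pr z≈) , z≈) }

          Value : V → Set ℓ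
          Value x = ∃[ y ] (f [ x ]≈ y × (∀ y′ → f [ x ]≈ y′ → y′ ≡ y))

          Restriction-FnOn : ∀ {p x} → (∀ u → u ∈ x → u ∈ B → Value u) → IsRestriction p f x → FnOn p x
          Restriction-FnOn {p} {x} ih hp =
            (λ u u∈x u∈B → case ih u u∈x u∈B of λ (v , r , _) → v , Restriction← hp r u∈x)
            , λ u v r → case Restriction→ hp r of λ { (r′ , u∈x) → u∈x , λ v′ r″ →
              case ih u u∈x (proj₁ (inB r′)) of λ { (_ , _ , h) →
                trans (h v r′) (sym (h v′ (proj₁ (Restriction→ hp r″)))) } }

          Restriction-∈ : ∀ {p x} → IsRestriction p f x → p ∈ q
          Restriction-∈ {p} hp = from (hq p) λ z z∈p → f⊆c z (proj₁ (to (hp z) z∈p))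

          -- Uniqueness comes from minimality: a second pair at `x` could be deleted from `f`
          -- without destroying closure.
          step : ∀ x → x ∈ B → (∀ u → u ∈ x → u ∈ B → Value u) → ∀ p → IsRestriction p f x → ∀ y → g [ p ]≈ y →
                 f [ x ]≈ y × (∀ y′ → f [ x ]≈ y′ → y′ ≡ y)
          step x x∈B ih p hp y gy = fxy , λ y′ fxy′ → byContra λ y′≢y →
            case sep f (λ z → ¬ Pr z x y′) of λ (F , hF) →
            let F⊆f : F ⊆ f
                F⊆f z z∈F = proj₁ (to (hF z) z∈F)
                cF : Closed F
                cF x₁ x₁∈B p₁ p₁∈q p₁⊆F fn₁ y₁ gy₁ = case pa (closed x₁ x₁∈B p₁ p₁∈q (λ z r → F⊆f z (p₁⊆F z r)) fn₁ y₁ gy₁) of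
                  λ { (z , z∈f , z≈) → ap (z , from (hF z) (z∈f , λ z≈′ → case IsPair-injective z≈ (rp z≈′) of
                    λ { (refl , refl) → y′≢y (Fn.fun fg (subst (λ s → g [ s ]≈ y₁) (same p₁ p₁∈q (λ w r → F⊆f w (p₁⊆F w r)) fn₁) gy₁) gy) }) , z≈) }
            in case pa fxy′ of λ { (z , z∈f , z≈) →
              proj₂ (to (hF z) (proj₂ (to (hf z) z∈f) F (λ w r → f⊆c w (F⊆f w r)) cF)) (pr z≈) }
            where
            p∈q : p ∈ q
            p∈q = Restriction-∈ hp
            fn : FnOn p x
            fn = Restriction-FnOn ih hp
            fxy : f [ x ]≈ y
            fxy = closed x x∈B p p∈q (λ z r → proj₁ (to (hp z) r)) fn y gy
            same : ∀ p₁ → p₁ ∈ q → p₁ ⊆ f → FnOn p₁ x → p₁ ≡ p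
            same p₁ p₁∈q p₁⊆f (tot₁ , fun₁) = ⊆-antisym
              (λ z z∈p₁ → case to (hc z) (to (hq p₁) p₁∈q z z∈p₁) of λ { (u , u∈B , v , v∈X , z≈) →
                from (hp z) (p₁⊆f z z∈p₁ , u , proj₁ (fun₁ u v (ap (z , z∈p₁ , rp z≈))) , v , z≈) })
              (λ z z∈p → case to (hp z) z∈p of λ { (z∈f , u , u∈x , v , z≈) →
                case inB (ap (z , z∈f , rp z≈)) of λ { (u∈B , _) →
                case tot₁ u u∈x u∈B of λ { (v₁ , r₁) → case pa r₁ of λ { (z₁ , z₁∈p₁ , z₁≈) →
                case ih u u∈x u∈B of λ { (_ , _ , h) →
                  case trans (h v (ap (z , z∈f , rp z≈))) (sym (h v₁ (ap⊆ p₁⊆f r₁))) of λ { refl →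
                    subst (_∈ p₁) (IsPair-unique z₁≈ (rp z≈)) z₁∈p₁ } } } } } })

          value : ∀ x → x ∈ B → Value x
          value = ∈-ind B Value λ x x∈B ih → case restrict x of λ (p , hp) →
            case Fn.tot fg p (Restriction-∈ hp) of λ (y , gy) → y , step x x∈B ih p hp y gy

          fn : Fn B X f
          fn .Fn.tot x x∈B = case value x x∈B of λ (y , r , _) → y , r
          fn .Fn.dom r = proj₁ (inB r)
          fn .Fn.cod r = proj₂ (inB r)
          fn .Fn.fun {x} r r′ = case value x (proj₁ (inB r)) of λ (_ , _ , h) → trans (h _ r) (sym (h _ r′))
          fn .Fn.prs p p∈f = to (hc p) (f⊆c p p∈f)

          equation : ∀ {x y p} → f [ x ]≈ y → IsRestriction p f x → g [ p ]≈ y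
          equation {x} {y} {p} r hp = case Fn.tot fg p (Restriction-∈ hp) of λ { (y′ , gy) →
            case proj₂ (step x (proj₁ (inB r)) (λ u _ u∈B → value u u∈B) p hp y′ gy) y r of λ { refl → gy } }

  opaque
    ∈-rec : ∀ B X c q g → IsSetOf c (λ p → ∃[ x ∈ B ] ∃[ y ∈ X ] Pr p x y) → (∀ p → p ∈ q ⇔ p ⊆ c) → Fn q X g →
            ∃[ f ] (Fn B X f × (∀ x y → f [ x ]≈ y → ∃[ p ∈ q ] (g [ p ]≈ y ×
              (∀ u v → p [ u ]≈ v ⇔ (f [ u ]≈ v × u ∈ x)))))
    ∈-rec B X c q g hc hq fg = case hull of λ (f , hf) → let open Hull f hf in
      f , fn , λ x y r → case restrict x of λ (p , hp) → p , Restriction-∈ hp , equation r hp ,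
        λ u v → mk⇔ (Restriction→ hp) (λ (r′ , u∈x) → Restriction← hp r′ u∈x)
      where open Rec B X c q g hc hq fg
 

  -- Injections, collapses and cardinals

  infix 4 _≼_
  -- An injection that may be multivalued.
  _≼_ : V → V → Set ℓ
  a ≼ b = ∃[ f ] ((∀[ x ∈ a ] ∃[ y ∈ b ] f [ x ]≈ y) × (∀ x x′ y → f [ x ]≈ y → f [ x′ ]≈ y → x ≡ x′))

  -- c is the transitive collapse of (B, ∈).
  Col : V → V → Set ℓ
  Col B c = (∀[ ξ ∈ B ] ∃[ y ] c [ ξ ]≈ y) ×
    (∀ ξ y → c [ ξ ]≈ y → ξ ∈ B × (∀ z → z ∈ y ⇔ (∃[ ζ ∈ B ] (ζ ∈ ξ × c [ ζ ]≈ z))))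

  opaque
    ≼-rel : ∀ a b (R : V → V → Set ℓ) {{_ : Def₂ R}} → (∀[ x ∈ a ] ∃[ y ∈ b ] R x y) →
            (∀ x x′ y → x ∈ a → x′ ∈ a → R x y → R x′ y → x ≡ x′) → a ≼ b
    ≼-rel a b R {{d}} h i = case rel a b R {{d}} of λ (r , hr , _) →
      r , (λ x x∈a → case h x x∈a of λ (y , y∈b , Rxy) → y , y∈b , from (hr x y) (x∈a , y∈b , Rxy))
      , λ x x′ y p p′ → case (to (hr x y) p , to (hr x′ y) p′) of λ ((q , _ , r) , (q′ , _ , r′)) → i x x′ y q q′ r r′

    ⊆⇒≼ : ∀ {a b} → a ⊆ b → a ≼ b
    ⊆⇒≼ {a} {b} h = ≼-rel a b _≡_ (λ x p → x , h x p , refl) λ { x x′ y _ _ refl refl → refl }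

    ≼-trans : ∀ {a b c} → a ≼ b → b ≼ c → a ≼ c
    ≼-trans {a} {b} {c} (f , tf , jf) (g , tg , jg) = ≼-rel a c (λ x z → ∃[ y ] (f [ x ]≈ y × g [ y ]≈ z))
      (λ x p → case tf x p of λ (y , q , r) → case tg y q of λ (z , q′ , r′) → z , q′ , y , r , r′)
      λ { x x′ z _ _ (y , r , s) (y′ , r′ , s′) → case jg y y′ z s s′ of λ { refl → jf x x′ y r r′ } }

    ≼-injects : ∀ {a b} → a ≼ b → ∃[ f ] (Fn a b f × (∀ x x′ y → f [ x ]≈ y → f [ x′ ]≈ y → x ≡ x′))
    ≼-injects {a} {b} (f , tf , jf) = case choose a b (λ x y → f [ x ]≈ y) tf of λ (g , fg , g⊆f) →
      g , fg , λ x x′ y p p′ → jf x x′ y (g⊆f x y p) (g⊆f x′ y p′)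

    Injection⇒≼ : ∀ {a b f} → Injection a b f → a ≼ b
    Injection⇒≼ {a} {b} {f} (((_ , tot , _) , cod) , inj) = f ,
      (λ x p → case tot x p of λ (y , q) → y , cod x y q , ap q) , λ x x′ y p p′ → inj x x′ y (pa p) (pa p′)

    SameSize⇒≼ : ∀ {a b} → SameSize a b → a ≼ b
    SameSize⇒≼ (f , inj , _) = Injection⇒≼ inj

    mkSameSize : ∀ a b (R : V → V → Set ℓ) {{_ : Def₂ R}} → (∀[ x ∈ a ] ∃[ y ∈ b ] R x y) →
      (∀ x x′ y → R x y → R x′ y → x ≡ x′) → (∀ x y y′ → R x y → R x y′ → y ≡ y′) →
      (∀[ y ∈ b ] ∃[ x ∈ a ] R x y) → SameSize a b
    mkSameSize a b R {{d}} tot inj fun surj = case choose a b R {{d}} tot of λ (f , fn , f⊆R) →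
      f , (Fn→Function fn , λ x x′ y p p′ → inj x x′ y (f⊆R x y (ap p)) (f⊆R x′ y (ap p′))) ,
      λ y y∈b → case surj y y∈b of λ (x , x∈a , r) → case Fn.tot fn x x∈a of λ { (y′ , q) →
        case fun x y y′ r (f⊆R x y′ q) of λ { refl → x , pa q } }

    SameSize-sym : ∀ {a b} → SameSize a b → SameSize b a
    SameSize-sym {a} {b} (f , (((prs , tot , fun) , cod) , inj) , surj) = mkSameSize b a (λ y x → f [ x ]≈ y)
      (λ y p → case surj y p of λ (x , q) → x , FunctionOn-dom (prs , tot , fun) (ap q) , ap q)
      (λ y y′ x p p′ → fun x y y′ (pa p) (pa p′)) (λ y x x′ p p′ → inj x x′ y (pa p) (pa p′))
      λ x p → case tot x p of λ (y , q) → y , cod x y q , ap q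

    -- Recursion needs a set of values in advance, so the values are cut down to subsets of the
    -- union of `B`. Nothing is lost: the collapse of ζ is at most ζ, hence below any ξ above ζ.
    col : ∀ B → (∀ ξ → ξ ∈ B → Ordinal ξ) → ∃[ c ] ∃[ ρ ] (Col B c ×
          (∀ ξ y → c [ ξ ]≈ y → Ordinal y × y ⊆ ξ) × IsSetOf ρ (λ y → ∃[ ξ ] c [ ξ ]≈ y))
    col B oB = case ⋃ B of λ (u , hu) → case powerSet u of λ (X , hX) → case prod B X of λ (k , hk) →
      case powerSet k of λ (q , hq) →
      case choose q X (λ p y → ∀ z → z ∈ y ⇔ (z ∈ u × ∃[ x ] p [ x ]≈ z))
        (λ p _ → case sep u (λ z → ∃[ x ] p [ x ]≈ z) of λ (y , hy) → y , from (hX y) (λ z r → proj₁ (to (hy z) r)) , hy)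
      of λ (g , fg , hg) → case ∈-rec B X k q g hk hq fg of λ (f , ff , eqn) →
      case sep X (λ y → ∃[ ξ ] f [ ξ ]≈ y) of λ (ρ , hρ) →
      finish u hu f (Fn.tot ff) (Fn.dom ff)
        (λ ξ y r → case eqn ξ y r of λ (p , _ , gp , hp) → λ z → mk⇔
          (λ z∈y → case to (hg p y gp z) z∈y of λ (z∈u , ζ , s) → case to (hp ζ z) s of λ (s′ , ζ∈ξ) → z∈u , ζ , s′ , ζ∈ξ)
          (λ (z∈u , ζ , s , ζ∈ξ) → from (hg p y gp z) (z∈u , ζ , from (hp ζ z) (s , ζ∈ξ))))
        ρ λ y → mk⇔ (λ r → proj₂ (to (hρ y) r)) λ (ξ , r) → from (hρ y) (Fn.cod ff r , ξ , r)
      where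
      finish : ∀ u → IsUnion u B → ∀ f → (∀ ξ → ξ ∈ B → ∃[ y ] f [ ξ ]≈ y) → (∀ {ξ y} → f [ ξ ]≈ y → ξ ∈ B) →
        (∀ ξ y → f [ ξ ]≈ y → ∀ z → z ∈ y ⇔ (z ∈ u × ∃[ ζ ] (f [ ζ ]≈ z × ζ ∈ ξ))) → ∀ ρ →
        IsSetOf ρ (λ y → ∃[ ξ ] f [ ξ ]≈ y) → ∃[ c ] ∃[ ρ ] (Col B c ×
          (∀ ξ y → c [ ξ ]≈ y → Ordinal y × y ⊆ ξ) × IsSetOf ρ (λ y → ∃[ ξ ] c [ ξ ]≈ y))
      finish u hu f tot dom val ρ hρ = f , ρ ,
        (tot , λ ξ y r → dom r , λ z → mk⇔
          (λ z∈y → case to (val ξ y r z) z∈y of λ (_ , ζ , s , ζ∈ξ) → ζ , dom s , ζ∈ξ , s)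
          (λ (ζ , _ , ζ∈ξ , s) → from (val ξ y r z) (below ξ z ζ (dom r) s ζ∈ξ , ζ , s , ζ∈ξ)))
        , (λ ξ y r → ordinal ξ (dom r) y r) , hρ
        where
        ordinal : ∀ ξ → ξ ∈ B → ∀ y → f [ ξ ]≈ y → Ordinal y × y ⊆ ξ
        ordinal = ∈-ind B (λ ξ → ∀ y → f [ ξ ]≈ y → Ordinal y × y ⊆ ξ) λ ξ ξ∈B ih y r →
          let member : ∀ z → z ∈ y → Ordinal z × z ∈ ξ
              member z z∈y = case to (val ξ y r z) z∈y of λ (_ , ζ , s , ζ∈ξ) → case ih ζ ζ∈ξ (dom s) z s of λ (oz , z⊆ζ) →
                oz , (case ⊆⇒≤ oz (Ordinal-∈ (oB ξ ξ∈B) ζ∈ξ) z⊆ζ of λ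
                  { (inj₁ z∈ζ) → proj₁ (oB ξ ξ∈B) ζ ζ∈ξ z z∈ζ ; (inj₂ refl) → ζ∈ξ })
          in mkOrdinal
            (λ z z∈y w w∈z → case to (val ξ y r z) z∈y of λ (_ , ζ , s , ζ∈ξ) →
              case to (val ζ z s w) w∈z of λ (w∈u , η , t , η∈ζ) →
              from (val ξ y r w) (w∈u , η , t , proj₁ (oB ξ ξ∈B) ζ ζ∈ξ η η∈ζ))
            (λ z z∈y → proj₁ (member z z∈y)) , λ z z∈y → proj₂ (member z z∈y)
        below : ∀ ξ z ζ → ξ ∈ B → f [ ζ ]≈ z → ζ ∈ ξ → z ∈ u
        below ξ z ζ ξ∈B s ζ∈ξ = case ordinal ζ (dom s) z s of λ (oz , z⊆ζ) → from (hu z) (ξ , ξ∈B ,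
          (case ⊆⇒≤ oz (Ordinal-∈ (oB ξ ξ∈B) ζ∈ξ) z⊆ζ of λ
             { (inj₁ z∈ζ) → proj₁ (oB ξ ξ∈B) ζ ζ∈ξ z z∈ζ ; (inj₂ refl) → ζ∈ξ }))

    Col-fun : ∀ {B c ξ y y′} → Col B c → c [ ξ ]≈ y → c [ ξ ]≈ y′ → y ≡ y′
    Col-fun (_ , h) r r′ = IsSetOf-unique (proj₂ (h _ _ r)) (proj₂ (h _ _ r′))

    Col-mono : ∀ {B c ξ ζ y z} → Col B c → c [ ξ ]≈ y → c [ ζ ]≈ z → ζ ∈ ξ → z ∈ y
    Col-mono (_ , h) r s p = from (proj₂ (h _ _ r) _) (_ , proj₁ (h _ _ s) , p , s)

    Col-inj : ∀ {B c ξ ζ y} → (∀ ξ → ξ ∈ B → Ordinal ξ) → Col B c → c [ ξ ]≈ y → c [ ζ ]≈ y → ξ ≡ ζ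
    Col-inj {ξ = ξ} {ζ} oB h r s = case ∈-tri (oB ξ (proj₁ (proj₂ h _ _ r))) (oB ζ (proj₁ (proj₂ h _ _ s))) of λ
      { (inj₁ p) → ⊥-elim (∈-irrefl (Col-mono h s r p)) ; (inj₂ (inj₁ p)) → p
      ; (inj₂ (inj₂ p)) → ⊥-elim (∈-irrefl (Col-mono h r s p)) }

    Col-range : ∀ {B c ρ} → Col B c → (∀ ξ y → c [ ξ ]≈ y → Ordinal y × y ⊆ ξ) →
                IsSetOf ρ (λ y → ∃[ ξ ] c [ ξ ]≈ y) → Ordinal ρ
    Col-range h o hρ = mkOrdinal
      (λ y y∈ρ z z∈y → case to (hρ y) y∈ρ of λ (ξ , r) → case to (proj₂ (proj₂ h ξ y r) z) z∈y of λ (ζ , _ , _ , s) →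
        from (hρ z) (ζ , s))
      λ y y∈ρ → case to (hρ y) y∈ρ of λ (ξ , r) → proj₁ (o ξ y r)

    -- The range of the injection is a set of ordinals below α, and its collapse is an order type at
    -- most α. This takes the place of the Schröder-Bernstein theorem in comparisons with cardinals.
    ≼-Ordinal : ∀ {a α} → Ordinal α → a ≼ α → ∃[ β ] (Ordinal β × β ≤ α × SameSize a β)
    ≼-Ordinal {a} {α} oα a≼α = case ≼-injects a≼α of λ (g , fg , jg) → case sep α (λ j → ∃[ x ] g [ x ]≈ j) of λ (B , hB) →
      let oB : ∀ ξ → ξ ∈ B → Ordinal ξ
          oB ξ p = Ordinal-∈ oα (proj₁ (to (hB ξ) p))
      in case col B oB of λ { (c , ρ , hc , o , hρ) → let oρ = Col-range hc o hρ in
      ρ , oρ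
      , ⊆⇒≤ oρ oα (λ y y∈ρ → case to (hρ y) y∈ρ of λ { (ξ , r) → case o ξ y r of λ { (oy , y⊆ξ) →
          let ξ∈α = proj₁ (to (hB ξ) (proj₁ (proj₂ hc ξ y r))) in
          case ⊆⇒≤ oy (Ordinal-∈ oα ξ∈α) y⊆ξ of λ { (inj₁ p) → proj₁ oα ξ ξ∈α y p ; (inj₂ refl) → ξ∈α } } })
      , mkSameSize a ρ (λ x y → ∃[ j ] (g [ x ]≈ j × c [ j ]≈ y))
          (λ x x∈a → case Fn.tot fg x x∈a of λ (j , r) → case proj₁ hc j (from (hB j) (Fn.cod fg r , x , r)) of λ (y , s) →
            y , from (hρ y) (j , s) , j , r , s)
          (λ { x x′ y (j , r , s) (j′ , r′ , s′) → case Col-inj oB hc s s′ of λ { refl → jg x x′ j r r′ } })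
          (λ { x y y′ (j , r , s) (j′ , r′ , s′) → case Fn.fun fg r r′ of λ { refl → Col-fun hc s s′ } })
          (λ y y∈ρ → case to (hρ y) y∈ρ of λ (j , s) → case to (hB j) (proj₁ (proj₂ hc j y s)) of λ (_ , x , r) →
            x , Fn.dom fg r , j , r , s) }

    Cardinal⇒⋠ : ∀ {κ α} → Cardinal κ → α ∈ κ → ¬ κ ≼ α
    Cardinal⇒⋠ (oκ , h) α∈κ κ≼α = case ≼-Ordinal (Ordinal-∈ oκ α∈κ) κ≼α of λ
      { (β , _ , inj₁ p , ss) → h β (proj₁ oκ _ α∈κ β p) (SameSize-sym ss)
      ; (β , _ , inj₂ refl , ss) → h β α∈κ (SameSize-sym ss) }

    Smaller-⊆ : ∀ {a b κ} → Cardinal κ → a ⊆ b → Smaller b κ → Smaller a κ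
    Smaller-⊆ (oκ , _) a⊆b (α , α∈κ , ss) =
      case ≼-Ordinal (Ordinal-∈ oκ α∈κ) (≼-trans (⊆⇒≼ a⊆b) (SameSize⇒≼ ss)) of λ
      { (β , _ , inj₁ p , ss) → β , proj₁ oκ _ α∈κ β p , ss ; (β , _ , inj₂ refl , ss) → β , α∈κ , ss }

-- Countable sets, ω₁ and closed points

record Cardinals {ℓ} (𝔐 : Structure ℓ) : Set ℓ where
  open SetTheory 𝔐
  field
    ω ω₁ ω₂ : V
    isω     : IsOmega ω
    isω₁    : IsSuccessorCardinal ω₁ ω
    isω₂    : IsSuccessorCardinal ω₂ ω₁

module Cardinality {ℓ} (em : ExcludedMiddle ℓ) (𝔐 : Structure ℓ) (zfc : SetTheory.ZFC 𝔐) (ℵ : Cardinals 𝔐) where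
  open SetTheory 𝔐
  open Cardinals ℵ
  open Sets em 𝔐 zfc public

  -- One move of the walk through ω × ω: along the row, down the column, or on to the next square.
  Step : V → V → V → V → Set ℓ
  Step m l m′ l′ = (m ∈ l × IsSuc m′ m × l′ ≡ l) ⊎
    ((m ∉ l × m′ ≡ m × IsSuc l l′) ⊎ (m ∉ l × IsEmpty l × IsEmpty m′ × IsSuc l′ m))

  -- Recursion hands over the whole earlier sequence `p`; for dependent choices only its final entry
  -- matters.
  Last : V → V → V → V → Set ℓ
  Last X p m x = m ∈ ω × x ∈ X × p [ m ]≈ x × (∀ m′ x′ → p [ m′ ]≈ x′ → m′ ∈ m ⊎ (m′ ≡ m × x′ ≡ x))

  opaque
    ω∈ω₁ : ω ∈ ω₁
    ω∈ω₁ = proj₁ (proj₂ isω₁)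

    Ordinal-ω₁ : Ordinal ω₁
    Ordinal-ω₁ = proj₁ (proj₁ isω₁)

    Ordinal-ω : Ordinal ω
    Ordinal-ω = Ordinal-∈ Ordinal-ω₁ ω∈ω₁

    zero-∈ω : ∀ {e} → IsEmpty e → e ∈ ω
    zero-∈ω h = proj₁ (proj₁ isω) _ h

    suc-∈ω : ∀ {n s} → n ∈ ω → IsSuc s n → s ∈ ω
    suc-∈ω p h = proj₂ (proj₁ isω) _ p _ h

    ω-ind : (P : V → Set ℓ) {{_ : Def₁ P}} → (∀ e → IsEmpty e → P e) →
            (∀ k → k ∈ ω → P k → ∀ s → IsSuc s k → P s) → ∀ k → k ∈ ω → P k
    ω-ind P {{d}} z s k k∈ω = case sep ω P {{d}} of λ (i , hi) → proj₂ (to (hi k) (proj₂ isω i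
      ( (λ e he → from (hi e) (zero-∈ω he , z e he))
      , (λ x x∈i y hy → case to (hi x) x∈i of λ (x∈ω , Px) → from (hi y) (suc-∈ω x∈ω hy , s x x∈ω Px y hy))) k k∈ω))

    IsSuc-injective : ∀ {s a b} → IsSuc s a → IsSuc s b → a ≡ b
    IsSuc-injective h h′ = case (to (h′ _) (from (h _) (inj₂ refl)) , to (h _) (from (h′ _) (inj₂ refl))) of λ
      { (inj₂ p , _) → p ; (inj₁ _ , inj₂ p) → sym p ; (inj₁ p , inj₁ q) → ⊥-elim (∈-asym p q) }

    zero-or-suc : ∀ k → k ∈ ω → IsEmpty k ⊎ (∃[ m ∈ ω ] IsSuc k m)
    zero-or-suc = ω-ind (λ k → IsEmpty k ⊎ (∃[ m ∈ ω ] IsSuc k m)) (λ e → inj₁) λ k p _ s h → inj₂ (k , p , h)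

    IsEmpty-unique : ∀ {a b} → IsEmpty a → IsEmpty b → a ≡ b
    IsEmpty-unique h h′ = ⊆-antisym (λ z p → ⊥-elim (h z p)) (λ z p → ⊥-elim (h′ z p))

    Last-unique : ∀ {X p m x m′ x′} → Last X p m x → Last X p m′ x′ → m ≡ m′ × x ≡ x′
    Last-unique (_ , _ , r , h) (_ , _ , r′ , h′) = case (h _ _ r′ , h′ _ _ r) of λ
      { (inj₂ (p , q) , _) → sym p , sym q ; (inj₁ _ , inj₂ pq) → pq ; (inj₁ p , inj₁ q) → ⊥-elim (∈-asym p q) }

    -- A choice function assigns to each partial sequence an R-successor of its last entry, or `a`
    -- if there is no last entry; the sequence is then obtained by recursion on ω.
    dc : ∀ X (R : V → V → V → Set ℓ) {{_ : Def₃ R}} a → a ∈ X → (∀[ k ∈ ω ] ∀[ x ∈ X ] ∃[ y ∈ X ] R k x y) →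
         ∃[ s ] (Fn ω X s × (∀ e → IsEmpty e → s [ e ]≈ a) ×
           (∀ k k⁺ x y → IsSuc k⁺ k → s [ k ]≈ x → s [ k⁺ ]≈ y → R k x y))
    dc X R {{d}} a a∈X h = case prod ω X of λ (c , hc) → case powerSet c of λ (q , hq) →
      case choose q X (λ p y → (∀ m x → Last X p m x → R m x y) × ((∀ m x → ¬ Last X p m x) → y ≡ a)) total of λ (g , fg , hg) →
      case ∈-rec ω X c q g hc hq fg of λ (s , fs , eqn) → s , fs
        , (λ e he → case Fn.tot fs e (zero-∈ω he) of λ { (y , r) → case eqn e y r of λ { (p , _ , gp , hp) →
            case proj₂ (hg p y gp) (λ m x l → he m (proj₂ (to (hp m x) (proj₁ (proj₂ (proj₂ l)))))) of λ { refl → r } } })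
        , λ k k⁺ x y hk r r′ → case eqn k⁺ y r′ of λ (p , _ , gp , hp) → proj₁ (hg p y gp) k x
            (Fn.dom fs r , Fn.cod fs r , from (hp k x) (r , from (hk k) (inj₂ refl)) ,
              λ m′ x′ q → case to (hp m′ x′) q of λ { (q′ , m′∈k⁺) → case to (hk m′) m′∈k⁺ of λ
                { (inj₁ p) → inj₁ p ; (inj₂ refl) → inj₂ (refl , Fn.fun fs q′ r) } })
      where
      instance
        _ : Atom₃ d
        _ = atom₃ d
      total : ∀ {q} → ∀[ p ∈ q ] ∃[ y ∈ X ] ((∀ m x → Last X p m x → R m x y) × ((∀ m x → ¬ Last X p m x) → y ≡ a))
      total p _ with em {∃[ m ] ∃[ x ] Last X p m x}
      ... | yes (m , x , l) = case h m (proj₁ l) x (proj₁ (proj₂ l)) of λ (y , y∈X , r) → y , y∈X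
        , (λ m′ x′ l′ → case Last-unique l l′ of λ { (refl , refl) → r }) , λ no → ⊥-elim (no m x l)
      ... | no none = a , a∈X , (λ m x l → ⊥-elim (none (m , x , l))) , λ _ → refl

  private
    module Walk (X s z : V) (hX : IsSetOf X (λ p → ∃[ m ∈ ω ] ∃[ l ∈ ω ] Pr p m l)) (fs : Fn ω X s) (hz : IsEmpty z)
      (start : ∀ e → IsEmpty e → ∀ p → s [ e ]≈ p → Pr p z z)
      (next : ∀ k k⁺ p p′ → IsSuc k⁺ k → s [ k ]≈ p → s [ k⁺ ]≈ p′ →
        ∃[ m ] ∃[ l ] ∃[ m′ ] ∃[ l′ ] (Pr p m l × Pr p′ m′ l′ × Step m l m′ l′)) where

      W : V → V → Set ℓ
      W m l = ∃[ k ] ∃[ p ] (s [ k ]≈ p × Pr p m l)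

      opaque
        oω : ∀ {k} → k ∈ ω → Ordinal k
        oω = Ordinal-∈ Ordinal-ω

        Step-unique : ∀ {m l a b c d} → Step m l a b → Step m l c d → a ≡ c × b ≡ d
        Step-unique (inj₁ (_ , h , refl)) (inj₁ (_ , h′ , refl)) = IsSetOf-unique h h′ , refl
        Step-unique (inj₁ (p , _)) (inj₂ (inj₁ (q , _))) = ⊥-elim (q p)
        Step-unique (inj₁ (p , _)) (inj₂ (inj₂ (q , _))) = ⊥-elim (q p)
        Step-unique (inj₂ (inj₁ (q , _))) (inj₁ (p , _)) = ⊥-elim (q p)
        Step-unique (inj₂ (inj₂ (q , _))) (inj₁ (p , _)) = ⊥-elim (q p)
        Step-unique (inj₂ (inj₁ (_ , refl , h))) (inj₂ (inj₁ (_ , refl , h′))) = refl , IsSuc-injective h h′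
        Step-unique (inj₂ (inj₁ (_ , _ , h))) (inj₂ (inj₂ (_ , h′ , _))) = ⊥-elim (h′ _ (from (h _) (inj₂ refl)))
        Step-unique (inj₂ (inj₂ (_ , h′ , _))) (inj₂ (inj₁ (_ , _ , h))) = ⊥-elim (h′ _ (from (h _) (inj₂ refl)))
        Step-unique (inj₂ (inj₂ (_ , _ , h , i))) (inj₂ (inj₂ (_ , _ , h′ , i′))) = IsEmpty-unique h h′ , IsSetOf-unique i i′

        W-step : ∀ {m l a b} → W m l → Step m l a b → W a b
        W-step (k , p , r , q) st = case ∃suc k of λ (k⁺ , hk) → case Fn.tot fs k⁺ (suc-∈ω (Fn.dom fs r) hk) of λ (p′ , r′) →
          case next k k⁺ p p′ hk r r′ of λ { (_ , _ , a , b , q₁ , q₂ , st′) → case IsPair-injective (rp q) (rp q₁) of λ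
            { (refl , refl) → case Step-unique st st′ of λ { (refl , refl) → k⁺ , p′ , r′ , q₂ } } }

        across : ∀ {l} → l ∈ ω → W z l → ∀ m → m ∈ ω → m ≤ l → W m l
        across {l} l∈ω w = ω-ind (λ m → m ≤ l → W m l) (λ e he _ → case IsEmpty-unique he hz of λ { refl → w })
          λ m m∈ω ih m⁺ hm m⁺≤l → let m∈l = ≤⇒⊆ (oω l∈ω) m⁺≤l m (from (hm m) (inj₂ refl)) in
          W-step (ih (inj₁ m∈l)) (inj₁ (m∈l , hm , refl))

        -- The walk descends while induction ascends, so the contrapositive is proved: if (l,k) is
        -- missed, so is every (l,j) with k ≤ j ≤ l.
        down : ∀ {l} → l ∈ ω → W l l → ∀ k → k ∈ ω → k ≤ l → W l k
        down {l} l∈ω w k k∈ω k≤l = byContra λ nw →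
          ω-ind (λ j → j ≤ l → k ≤ j → ¬ W l j)
            (λ { e he _ (inj₁ p) → ⊥-elim (he _ p) ; e he _ (inj₂ refl) → nw })
            (λ { j j∈ω ih j⁺ hj j⁺≤l (inj₂ refl) → nw
               ; j j∈ω ih j⁺ hj j⁺≤l (inj₁ p) w′ → let j∈l = ≤⇒⊆ (oω l∈ω) j⁺≤l j (from (hj j) (inj₂ refl)) in
                   ih (inj₁ j∈l) (to (hj k) p) (W-step w′ (inj₂ (inj₁
                     ((λ l∈j⁺ → case j⁺≤l of λ { (inj₁ q) → ∈-asym q l∈j⁺ ; (inj₂ refl) → ∈-irrefl l∈j⁺ }) , refl , hj)))) })
            l l∈ω (inj₂ refl) k≤l w

        diagonal : ∀ l → l ∈ ω → W z l
        diagonal = ω-ind (λ l → W z l)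
          (λ e he → case IsEmpty-unique he hz of λ { refl → case Fn.tot fs z (zero-∈ω hz) of λ (p , r) →
             z , p , r , start z hz p r })
          λ l l∈ω w l⁺ hl → W-step (down l∈ω (across l∈ω w l l∈ω (inj₂ refl)) z (zero-∈ω hz) (case zero-or-suc l l∈ω of λ
            { (inj₁ he) → inj₂ (IsEmpty-unique hz he)
            ; (inj₂ _) → case ∈-tri (oω (zero-∈ω hz)) (oω l∈ω) of λ
                { (inj₁ p) → inj₁ p ; (inj₂ (inj₁ p)) → inj₂ p ; (inj₂ (inj₂ p)) → ⊥-elim (hz _ p) } }))
            (inj₂ (inj₂ (hz l , hz , hz , hl)))

        everywhere : ∀ m l → m ∈ ω → l ∈ ω → W m l
        everywhere m l m∈ω l∈ω = case ≤-or-> (oω m∈ω) (oω l∈ω) of λ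
          { (inj₁ p) → across l∈ω (diagonal l l∈ω) m m∈ω p
          ; (inj₂ p) → down m∈ω (across m∈ω (diagonal m m∈ω) m m∈ω (inj₂ refl)) l l∈ω (inj₁ p) }

  opaque
    -- The walk (0,k) → (1,k) → … → (k,k) → (k,k−1) → … → (k,0) → (0,k+1) enumerates ω × ω.
    pairing-ω : ∃[ s ] ∃[ X ] (Fn ω X s × (∀[ m ∈ ω ] ∀[ l ∈ ω ] ∃[ k ] ∃[ p ] (s [ k ]≈ p × Pr p m l)))
    pairing-ω = case prod ω ω of λ (X , hX) → case ∃∅ of λ (z , hz) → case pair z z of λ (o , ho) →
      case dc X (λ _ p p′ → ∃[ m ] ∃[ l ] ∃[ m′ ] ∃[ l′ ] (Pr p m l × Pr p′ m′ l′ × Step m l m′ l′)) o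
        (from (hX o) (z , zero-∈ω hz , z , zero-∈ω hz , pr ho))
        (λ _ _ p p∈X → case to (hX p) p∈X of λ { (m , m∈ω , l , l∈ω , hp) → case ∃suc m of λ { (m⁺ , hm) →
          let mk : ∀ a b → a ∈ ω → b ∈ ω → Step m l a b → _
              mk a b a∈ω b∈ω st = case pair a b of λ (p′ , hp′) →
                p′ , from (hX p′) (a , a∈ω , b , b∈ω , pr hp′) , m , l , a , b , hp , pr hp′ , st
          in case em {m ∈ l} of λ
            { (yes q) → mk m⁺ l (suc-∈ω m∈ω hm) l∈ω (inj₁ (q , hm , refl))
            ; (no q) → case zero-or-suc l l∈ω of λ
              { (inj₁ he) → mk z m⁺ (zero-∈ω hz) (suc-∈ω m∈ω hm) (inj₂ (inj₂ (q , he , hz , hm)))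
              ; (inj₂ (l⁻ , l⁻∈ω , hl)) → mk m l⁻ m∈ω l⁻∈ω (inj₂ (inj₁ (q , refl , hl))) } } } }) of λ
      { (s , fs , s₀ , next) → s , X , fs , λ m m∈ω l l∈ω →
        Walk.everywhere X s z hX fs hz (λ e he p r → case Fn.fun fs r (s₀ e he) of λ { refl → pr ho }) next m l m∈ω l∈ω }

    ⋃-countable : ∀ {x u} → x ≼ ω → (∀ a → a ∈ x → a ≼ ω) → IsUnion u x → u ≼ ω
    ⋃-countable {x} {u} (φ , tφ , jφ) h hu = case pairing-ω of λ (s , _ , fs , surj) →
      case prod u ω of λ (c , hc) → case powerSet c of λ (w , hw) →
      case choose x w (λ a f → (∀[ y ∈ a ] ∃[ k ∈ ω ] f [ y ]≈ k) × (∀ y y′ k → f [ y ]≈ k → f [ y′ ]≈ k → y ≡ y′))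
        (λ a a∈x → case h a a∈x of λ (f , tf , jf) → case rel a ω (λ y k → f [ y ]≈ k) of λ (g , hg , pg) →
          g , from (hw g) (λ p p∈g → case pg p p∈g of λ (y , y∈a , k , k∈ω , hp) →
            from (hc p) (y , from (hu y) (a , a∈x , y∈a) , k , k∈ω , hp))
          , (λ y y∈a → case tf y y∈a of λ (k , k∈ω , r) → k , k∈ω , from (hg y k) (y∈a , k∈ω , r))
          , λ y y′ k r r′ → jf y y′ k (proj₂ (proj₂ (to (hg y k) r))) (proj₂ (proj₂ (to (hg y′ k) r′)))) of λ (F , fF , hF) →
      ≼-rel u ω (λ y k → ∃[ a ] ∃[ f ] ∃[ i ] ∃[ j ] ∃[ p ] (y ∈ a × φ [ a ]≈ i × F [ a ]≈ f × f [ y ]≈ j × Pr p i j × s [ k ]≈ p))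
        (λ y y∈u → case to (hu y) y∈u of λ (a , a∈x , y∈a) → case tφ a a∈x of λ (i , i∈ω , r) →
          case Fn.tot fF a a∈x of λ (f , q) → case proj₁ (hF a f q) y y∈a of λ (j , j∈ω , t) →
          case surj i i∈ω j j∈ω of λ (k , p , o , hp) → k , Fn.dom fs o , a , f , i , j , p , y∈a , r , q , t , hp , o)
        λ { y y′ k _ _ (a , f , i , j , p , _ , r , q , t , hp , o) (a′ , f′ , i′ , j′ , p′ , _ , r′ , q′ , t′ , hp′ , o′) →
          case Fn.fun fs o o′ of λ { refl → case IsPair-injective (rp hp) (rp hp′) of λ { (refl , refl) →
          case jφ a a′ i r r′ of λ { refl → case Fn.fun fF q q′ of λ { refl → proj₂ (hF a f q) y y′ j t t′ } } } } }

    upair-countable : ∀ {p a b} → IsUnorderedPair p a b → p ≼ ω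
    upair-countable {p} {a} {b} hp = case ∃∅ of λ (z , hz) → case ∃suc z of λ (o , ho) →
      ≼-rel p ω (λ x k → (x ≡ a × k ≡ z) ⊎ (x ≡ b × k ≡ o))
        (λ x x∈p → case to (hp x) x∈p of λ { (inj₁ q) → z , zero-∈ω hz , inj₁ (q , refl)
                                           ; (inj₂ q) → o , suc-∈ω (zero-∈ω hz) ho , inj₂ (q , refl) })
        λ { x x′ k _ _ (inj₁ (p , refl)) (inj₁ (q , _)) → trans p (sym q)
          ; x x′ k _ _ (inj₂ (p , refl)) (inj₂ (q , _)) → trans p (sym q)
          ; x x′ k _ _ (inj₁ (_ , refl)) (inj₂ (_ , refl)) → ⊥-elim (hz z (from (ho z) (inj₂ refl)))
          ; x x′ k _ _ (inj₂ (_ , refl)) (inj₁ (_ , refl)) → ⊥-elim (hz z (from (ho z) (inj₂ refl))) }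

    sing-countable : ∀ {p a} → IsSetOf p (_≡ a) → p ≼ ω
    sing-countable hp = upair-countable λ x → mk⇔ (λ q → inj₁ (to (hp x) q)) λ { (inj₁ q) → from (hp x) q ; (inj₂ q) → from (hp x) q }

    ∪-countable : ∀ {u a b} → a ≼ ω → b ≼ ω → IsSetOf u (λ x → x ∈ a ⊎ x ∈ b) → u ≼ ω
    ∪-countable {u} {a} {b} ha hb hu = case upair a b of λ (p , hp) → ⋃-countable (upair-countable hp)
      (λ c c∈p → case to (hp c) c∈p of λ { (inj₁ refl) → ha ; (inj₂ refl) → hb })
      λ x → mk⇔ (λ q → case to (hu x) q of λ { (inj₁ r) → a , from (hp a) (inj₁ refl) , r ; (inj₂ r) → b , from (hp b) (inj₂ refl) , r })
        λ { (c , c∈p , x∈c) → case to (hp c) c∈p of λ { (inj₁ refl) → from (hu x) (inj₁ x∈c) ; (inj₂ refl) → from (hu x) (inj₂ x∈c) } }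

    -- By induction all elements of `i` are countable, so an uncountable `i` would be a cardinal
    -- strictly between ω and ω₁.
    ∈ω₁⇒countable : ∀ i → i ∈ ω₁ → i ≼ ω
    ∈ω₁⇒countable = ∈-ind ω₁ (λ i → i ≼ ω) λ i i∈ω₁ ih →
      let oi = Ordinal-∈ Ordinal-ω₁ i∈ω₁ in
      case ≤-or-> oi Ordinal-ω of λ
      { (inj₁ p) → ⊆⇒≼ (≤⇒⊆ Ordinal-ω p)
      ; (inj₂ p) → byContra λ no → proj₂ (proj₂ isω₁) i i∈ω₁ p (oi , λ α α∈i ss →
          no (≼-trans (SameSize⇒≼ (SameSize-sym ss)) (ih α α∈i (proj₁ Ordinal-ω₁ i i∈ω₁ α α∈i)))) }

    countable⇒∈ω₁ : ∀ {α} → Ordinal α → α ≼ ω → α ∈ ω₁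
    countable⇒∈ω₁ oα h = case ≤-or-> Ordinal-ω₁ oα of λ
      { (inj₂ p) → p
      ; (inj₁ p) → ⊥-elim (Cardinal⇒⋠ (proj₁ isω₁) ω∈ω₁ (≼-trans (⊆⇒≼ (≤⇒⊆ oα p)) h)) }

    -- The set `x` together with its union is a countable ordinal.
    ω₁-bounded : ∀ {x} → x ≼ ω → x ⊆ ω₁ → ∃[ k ∈ ω₁ ] x ⊆ k
    ω₁-bounded {x} hx x⊆ω₁ = case ⋃ x of λ (v , hv) → case x ∪ v of λ (u , hu) →
      let mem : ∀ y → y ∈ u → y ∈ ω₁
          mem y y∈u = case to (hu y) y∈u of λ { (inj₁ p) → x⊆ω₁ y p ; (inj₂ p) → case to (hv y) p of λ { (a , a∈x , y∈a) →
            proj₁ Ordinal-ω₁ a (x⊆ω₁ a a∈x) y y∈a } }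
          tr : Transitive u
          tr y y∈u z z∈y = from (hu z) (inj₂ (from (hv z) (case to (hu y) y∈u of λ
            { (inj₁ p) → y , p , z∈y
            ; (inj₂ p) → case to (hv y) p of λ { (a , a∈x , y∈a) →
                a , a∈x , proj₁ (Ordinal-∈ Ordinal-ω₁ (x⊆ω₁ a a∈x)) y y∈a z z∈y } })))
      in u , countable⇒∈ω₁ (mkOrdinal tr λ y p → Ordinal-∈ Ordinal-ω₁ (mem y p))
        (∪-countable hx (⋃-countable hx (λ a a∈x → ∈ω₁⇒countable a (x⊆ω₁ a a∈x)) hv) hu) , λ y p → from (hu y) (inj₁ p)
 
 

  open Alephs ω ω₁ ω₂

  -- T meets the club of nonempty i closed under q, for every total relation q on κ.
  Meets : V → (V → Set ℓ) → Set ℓ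
  Meets κ T = ∀ q → (∀[ j ∈ κ ] ∃[ k ∈ κ ] q [ j ]≈ k) →
    ∃[ i ∈ κ ] (T i × (∃[ j ] j ∈ i) × (∀[ j ∈ i ] ∃[ k ∈ i ] q [ j ]≈ k))

  opaque
    Meets-rel : ∀ {κ T} → Meets κ T → (Q : V → V → Set ℓ) {{_ : Def₂ Q}} → (∀[ j ∈ κ ] ∃[ k ∈ κ ] Q j k) →
      ∃[ i ∈ κ ] (T i × (∃[ j ] j ∈ i) × (∀[ j ∈ i ] ∃[ k ∈ i ] Q j k))
    Meets-rel {κ} m Q {{d}} h = case rel κ κ Q {{d}} of λ (q , hq , _) →
      case m q (λ j p → case h j p of λ (k , r , s) → k , r , from (hq j k) (p , r , s)) of λ (i , i∈κ , i∈T , ne , c) →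
      i , i∈κ , i∈T , ne , λ j p → case c j p of λ (k , r , s) → k , r , proj₂ (proj₂ (to (hq j k) s))

    Meets-⊆ : ∀ {κ T T′} → (∀ i → i ∈ κ → T i → T′ i) → Meets κ T → Meets κ T′
    Meets-⊆ h m q t = case m q t of λ (i , p , r , s) → i , p , h i p r , s

    iterate : ∀ κ (R : V → V → Set ℓ) {{_ : Def₂ R}} a → a ∈ κ → (∀[ x ∈ κ ] ∃[ y ∈ κ ] R x y) →
              ∃[ r ] (r ≼ ω × r ⊆ κ × a ∈ r × (∀[ x ∈ r ] ∃[ y ∈ r ] R x y))
    iterate κ R {{d}} a a∈κ h = case dc κ (λ _ x y → R x y) a a∈κ (λ _ _ → h) of λ (s , fs , s₀ , s⁺) →
      case sep κ (λ x → ∃[ k ] s [ k ]≈ x) of λ (r , hr) → r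
      , ≼-rel r ω (λ x k → s [ k ]≈ x) (λ x p → case to (hr x) p of λ (_ , k , q) → k , Fn.dom fs q , q)
          (λ x x′ k _ _ p p′ → Fn.fun fs p p′)
      , (λ x p → proj₁ (to (hr x) p))
      , (case ∃∅ of λ (e , he) → from (hr a) (a∈κ , e , s₀ e he))
      , λ x p → case to (hr x) p of λ (_ , k , q) → case ∃suc k of λ (k⁺ , hk) →
          case Fn.tot fs k⁺ (suc-∈ω (Fn.dom fs q) hk) of λ (y , q′) →
          y , from (hr y) (Fn.cod fs q′ , k⁺ , q′) , s⁺ k k⁺ x y hk q q′
      where
      instance
        _ : Atom₂ d
        _ = atom₂ d

    Ordinal-⋃ : ∀ {a u} → (∀ x → x ∈ a → Ordinal x) → IsUnion u a → Ordinal u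
    Ordinal-⋃ o hu = mkOrdinal
      (λ x x∈u y y∈x → case to (hu x) x∈u of λ (z , z∈a , x∈z) → from (hu y) (z , z∈a , proj₁ (o z z∈a) x x∈z y y∈x))
      λ x x∈u → case to (hu x) x∈u of λ (z , z∈a , x∈z) → Ordinal-∈ (o z z∈a) x∈z

    ∈ω₁-Ordinal : ∀ {i} → i ∈ ω₁ → Ordinal i
    ∈ω₁-Ordinal = Ordinal-∈ Ordinal-ω₁

    ω₁-bound : ∀ x → x ≼ ω → (R : V → V → Set ℓ) {{_ : Def₂ R}} → (∀[ a ∈ x ] ∃[ k ∈ ω₁ ] R a k) →
               ∃[ b ∈ ω₁ ] (∀[ a ∈ x ] ∃[ k ∈ b ] R a k)
    ω₁-bound x hx R {{d}} h = case choose x ω₁ R {{d}} h of λ (f , ff , f⊆R) → case sep ω₁ (λ k → ∃[ a ] f [ a ]≈ k) of λ (r , hr) →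
      case ω₁-bounded {r} (≼-trans (≼-rel r x (λ k a → f [ a ]≈ k)
          (λ k p → case to (hr k) p of λ (_ , a , q) → a , Fn.dom ff q , q) (λ k k′ a _ _ p p′ → Fn.fun ff p p′)) hx)
        (λ k p → proj₁ (to (hr k) p)) of λ (b , b∈ω₁ , r⊆b) → b , b∈ω₁ ,
      λ a a∈x → case Fn.tot ff a a∈x of λ (k , q) → k , r⊆b k (from (hr k) (Fn.cod ff q , a , q)) , f⊆R a k q

    ω₁-max : ∀ {i j} → i ∈ ω₁ → j ∈ ω₁ → ∃[ k ∈ ω₁ ] (i ∈ k × j ∈ k)
    ω₁-max {i} {j} p q = case upair i j of λ (x , hx) → case ω₁-bounded (upair-countable hx)
      (λ k r → case to (hx k) r of λ { (inj₁ refl) → p ; (inj₂ refl) → q }) of λ (k , k∈ω₁ , x⊆k) →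
      k , k∈ω₁ , x⊆k i (from (hx i) (inj₁ refl)) , x⊆k j (from (hx j) (inj₂ refl))

    -- Each stage has countably many elements, so the next stage can bound some `q`-value of each of
    -- them; the union of ω stages is closed.
    ω₁-closed-point : ∀ q → (∀[ j ∈ ω₁ ] ∃[ k ∈ ω₁ ] q [ j ]≈ k) → ∀ α → α ∈ ω₁ →
      ∃[ i ∈ ω₁ ] (α ∈ i × (∀[ j ∈ i ] ∃[ k ∈ i ] q [ j ]≈ k))
    ω₁-closed-point q h α α∈ω₁ = case ω₁-max α∈ω₁ α∈ω₁ of λ (α′ , α′∈ω₁ , α∈α′ , _) →
      case iterate ω₁ (λ x y → ∀[ j ∈ x ] ∃[ k ∈ y ] q [ j ]≈ k) α′ α′∈ω₁
        (λ x x∈ω₁ → ω₁-bound x (∈ω₁⇒countable x x∈ω₁) (λ j k → q [ j ]≈ k) λ j j∈x → h j (proj₁ Ordinal-ω₁ x x∈ω₁ j j∈x))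
      of λ (r , r≼ω , r⊆ω₁ , α′∈r , cl) → case ⋃ r of λ (i , hi) →
      i , countable⇒∈ω₁ (Ordinal-⋃ (λ x p → ∈ω₁-Ordinal (r⊆ω₁ x p)) hi)
            (⋃-countable r≼ω (λ a p → ∈ω₁⇒countable a (r⊆ω₁ a p)) hi)
        , from (hi α) (α′ , α′∈r , α∈α′)
        , λ j p → case to (hi j) p of λ (x , x∈r , j∈x) → case cl x x∈r of λ (y , y∈r , c) → case c j j∈x of λ (k , k∈y , s) →
            k , from (hi k) (y , y∈r , k∈y) , s

    ω₁-Meets : Meets ω₁ (_∈ ω₁)
    ω₁-Meets q h = case ω₁-closed-point q h ω ω∈ω₁ of λ (i , i∈ω₁ , p , c) → i , i∈ω₁ , i∈ω₁ , (ω , p) , c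

    -- The nonempty closed points of `q` form a club.
    Stationary₁⇒Meets : ∀ {T} → Stationary₁ T → Meets ω₁ (_∈ T)
    Stationary₁⇒Meets {T} (T⊆ω₁ , st) q h =
      case sep ω₁ (λ i → (∃[ j ] j ∈ i) × (∀[ j ∈ i ] ∃[ k ∈ i ] q [ j ]≈ k)) of λ (C , hC) →
      case st C (record
        { subset = λ i p → proj₁ (to (hC i) p)
        ; unbounded = λ α p → case ω₁-closed-point q h α p of λ (i , i∈ω₁ , α∈i , c) → i , from (hC i) (i∈ω₁ , (α , α∈i) , c) , α∈i
        ; closed = λ δ δ∈ω₁ (oδ , ne , _) lim → from (hC δ) (δ∈ω₁ , ne , λ j j∈δ →
            case lim j j∈δ of λ (β , β∈C , j∈β , β∈δ) → case proj₂ (proj₂ (to (hC β) β∈C)) j j∈β of λ (k , k∈β , s) →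
            k , proj₁ oδ β β∈δ k k∈β , s) }) of λ (i , i∈C , i∈T) →
      case to (hC i) i∈C of λ (p , r) → i , p , i∈T , r

    Countable⇒≼ : ∀ {x} → Countable x → x ≼ ω
    Countable⇒≼ (f , i) = Injection⇒≼ i

    ≼⇒Countable : ∀ {x} → x ≼ ω → Countable x
    ≼⇒Countable h = case ≼-injects h of λ (f , ff , j) → f , Fn→Function ff , λ x x′ y p p′ → j x x′ y (ap p) (ap p′)

-- Almost all models of the ideal

record Ideal {ℓ} (𝔐 : Structure ℓ) (ℵ : Cardinals 𝔐) : Set ℓ where
  open SetTheory 𝔐
  open Cardinals ℵ
  open Alephs ω ω₁ ω₂
  field
    θ h Z I : V
    ideal   : IsIdeal θ h Z I
    conc    : ConcentratesOn Z I GIS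
    bounds  : BoundsCompleteness h Z I

module Ideals {ℓ} (em : ExcludedMiddle ℓ) (𝔐 : Structure ℓ) (zfc : SetTheory.ZFC 𝔐) (ℵ : Cardinals 𝔐) (𝔍 : Ideal 𝔐 ℵ) where
  open SetTheory 𝔐
  open Cardinals ℵ
  open Alephs ω ω₁ ω₂
  open Ideal 𝔍
  open IsIdeal ideal public
  open Cardinality em 𝔐 zfc ℵ public

  -- P holds for almost all M.
  𝔸 : (V → Set ℓ) → Set ℓ
  𝔸 P = ∃[ S ∈ I ] (∀[ M ∈ Z ] (¬ P M → M ∈ S))

  -- For x ⊆ h this says that x has size at most ω₁.
  Small : V → Set ℓ
  Small x = 𝔸 (x ⊆_)

  opaque
    𝔸-map : ∀ {P Q} → (∀ M → M ∈ Z → P M → Q M) → 𝔸 P → 𝔸 Q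
    𝔸-map f (S , S∈I , k) = S , S∈I , λ M p nQ → k M p (λ PM → nQ (f M p PM))

    𝔸-∧ : ∀ {P Q} → 𝔸 P → 𝔸 Q → 𝔸 (λ M → P M × Q M)
    𝔸-∧ {P} (S , S∈I , k) (S′ , S′∈I , k′) = case S ∪ S′ of λ (u , hu) → u , unions S S∈I S′ S′∈I u hu , λ M p n →
      from (hu M) (case em {P M} of λ { (yes q) → inj₂ (k′ M p λ q′ → n (q , q′)) ; (no nq) → inj₁ (k M p nq) })

    𝔸-all : ∀ {P} → (∀ M → M ∈ Z → P M) → 𝔸 P
    𝔸-all f = case ∃∅ of λ (e , he) → e , empty e he , λ M p n → ⊥-elim (n (f M p))

    𝔸-witness : ∀ {P} → 𝔸 P → ∃[ M ∈ Z ] P M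
    𝔸-witness (S , S∈I , k) = byContra λ n → proper (downward S S∈I Z λ M p → k M p λ q → n (M , p , q))

    𝔸-filter : ∀ {A} → DualFilter Z I A → 𝔸 (_∈ A)
    𝔸-filter (_ , S , S∈I , hS) = S , S∈I , λ M p n → from (hS M) (p , n)

    𝔸-fine : ∀ {b} → b ∈ h → 𝔸 (b ∈_)
    𝔸-fine {b} p = case fine b p of λ (S , S∈I , hS) → S , S∈I , λ M q n → from (hS M) (q , n)

    ⊆h : ∀ {M} → M ∈ Z → M ⊆ h
    ⊆h p = proj₁ (to (base _) p)

    -- If the exceptional M formed a positive set, choosing a bad `x` in each would be regressive,
    -- hence constant on a positive set by normality, against the hypothesis for that `x`.
    𝔸-diag′ : (P : V → V → Set ℓ) → Def₂ P → (∀ x → x ∈ h → 𝔸 (P x)) → 𝔸 (λ M → ∀[ x ∈ M ] P x M)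
    𝔸-diag′ P d f = case sep Z (λ M → ∃[ x ∈ M ] ¬ P x M) of λ (B , hB) →
      B , byContra (λ B∉I → case choose B h (λ M x → x ∈ M × ¬ P x M)
        (λ M p → case to (hB M) p of λ (M∈Z , x , x∈M , n) → x , ⊆h M∈Z x x∈M , x∈M , n) of λ (g , fg , hg) →
        case normal B (λ M p → proj₁ (to (hB M) p)) B∉I g (proj₁ (Fn→Function fg)) (λ M y r → proj₁ (hg M y (ap r)))
        of λ (S′ , S′⊆B , S′∉I , c , hc) → S′∉I (byContra λ _ → S′∉I (empty S′ λ M p →
          case hg M c (ap (hc M p)) of λ (c∈M , _) →
          case f c (⊆h (proj₁ (to (hB M) (S′⊆B M p))) c c∈M) of λ (S , S∈I , k) →
          S′∉I (downward S S∈I S′ λ M′ p′ → k M′ (proj₁ (to (hB M′) (S′⊆B M′ p′))) (proj₂ (hg M′ c (ap (hc M′ p′))))))))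
      , λ M p n → from (hB M) (p , byContra λ none → n λ x x∈M → byContra λ nP → none (x , x∈M , nP))
      where
      instance
        _ : Atom₂ d
        _ = atom₂ d

    𝔸-diag : (P : V → V → Set ℓ) {{_ : Def₂ P}} → (∀ x → x ∈ h → 𝔸 (P x)) → 𝔸 (λ M → ∀[ x ∈ M ] P x M)
    𝔸-diag P {{d}} = 𝔸-diag′ P d

    -- Fineness puts one witness for a given `x` into almost all M; the diagonal intersection
    -- handles all `x` in M at once.
    𝔸-clos : (R : V → V → Set ℓ) {{_ : Def₂ R}} → 𝔸 (λ M → ∀[ x ∈ M ] ((∃[ y ∈ h ] R x y) → ∃[ y ∈ M ] R x y))
    𝔸-clos R {{d}} = 𝔸-diag (λ x M → (∃[ y ∈ h ] R x y) → ∃[ y ∈ M ] R x y) λ x _ →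
      case em {∃[ y ∈ h ] R x y} of λ
        { (yes (y , y∈h , r)) → 𝔸-map (λ M _ p _ → y , p , r) (𝔸-fine y∈h)
        ; (no n) → 𝔸-all λ M _ p → ⊥-elim (n p) }
      where
      instance
        _ : Atom₂ d
        _ = atom₂ d

    𝔸-clos₂ : (R : V → V → V → Set ℓ) {{_ : Def₃ R}} →
              𝔸 (λ M → ∀[ x ∈ M ] ∀[ x′ ∈ M ] ((∃[ y ∈ h ] R x x′ y) → ∃[ y ∈ M ] R x x′ y))
    𝔸-clos₂ R {{d}} = 𝔸-diag (λ x M → ∀[ x′ ∈ M ] ((∃[ y ∈ h ] R x x′ y) → ∃[ y ∈ M ] R x x′ y)) λ x _ → 𝔸-clos (R x)
      where
      instance
        _ : Atom₃ d
        _ = atom₃ d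

    -- Almost all M include `x`, so a diagonal intersection over M covers an intersection over `x`.
    Small-family : ∀ {x} → Small x → (R : V → V → Set ℓ) {{_ : Def₂ R}} → (∀ a → a ∈ x → 𝔸 (λ M → ∀ z → R a z → z ∈ M)) →
                   𝔸 (λ M → ∀[ a ∈ x ] ∀ z → R a z → z ∈ M)
    Small-family {x} sx R {{d}} f = 𝔸-map (λ M _ (x⊆M , k) a a∈x → k a (x⊆M a a∈x) a∈x)
      (𝔸-∧ sx (𝔸-diag (λ a M → a ∈ x → ∀ z → R a z → z ∈ M) λ a _ → case em {a ∈ x} of λ
        { (yes p) → 𝔸-map (λ M _ k _ → k) (f a p) ; (no n) → 𝔸-all λ M _ p → ⊥-elim (n p) }))
      where
      instance
        _ : Atom₂→ d
        _ = atom₂→ d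

    𝔸-GIS : 𝔸 GIS
    𝔸-GIS = case conc of λ (A , fA , hA) → 𝔸-map (λ M _ → hA M) (𝔸-filter fA)

    GIS⇒≼ω₁ : ∀ {M} → GIS M → M ≼ ω₁
    GIS⇒≼ω₁ ((_ , ss , _) , _) = SameSize⇒≼ ss

    GIS⇒ω₁⊆ : ∀ {M} → GIS M → ω₁ ⊆ M
    GIS⇒ω₁⊆ ((_ , _ , s) , _) = s

    Ordinal-ω₂ : Ordinal ω₂
    Ordinal-ω₂ = proj₁ (proj₁ isω₂)

    ω₁∈ω₂ : ω₁ ∈ ω₂
    ω₁∈ω₂ = proj₁ (proj₂ isω₂)

    GIS⇒ω₂⊈ : ∀ {M} → GIS M → ¬ (ω₂ ⊆ M)
    GIS⇒ω₂⊈ g s = Cardinal⇒⋠ (proj₁ isω₂) ω₁∈ω₂ (≼-trans (⊆⇒≼ s) (GIS⇒≼ω₁ g))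

    identity : ∀ a → ∃[ f ] Function a a f
    identity a = case choose a a _≡_ (λ x p → x , p , refl) of λ (f , ff , _) → f , Fn→Function ff

    -- If μ ≤ ω₁, then M ∩ μ is μ because M includes ω₁; and no cardinal lies strictly between ω₁
    -- and ω₂. If ω₂ < μ, then some M contains ω₂, so the ordinal M ∩ μ has ω₂ as an element and
    -- hence as a subset, although M has size ω₁.
    completeness≡ω₂ : ∀ {μ} → Cardinal μ → μ ⊆ h → 𝔸 (λ M → ∃[ κ ∈ μ ] IsIntersection κ M μ) → μ ≡ ω₂
    completeness≡ω₂ {μ} cμ μ⊆h b = case ∈-tri (proj₁ cμ) Ordinal-ω₂ of λ
      { (inj₂ (inj₁ p)) → p
      ; (inj₁ μ∈ω₂) → case 𝔸-witness (𝔸-∧ 𝔸-GIS b) of λ { (M , _ , g , κ , κ∈μ , hκ) →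
          case ≤-or-> (proj₁ cμ) Ordinal-ω₁ of λ
            { (inj₁ μ≤ω₁) → ⊥-elim (∈-irrefl (subst (_∈ μ) (⊆-antisym (λ x p → proj₂ (to (hκ x) p))
                (λ x p → from (hκ x) (GIS⇒ω₁⊆ g x (≤⇒⊆ Ordinal-ω₁ μ≤ω₁ x p) , p))) κ∈μ))
            ; (inj₂ ω₁∈μ) → ⊥-elim (proj₂ (proj₂ isω₂) μ μ∈ω₂ ω₁∈μ cμ) } }
      ; (inj₂ (inj₂ ω₂∈μ)) → case 𝔸-witness (𝔸-∧ 𝔸-GIS (𝔸-∧ b (𝔸-fine (μ⊆h ω₂ ω₂∈μ)))) of λ
          { (M , _ , g , (κ , κ∈μ , hκ) , ω₂∈M) → ⊥-elim (GIS⇒ω₂⊈ g λ x p → proj₁ (to (hκ x)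
              (proj₁ (Ordinal-∈ (proj₁ cμ) κ∈μ) ω₂ (from (hκ ω₂) (ω₂∈M , ω₂∈μ)) x p))) } }

    bounded : (ω₂ ⊆ h) × (∀ f → Function ω₂ ω₂ f → 𝔸 (OrderTypeExceeds ω₂ f))
    bounded = case bounds of λ { (μ , (cμ , _) , μ⊆h , b) →
      let b′ : ∀ f → Function μ μ f → 𝔸 (OrderTypeExceeds μ f)
          b′ f ff = case b f ff of λ (A , fA , hA) → 𝔸-map (λ M _ p → proj₂ (to (hA M) p)) (𝔸-filter fA)
      -- Any function would do here: only M ∩ μ ∈ μ is read off.
      in case identity μ of λ { (i , fi) →
      case completeness≡ω₂ cμ μ⊆h (𝔸-map (λ M _ (κ , κ∈μ , _ , _ , hκ , _) → κ , κ∈μ , hκ) (b′ i fi)) of λ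
        { refl → μ⊆h , b′ } } }

    ω₂⊆h : ω₂ ⊆ h
    ω₂⊆h = proj₁ bounded

  record Good (M : V) : Set ℓ where
    field
      M∈Z : M ∈ Z
      gis : GIS M
      κ   : V
      κ∈  : κ ∈ ω₂
      hκ  : IsIntersection κ M ω₂

  opaque
    𝔸-Good : 𝔸 Good
    𝔸-Good = case identity ω₂ of λ (i , fi) → 𝔸-map (λ M p (g , κ , κ∈ω₂ , _ , _ , hκ , _) →
      record { M∈Z = p ; gis = g ; κ = κ ; κ∈ = κ∈ω₂ ; hκ = hκ }) (𝔸-∧ 𝔸-GIS (proj₂ bounded i fi))

    good : ∀ {P} → 𝔸 P → ∃[ M ] (Good M × P M)
    good a = case 𝔸-witness (𝔸-∧ 𝔸-Good a) of λ (M , _ , p) → M , p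

    Good⇒⊆ : ∀ {M α} → Good M → α ∈ M → α ∈ ω₂ → α ⊆ M
    Good⇒⊆ g p q x r = let open Good g in
      proj₁ (to (hκ x) (proj₁ (Ordinal-∈ Ordinal-ω₂ κ∈) _ (from (hκ _) (p , q)) x r))

    -- Some good M of size ω₁ contains α, and then includes it because M ∩ ω₂ is an ordinal.
    ∈ω₂⇒≼ω₁ : ∀ {α} → α ∈ ω₂ → α ≼ ω₁
    ∈ω₂⇒≼ω₁ p = case good (𝔸-fine (ω₂⊆h _ p)) of λ (M , g , q) → ≼-trans (⊆⇒≼ (Good⇒⊆ g q p)) (GIS⇒≼ω₁ (Good.gis g))

    ω₁-Small : Small ω₁
    ω₁-Small = 𝔸-map (λ M _ → GIS⇒ω₁⊆) 𝔸-GIS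

    ≼ω₁⇒Small : ∀ {x} → x ⊆ h → x ≼ ω₁ → Small x
    ≼ω₁⇒Small {x} x⊆h (f , tf , jf) = 𝔸-map
      (λ M _ k y y∈x → case tf y y∈x of λ (j , j∈ω₁ , r) → k j j∈ω₁ y (y∈x , r))
      (Small-family ω₁-Small (λ j y → y ∈ x × f [ y ]≈ j) λ j _ → case em {∃[ y ∈ x ] f [ y ]≈ j} of λ
        { (yes (y , y∈x , r)) → 𝔸-map (λ { M _ p z (_ , r′) → subst (_∈ M) (jf y z j r r′) p }) (𝔸-fine (x⊆h y y∈x))
        ; (no n) → 𝔸-all λ M _ z (p , r) → ⊥-elim (n (z , p , r)) })

    ω≼ω₁ : ω ≼ ω₁
    ω≼ω₁ = ⊆⇒≼ (proj₁ Ordinal-ω₁ ω ω∈ω₁)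

    countable⇒Small : ∀ {x} → x ⊆ h → x ≼ ω → Small x
    countable⇒Small s c = ≼ω₁⇒Small s (≼-trans c ω≼ω₁)

    Small⇒≼ω₁ : ∀ {x} → Small x → x ≼ ω₁
    Small⇒≼ω₁ s = case good s of λ (M , g , x⊆M) → ≼-trans (⊆⇒≼ x⊆M) (GIS⇒≼ω₁ (Good.gis g))

    -- This is regularity of ω₂: a model that includes `x` and is closed under `R` has witnesses in
    -- M ∩ ω₂, an ordinal below ω₂.
    ω₂-bound′ : ∀ {x} → Small x → (R : V → V → Set ℓ) → Def₂ R → (∀[ a ∈ x ] ∃[ k ∈ ω₂ ] R a k) →
               ∃[ b ∈ ω₂ ] (∀[ a ∈ x ] ∃[ k ∈ b ] R a k)
    ω₂-bound′ {x} sx R d f = case good (𝔸-∧ sx (𝔸-clos (λ a k → k ∈ ω₂ × R a k))) of λ (M , g , x⊆M , c) →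
      let open Good g in κ , κ∈ , λ a a∈x → case f a a∈x of λ (k , k∈ω₂ , r) →
        case c a (x⊆M a a∈x) (k , ω₂⊆h k k∈ω₂ , k∈ω₂ , r) of λ (k′ , p , q , s) → k′ , from (hκ k′) (p , q) , s
      where
      instance
        _ : Atom₂ d
        _ = atom₂ d

    ω₂-bound : ∀ {x} → Small x → (R : V → V → Set ℓ) {{_ : Def₂ R}} → (∀[ a ∈ x ] ∃[ k ∈ ω₂ ] R a k) →
               ∃[ b ∈ ω₂ ] (∀[ a ∈ x ] ∃[ k ∈ b ] R a k)
    ω₂-bound sx R {{d}} = ω₂-bound′ sx R d

  -- For nonzero δ this says that δ is a limit of cofinality ω.
  Cofinal : V → Set ℓ
  Cofinal δ = ∃[ r ] (r ≼ ω × r ⊆ δ × (∀[ ξ ∈ δ ] ∃[ ρ ∈ r ] ξ ∈ ρ))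

  opaque
    ∈ω₂-Ordinal : ∀ {i} → i ∈ ω₂ → Ordinal i
    ∈ω₂-Ordinal = Ordinal-∈ Ordinal-ω₂

    ∈ω₂⇒⊆ω₂ : ∀ {i} → i ∈ ω₂ → i ⊆ ω₂
    ∈ω₂⇒⊆ω₂ = proj₁ Ordinal-ω₂ _

    ω₁⊆ω₂ : ω₁ ⊆ ω₂
    ω₁⊆ω₂ = ∈ω₂⇒⊆ω₂ ω₁∈ω₂

    ∈ω₂⇒Small : ∀ {i} → i ∈ ω₂ → Small i
    ∈ω₂⇒Small p = ≼ω₁⇒Small (λ x q → ω₂⊆h x (∈ω₂⇒⊆ω₂ p x q)) (∈ω₂⇒≼ω₁ p)

    tc-inside : ∀ {t y} → Transitive t → y ⊆ t → ∃[ s ] (IsTransitiveClosure s y × s ⊆ t)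
    tc-inside {t} {y} tt y⊆t = case sep t (λ z → ∀ u → y ⊆ u → Transitive u → z ∈ u) of λ (s , hs) → s
      , ( (λ z p → from (hs z) (y⊆t z p , λ u y⊆u _ → y⊆u z p))
        , (λ x x∈s z z∈x → case to (hs x) x∈s of λ (x∈t , k) → from (hs z) (tt x x∈t z z∈x , λ u p q → q x (k u p q) z z∈x))
        , λ u p q z z∈s → proj₂ (to (hs z) z∈s) u p q)
      , λ z p → proj₁ (to (hs z) p)

    H-in : ∀ {κ k t y} → Cardinal κ → IsH κ k → Transitive t → Smaller t κ → y ⊆ t → y ∈ k
    H-in cκ hk tt st y⊆t = case tc-inside tt y⊆t of λ (s , tc , s⊆t) → from (hk _) (s , tc , Smaller-⊆ cκ s⊆t st)

    H-⊆ : ∀ {κ k x y} → Cardinal κ → IsH κ k → x ∈ k → y ⊆ x → y ∈ k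
    H-⊆ cκ hk x∈k y⊆x = case to (hk _) x∈k of λ (t , (x⊆t , tt , _) , st) → H-in cκ hk tt st λ z p → x⊆t z (y⊆x z p)

    H-transitive : ∀ {κ k x y} → Cardinal κ → IsH κ k → x ∈ k → y ∈ x → y ∈ k
    H-transitive cκ hk x∈k y∈x = case to (hk _) x∈k of λ (t , (x⊆t , tt , _) , st) → H-in cκ hk tt st (tt _ (x⊆t _ y∈x))

    h-⊆ : ∀ {x y} → x ∈ h → y ⊆ x → y ∈ h
    h-⊆ = H-⊆ (proj₁ regular) isH

    h-transitive : ∀ {x y} → x ∈ h → y ∈ x → y ∈ h
    h-transitive = H-transitive (proj₁ regular) isH

    ≼ω₁⇒Smaller : ∀ {t} → t ≼ ω₁ → Smaller t ω₂
    ≼ω₁⇒Smaller s = case ≼-Ordinal Ordinal-ω₁ s of λ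
      { (β , _ , inj₁ p , ss) → β , ω₁⊆ω₂ β p , ss ; (β , _ , inj₂ refl , ss) → β , ω₁∈ω₂ , ss }

    ∃H₂ : ∃[ h₂ ] IsH ω₂ h₂
    ∃H₂ = case sep h (λ x → ∃[ t ] (IsTransitiveClosure t x × t ≼ ω₁)) of λ (k , hk) → k , λ x → mk⇔
      (λ p → case to (hk x) p of λ (_ , t , tc , s) → t , tc , ≼ω₁⇒Smaller s)
      λ (t , tc , st) → from (hk x) (from (isH x) (t , tc , (case st of λ (α , p , ss) → α , ω₂≤θ α p , ss)) , t , tc ,
        (case st of λ (α , p , ss) → ≼-trans (SameSize⇒≼ ss) (∈ω₂⇒≼ω₁ p)))

    SameSize-refl : ∀ {a} → SameSize a a
    SameSize-refl {a} = mkSameSize a a _≡_ (λ x p → x , p , refl) (λ { x x′ y refl refl → refl })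
      (λ { x y y′ refl refl → refl }) λ y p → y , p , refl

    ω₂-max : ∀ {i j} → i ∈ ω₂ → j ∈ ω₂ → ∃[ k ∈ ω₂ ] (i ∈ k × j ∈ k)
    ω₂-max p q = case good (𝔸-∧ (𝔸-fine (ω₂⊆h _ p)) (𝔸-fine (ω₂⊆h _ q))) of λ (M , g , r , s) →
      let open Good g in κ , κ∈ , from (hκ _) (r , p) , from (hκ _) (s , q)

    -- Each stage of an ω-sequence bounds `q`-values for the elements of the previous one. The
    -- supremum is closed, has cofinality ω by construction, and stays below ω₂ by regularity.
    ω₂-Meets : ∀ {α} → α ∈ ω₂ → Meets ω₂ (λ δ → α ∈ δ × Cofinal δ)
    ω₂-Meets {α} p q t = case ω₂-max p p of λ (a , a∈ω₂ , α∈a , _) →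
      case iterate ω₂ (λ x y → x ∈ y × (∀[ j ∈ x ] ∃[ k ∈ y ] q [ j ]≈ k)) a a∈ω₂
        (λ x x∈ω₂ → case ω₂-bound (∈ω₂⇒Small x∈ω₂) (λ j k → q [ j ]≈ k) (λ j j∈x → t j (∈ω₂⇒⊆ω₂ x∈ω₂ j j∈x)) of λ (b , b∈ω₂ , hb) →
          case ω₂-max x∈ω₂ b∈ω₂ of λ (y , y∈ω₂ , x∈y , b∈y) → y , y∈ω₂ , x∈y , λ j j∈x →
          case hb j j∈x of λ (k , k∈b , r) → k , proj₁ (∈ω₂-Ordinal y∈ω₂) b b∈y k k∈b , r)
      of λ (r , r≼ω , r⊆ω₂ , a∈r , cl) → case ⋃ r of λ (δ , hδ) →
      case ω₂-bound (countable⇒Small (λ x s → ω₂⊆h x (r⊆ω₂ x s)) r≼ω) _∈_ (λ x x∈r → case cl x x∈r of λ (y , y∈r , x∈y , _) →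
        y , r⊆ω₂ y y∈r , x∈y) of λ (b , b∈ω₂ , hb) →
      let oδ : Ordinal δ
          oδ = Ordinal-⋃ (λ x s → ∈ω₂-Ordinal (r⊆ω₂ x s)) hδ
          ob : Ordinal b
          ob = ∈ω₂-Ordinal b∈ω₂
          δ⊆b : δ ⊆ b
          δ⊆b z z∈δ = case to (hδ z) z∈δ of λ (x , x∈r , z∈x) → case hb x x∈r of λ (k , k∈b , x∈k) →
            proj₁ ob x (proj₁ ob k k∈b x x∈k) z z∈x
      in δ , (case ⊆⇒≤ oδ ob δ⊆b of λ { (inj₁ s) → ∈ω₂⇒⊆ω₂ b∈ω₂ δ s ; (inj₂ refl) → b∈ω₂ })
        , (from (hδ α) (a , a∈r , α∈a) , r , r≼ω , (λ x x∈r → case cl x x∈r of λ (y , y∈r , x∈y , _) → from (hδ x) (y , y∈r , x∈y))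
          , λ ξ ξ∈δ → case to (hδ ξ) ξ∈δ of λ (x , x∈r , ξ∈x) → x , x∈r , ξ∈x)
        , (α , from (hδ α) (a , a∈r , α∈a))
        , λ j j∈δ → case to (hδ j) j∈δ of λ (x , x∈r , j∈x) → case cl x x∈r of λ (y , y∈r , _ , c) →
            case c j j∈x of λ (k , k∈y , s) → k , from (hδ k) (y , y∈r , k∈y) , s

    Meets-above : ∀ {α S} → α ∈ ω₂ → Meets ω₂ S → Meets ω₂ (λ δ → α ∈ δ × S δ)
    Meets-above {α} {S} p m q t = case Meets-rel {ω₂} {S} m (λ l k → α ∈ k × (∃[ k′ ∈ k ] q [ l ]≈ k′))
      (λ l l∈ω₂ → case t l l∈ω₂ of λ (k′ , k′∈ω₂ , r) → case ω₂-max p k′∈ω₂ of λ (k , k∈ω₂ , s , s′) → k , k∈ω₂ , s , k′ , s′ , r)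
      of λ (i , i∈ω₂ , Si , (j , j∈i) , c) → let oi = ∈ω₂-Ordinal i∈ω₂ in
      i , i∈ω₂ , ((case c j j∈i of λ (k , k∈i , α∈k , _) → proj₁ oi k k∈i α α∈k) , Si) , (j , j∈i)
      , λ l l∈i → case c l l∈i of λ (k , k∈i , _ , k′ , k′∈k , r) → k′ , proj₁ oi k k∈i k′ k′∈k , r

  -- Pressing down on ω₂

  module Fodor (P : V → V → Set ℓ) (d : Def₂ P) where
    -- The closed points of `q` witness that the set of δ with `P δ γ` is not stationary.
    Regress : V → V → Set ℓ
    Regress γ q = (∀[ j ∈ ω₂ ] ∃[ k ∈ ω₂ ] q [ j ]≈ k) ×
      (∀[ i ∈ ω₂ ] ((∃[ j ] j ∈ i) → (∀[ j ∈ i ] ∃[ k ∈ i ] q [ j ]≈ k) → ¬ P i γ))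

    -- Its closed points lie in the diagonal intersection of the clubs given by the relations F(γ).
    Diagonal : V → V → V → Set ℓ
    Diagonal F l k = l ∈ k × (∀[ γ ∈ l ] ∀[ l′ ∈ l ] ∃[ k′ ∈ k ] ∃[ q ] (F [ γ ]≈ q × q [ l′ ]≈ k′))

    opaque
      def-Regress : Def₂ Regress
      def-Regress = auto
        where
        instance
          _ : Atom₂ d
          _ = atom₂ d

      def-Diagonal : ∀ F → Def₂ (Diagonal F)
      def-Diagonal F = auto

      Regress-witness : ∀ {w c} → IsSetOf c (λ p → ∃[ x ∈ ω₂ ] ∃[ y ∈ ω₂ ] Pr p x y) → (∀ p → p ∈ w ⇔ p ⊆ c) →
        ∀ γ → ¬ Meets ω₂ (λ δ → P δ γ) → ∃[ q ∈ w ] Regress γ q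
      Regress-witness hc hw γ fails = byContra λ none → fails λ q t → byContra λ miss →
        -- The later choice ranges over subsets of ω₂ × ω₂, so `q` is cut down to one.
        case rel ω₂ ω₂ (λ j k → q [ j ]≈ k) of λ (q′ , hq , pq) → none (q′
        , from (hw q′) (λ p p∈q → from (hc p) (pq p p∈q))
        , (λ j p → case t j p of λ (k , k∈ω₂ , r) → k , k∈ω₂ , from (hq j k) (p , k∈ω₂ , r))
        , λ i i∈ω₂ ne cl Pi → miss (i , i∈ω₂ , Pi , ne , λ j p → case cl j p of λ (k , k∈i , r) →
            k , k∈i , proj₂ (proj₂ (to (hq j k) r))))

      inner : ∀ F {l γ q} → l ∈ ω₂ → F [ γ ]≈ q → Regress γ q →
        ∃[ b ∈ ω₂ ] (∀[ l′ ∈ l ] ∃[ k′ ∈ b ] ∃[ q ] (F [ γ ]≈ q × q [ l′ ]≈ k′))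
      inner F {l} {γ} {q} l∈ω₂ r reg = ω₂-bound (∈ω₂⇒Small l∈ω₂) (λ l′ k′ → ∃[ q ] (F [ γ ]≈ q × q [ l′ ]≈ k′))
        λ l′ l′∈l → case proj₁ reg l′ (∈ω₂⇒⊆ω₂ l∈ω₂ l′ l′∈l) of λ (k , p , s) → k , p , q , r , s

      outer : ∀ F l → l ∈ ω₂ → (∀[ γ ∈ l ] ∃[ q ] (F [ γ ]≈ q × Regress γ q)) → ∃[ k ∈ ω₂ ] Diagonal F l k
      outer F l l∈ω₂ f = case ω₂-bound (∈ω₂⇒Small l∈ω₂)
          (λ γ b → b ∈ ω₂ × (∀[ l′ ∈ l ] ∃[ k′ ∈ b ] ∃[ q ] (F [ γ ]≈ q × q [ l′ ]≈ k′)))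
          (λ γ γ∈l → case f γ γ∈l of λ (q , r , reg) → case inner F l∈ω₂ r reg of λ (b , b∈ω₂ , hb) → b , b∈ω₂ , b∈ω₂ , hb)
        of λ (B , B∈ω₂ , hB) → case ω₂-max l∈ω₂ B∈ω₂ of λ (k , k∈ω₂ , l∈k , B∈k) → k , k∈ω₂ , l∈k , λ γ γ∈l l′ l′∈l →
        case hB γ γ∈l of λ (b , b∈B , _ , hb) → case hb l′ l′∈l of λ (k′ , k′∈b , r) →
        k′ , proj₁ (∈ω₂-Ordinal k∈ω₂) B B∈k k′ (proj₁ (∈ω₂-Ordinal B∈ω₂) b b∈B k′ k′∈b) , r

      max : ∀ {δ γ l} → Ordinal δ → (∀ x → x ∈ δ → ∃[ k ∈ δ ] x ∈ k) → γ ∈ δ → l ∈ δ → ∃[ m ∈ δ ] (γ ∈ m × l ∈ m)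
      max {δ} {γ} {l} oδ up p q = case up γ p of λ (a , a∈δ , γ∈a) → case up l q of λ (b , b∈δ , l∈b) →
        case ∈-tri (Ordinal-∈ oδ a∈δ) (Ordinal-∈ oδ b∈δ) of λ
        { (inj₁ r) → b , b∈δ , proj₁ (Ordinal-∈ oδ b∈δ) a r γ γ∈a , l∈b
        ; (inj₂ (inj₁ refl)) → a , a∈δ , γ∈a , l∈b
        ; (inj₂ (inj₂ r)) → a , a∈δ , γ∈a , proj₁ (Ordinal-∈ oδ a∈δ) b r l l∈b }

      Diagonal-closed : ∀ {F δ γ q} → (∀ {q q′} → F [ γ ]≈ q → F [ γ ]≈ q′ → q ≡ q′) → F [ γ ]≈ q → Ordinal δ → γ ∈ δ →
        (∀[ l ∈ δ ] ∃[ k ∈ δ ] Diagonal F l k) → ∀[ l ∈ δ ] ∃[ k ∈ δ ] q [ l ]≈ k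
      Diagonal-closed fun r oδ γ∈δ cl l l∈δ =
        case max oδ (λ x x∈δ → case cl x x∈δ of λ (k , p , s , _) → k , p , s) γ∈δ l∈δ of λ { (m , m∈δ , γ∈m , l∈m) →
        case cl m m∈δ of λ { (k , k∈δ , _ , c) → case c _ γ∈m l l∈m of λ { (k′ , k′∈k , q′ , r′ , s) →
        case fun r r′ of λ { refl → k′ , proj₁ oδ k k∈δ k′ k′∈k , s } } } }

      fodor : Meets ω₂ (λ δ → ∃[ γ ∈ δ ] P δ γ) → ∃[ γ ∈ ω₂ ] Meets ω₂ (λ δ → P δ γ)
      fodor m = byContra λ none → case prod ω₂ ω₂ of λ (c , hc) → case powerSet c of λ (w , hw) →
        case choose ω₂ w Regress {{def-Regress}} (λ γ γ∈ω₂ → Regress-witness hc hw γ λ m → none (γ , γ∈ω₂ , m)) of λ (F , fF , hF) →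
        case Meets-rel {ω₂} {λ δ → ∃[ γ ∈ δ ] P δ γ} m (Diagonal F) {{def-Diagonal F}} (λ l l∈ω₂ → outer F l l∈ω₂ λ γ γ∈l →
          case Fn.tot fF γ (∈ω₂⇒⊆ω₂ l∈ω₂ γ γ∈l) of λ (q , r) → q , r , hF γ q r)
        of λ (δ , δ∈ω₂ , (γ , γ∈δ , Pδγ) , ne , cl) →
        case Fn.tot fF γ (∈ω₂⇒⊆ω₂ δ∈ω₂ γ γ∈δ) of λ (q , r) → proj₂ (hF γ q r) δ δ∈ω₂ ne
          (Diagonal-closed (Fn.fun fF) r (∈ω₂-Ordinal δ∈ω₂) γ∈δ cl) Pδγ

  Inj₁ : V → V → Set ℓ
  Inj₁ δ f = ((∀[ x ∈ δ ] ∃[ y ] f [ x ]≈ y) × (∀ x y → f [ x ]≈ y → x ∈ δ × y ∈ ω₁)) ×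
    ((∀ x y y′ → f [ x ]≈ y → f [ x ]≈ y′ → y ≡ y′) × (∀ x x′ y → f [ x ]≈ y → f [ x′ ]≈ y → x ≡ x′))

  opaque
    def-Inj₁ : Def₂ Inj₁
    def-Inj₁ = auto

    ∃ε : ∃[ ε ] ∃[ w ] (Fn ω₂ w ε × (∀ δ f → ε [ δ ]≈ f → Inj₁ δ f))
    ∃ε = case prod ω₂ ω₁ of λ (c , hc) → case powerSet c of λ (w , hw) →
      case choose ω₂ w Inj₁ {{def-Inj₁}}
        (λ δ δ∈ω₂ → case ≼-injects (∈ω₂⇒≼ω₁ δ∈ω₂) of λ (f , ff , jf) → f
          , from (hw f) (λ p p∈f → case Fn.prs ff p p∈f of λ (x , x∈δ , r) → from (hc p) (x , ∈ω₂⇒⊆ω₂ δ∈ω₂ x x∈δ , r))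
          , (Fn.tot ff , λ x y r → Fn.dom ff r , Fn.cod ff r) , ((λ x y y′ → Fn.fun ff) , jf))
      of λ (ε , fε , hε) → ε , w , fε , hε

  -- The sets picked here are arbitrary but must be the same throughout: pieces of different
  -- ordinals are compared through one fixed ε.
  record Chosen : Set ℓ where
    field
      h₂ ε w : V
      isH₂   : IsH ω₂ h₂
      fε     : Fn ω₂ w ε
      hε     : ∀ δ f → ε [ δ ]≈ f → Inj₁ δ f

  opaque
    chosen : Chosen
    chosen = case ∃H₂ of λ (h₂ , isH₂) → case ∃ε of λ (ε , w , fε , hε) →
      record { h₂ = h₂ ; ε = ε ; w = w ; isH₂ = isH₂ ; fε = fε ; hε = hε }

-- Countable closures in H(ω₂)

module Closure {ℓ} (em : ExcludedMiddle ℓ) (𝔐 : Structure ℓ) (zfc : SetTheory.ZFC 𝔐) (ℵ : Cardinals 𝔐) (𝔍 : Ideal 𝔐 ℵ) where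
  open SetTheory 𝔐
  open Cardinals ℵ
  open Alephs ω ω₁ ω₂
  open Ideal 𝔍
  open Ideals em 𝔐 zfc ℵ 𝔍 public
  open Chosen chosen

  opaque
    H₂⊆h : h₂ ⊆ h
    H₂⊆h x p = case to (isH₂ x) p of λ (t , tc , α , q , ss) → from (isH x) (t , tc , α , ω₂≤θ α q , ss)

    ω₂⊆H₂ : ω₂ ⊆ h₂
    ω₂⊆H₂ α p = from (isH₂ α) (α , ((λ _ q → q) , proj₁ (∈ω₂-Ordinal p) , λ u q _ → q) , α , p , SameSize-refl)

    ⊆ω₁⇒∈H₂ : ∀ {T} → T ⊆ ω₁ → T ∈ h₂
    ⊆ω₁⇒∈H₂ = H-⊆ (proj₁ isω₂) isH₂ (ω₂⊆H₂ ω₁ ω₁∈ω₂)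

    H₂-transitive : ∀ {x y} → x ∈ h₂ → y ∈ x → y ∈ h₂
    H₂-transitive = H-transitive (proj₁ isω₂) isH₂

    -- The transitive closure of each element of `y` has size at most ω₁ and is therefore included
    -- in almost all M. As `y` is countable, some single M of size ω₁ includes them all.
    countable⇒∈H₂ : ∀ {y} → y ⊆ h₂ → y ≼ ω → y ∈ h₂
    countable⇒∈H₂ {y} y⊆ cy =
      case sep h (λ z → z ∈ y ⊎ (∃[ x ∈ y ] (∀ t → Transitive t → x ⊆ t → z ∈ t))) of λ (t , ht) →
      H-in (proj₁ isω₂) isH₂
        (λ z z∈t v v∈z → case to (ht z) z∈t of λ
          { (z∈h , inj₁ z∈y) → from (ht v) (h-transitive z∈h v∈z , inj₂ (z , z∈y , λ t _ z⊆t → z⊆t v v∈z))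
          ; (z∈h , inj₂ (x , x∈y , k)) → from (ht v) (h-transitive z∈h v∈z , inj₂ (x , x∈y , λ t tt x⊆t → tt z (k t tt x⊆t) v v∈z)) })
        (≼ω₁⇒Smaller (Small⇒≼ω₁ (𝔸-map (λ M _ (y⊆M , k) z z∈t → case to (ht z) z∈t of λ
            { (_ , inj₁ z∈y) → y⊆M z z∈y ; (_ , inj₂ (x , x∈y , p)) → k x x∈y z p })
          (𝔸-∧ sy (Small-family sy (λ x z → ∀ t → Transitive t → x ⊆ t → z ∈ t) below)))))
        (λ z z∈y → from (ht z) (H₂⊆h z (y⊆ z z∈y) , inj₁ z∈y))
      where
      sy : Small y
      sy = countable⇒Small (λ z p → H₂⊆h z (y⊆ z p)) cy
      below : ∀ x → x ∈ y → 𝔸 (λ M → ∀ z → (∀ t → Transitive t → x ⊆ t → z ∈ t) → z ∈ M)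
      below x x∈y = case to (isH₂ x) (y⊆ x x∈y) of λ (s , (x⊆s , ts , min) , α , α∈ω₂ , ss) →
        𝔸-map (λ M _ s⊆M z k → s⊆M z (k s ts x⊆s))
          (≼ω₁⇒Small (min h (λ v v∈x → H₂⊆h v (H₂-transitive (y⊆ x x∈y) v∈x)) (λ a a∈h b b∈a → h-transitive a∈h b∈a))
            (≼-trans (SameSize⇒≼ ss) (∈ω₂⇒≼ω₁ α∈ω₂)))

    Ordinal-max : ∀ {δ γ l} → Ordinal δ → (∀ x → x ∈ δ → ∃[ k ∈ δ ] x ∈ k) → γ ∈ δ → l ∈ δ → ∃[ m ∈ δ ] (γ ∈ m × l ∈ m)
    Ordinal-max {δ} {γ} {l} oδ up p q = case up γ p of λ (a , a∈δ , γ∈a) → case up l q of λ (b , b∈δ , l∈b) →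
      case ∈-tri (Ordinal-∈ oδ a∈δ) (Ordinal-∈ oδ b∈δ) of λ
      { (inj₁ r) → b , b∈δ , proj₁ (Ordinal-∈ oδ b∈δ) a r γ γ∈a , l∈b
      ; (inj₂ (inj₁ refl)) → a , a∈δ , γ∈a , l∈b
      ; (inj₂ (inj₂ r)) → a , a∈δ , γ∈a , proj₁ (Ordinal-∈ oδ a∈δ) b r l l∈b }

    -- E δ ξ j: the injection chosen for δ sends ξ to j.
    E : V → V → V → Set ℓ
    E δ ξ j = ∃[ f ] (ε [ δ ]≈ f × f [ ξ ]≈ j)

    def-E : Def₃ E
    def-E = auto {X = Def₃ (λ δ ξ j → ∃[ f ] (ε [ δ ]≈ f × f [ ξ ]≈ j))}

    E-tot : ∀ {δ ξ} → δ ∈ ω₂ → ξ ∈ δ → ∃[ j ∈ ω₁ ] E δ ξ j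
    E-tot {δ} {ξ} p q = case Fn.tot fε δ p of λ (f , r) → case hε δ f r of λ ((tot , dom) , _) →
      case tot ξ q of λ (j , s) → j , proj₂ (dom ξ j s) , f , r , s

    E-dom : ∀ {δ ξ j} → E δ ξ j → δ ∈ ω₂ × ξ ∈ δ × j ∈ ω₁
    E-dom {δ} (f , r , s) = Fn.dom fε r , proj₂ (proj₁ (hε δ f r)) _ _ s

    E-fun : ∀ {δ ξ j j′} → E δ ξ j → E δ ξ j′ → j ≡ j′
    E-fun {δ} (f , r , s) (f′ , r′ , s′) = case Fn.fun fε r r′ of λ { refl → proj₁ (proj₂ (hε δ f r)) _ _ _ s s′ }

    E-inj : ∀ {δ ξ ξ′ j} → E δ ξ j → E δ ξ′ j → ξ ≡ ξ′
    E-inj {δ} (f , r , s) (f′ , r′ , s′) = case Fn.fun fε r r′ of λ { refl → proj₂ (proj₂ (hε δ f r)) _ _ _ s s′ }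

  instance
    i-E : Atom₃ def-E
    i-E = atom₃ def-E

    ×E : Atom₃× def-E
    ×E = atom₃× def-E

    →E : Atom₃→ def-E
    →E = atom₃→ def-E

  module Hull (K : V → V → V → Set ℓ) (dK : Def₃ K) (K⊆H₂ : ∀ {x x′ z} → K x x′ z → z ∈ h₂)
              (K-countable : ∀ {x x′} → x ∈ h₂ → x′ ∈ h₂ → ∃[ s ] (s ≼ ω × s ⊆ h₂ × (∀ z → K x x′ z → z ∈ s)))
              (K-∈ω₁ : ∀ {x x′ z} → x ∈ ω₁ → z ∈ x → K x x′ z)
              (p : V) (p∈H₂ : p ∈ h₂) where

    Closed : V → Set ℓ
    Closed Y = ∀[ x ∈ Y ] ∀[ x′ ∈ Y ] ∀ z → K x x′ z → z ∈ Y

    private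
      instance
        →K : Atom₃→ dK
        →K = atom₃→ dK

    opaque
      -- Cl δ i is the closure of {p} and the i-th piece of δ.
      Cl : V → V → V → Set ℓ
      Cl δ i z = z ∈ h₂ × (∀ Y → Closed Y → p ∈ Y → (∀ ξ j → j ∈ i → E δ ξ j → ξ ∈ Y) → z ∈ Y)

      def-Cl : Def₃ Cl
      def-Cl = auto {X = Def₃ (λ δ i z → z ∈ h₂ × (∀ Y → Closed Y → p ∈ Y → (∀ ξ j → j ∈ i → E δ ξ j → ξ ∈ Y) → z ∈ Y))}

      Cl⊆H₂ : ∀ {δ i z} → Cl δ i z → z ∈ h₂
      Cl⊆H₂ = proj₁

      Cl-min : ∀ {δ i Y} → Closed Y → p ∈ Y → (∀ ξ j → j ∈ i → E δ ξ j → ξ ∈ Y) → ∀ z → Cl δ i z → z ∈ Y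
      Cl-min c q g z (_ , k) = k _ c q g

      Cl-closed : ∀ {δ i x x′ z} → Cl δ i x → Cl δ i x′ → K x x′ z → Cl δ i z
      Cl-closed (_ , k) (_ , k′) r = K⊆H₂ r , λ Y c q g → c _ (k Y c q g) _ (k′ Y c q g) _ r

      Cl-p : ∀ {δ i} → Cl δ i p
      Cl-p = p∈H₂ , λ Y c q g → q

      Cl-gen : ∀ {δ i ξ j} → j ∈ i → E δ ξ j → Cl δ i ξ
      Cl-gen q r = case E-dom r of λ (s , t , _) → ω₂⊆H₂ _ (∈ω₂⇒⊆ω₂ s _ t) , λ Y c _ g → g _ _ q r

      Cl-set : ∀ δ i → ∃[ Y ] (IsSetOf Y (Cl δ i) × Closed Y × Y ⊆ h₂)
      Cl-set δ i = case sep h₂ (Cl δ i) of λ (Y , hY) → Y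
        , (λ z → mk⇔ (λ q → proj₂ (to (hY z) q)) λ q → from (hY z) (proj₁ q , q))
        , (λ x q x′ q′ z r → from (hY z) (K⊆H₂ r , Cl-closed (proj₂ (to (hY x) q)) (proj₂ (to (hY x′) q′)) r))
        , λ z q → proj₁ (to (hY z) q)

    instance
      i-Cl : Atom₃ def-Cl
      i-Cl = atom₃ def-Cl

      ×Cl : Atom₃× def-Cl
      ×Cl = atom₃× def-Cl

      →Cl : Atom₃→ def-Cl
      →Cl = atom₃→ def-Cl

    opaque
      Cl-⊆ : ∀ {β i δ i′} → (∀ ξ j → j ∈ i → E β ξ j → Cl δ i′ ξ) → ∀ z → Cl β i z → Cl δ i′ z
      Cl-⊆ {δ = δ} {i′} g z q = case Cl-set δ i′ of λ (Y , hY , cY , _) →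
        to (hY z) (Cl-min cY (from (hY p) Cl-p) (λ ξ j r s → from (hY ξ) (g ξ j r s)) z q)

      Cl-mono : ∀ {δ i i′} → i ⊆ i′ → ∀ z → Cl δ i z → Cl δ i′ z
      Cl-mono s = Cl-⊆ λ ξ j q r → Cl-gen (s j q) r

      -- Since `i` is a limit, the union of the closures for smaller indices is already closed.
      Cl-continuous : ∀ {δ i} → Ordinal i → (∃[ j ] j ∈ i) → (∀ j → j ∈ i → ∃[ k ∈ i ] j ∈ k) →
                      ∀ z → Cl δ i z → ∃[ j ∈ i ] Cl δ j z
      Cl-continuous {δ} {i} oi (j₀ , j₀∈i) up z q = case sep h₂ (λ z → ∃[ j ∈ i ] Cl δ j z) of λ (Y , hY) →
        proj₂ (to (hY z) (Cl-min
          (λ x r x′ r′ v k → case to (hY x) r of λ (_ , j , j∈i , c) → case to (hY x′) r′ of λ (_ , j′ , j′∈i , c′) →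
            case Ordinal-max oi up j∈i j′∈i of λ (m , m∈i , j∈m , j′∈m) → let om = Ordinal-∈ oi m∈i in
            from (hY v) (K⊆H₂ k , m , m∈i , Cl-closed (Cl-mono (proj₁ om j j∈m) x c) (Cl-mono (proj₁ om j′ j′∈m) x′ c′) k))
          (from (hY p) (p∈H₂ , j₀ , j₀∈i , Cl-p))
          (λ ξ j j∈i r → case up j j∈i of λ (k , k∈i , j∈k) → from (hY ξ) (Cl⊆H₂ (Cl-gen j∈k r) , k , k∈i , Cl-gen j∈k r)) z q))

      𝔸-Closed : 𝔸 (λ M → ∀[ x ∈ M ] (x ∈ h₂ → ∀[ x′ ∈ M ] (x′ ∈ h₂ → ∀ z → K x x′ z → z ∈ M)))
      𝔸-Closed = 𝔸-diag (λ x M → x ∈ h₂ → ∀[ x′ ∈ M ] (x′ ∈ h₂ → ∀ z → K x x′ z → z ∈ M)) λ x _ →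
        case em {x ∈ h₂} of λ
        { (no r) → 𝔸-all λ M _ q → ⊥-elim (r q)
        ; (yes q) → 𝔸-map (λ M _ f _ → f) (𝔸-diag (λ x′ M → x′ ∈ h₂ → ∀ z → K x x′ z → z ∈ M) λ x′ _ →
            case em {x′ ∈ h₂} of λ
            { (no r′) → 𝔸-all λ M _ q′ → ⊥-elim (r′ q′)
            ; (yes q′) → case K-countable q q′ of λ (s , cs , s⊆ , hs) →
                𝔸-map (λ M _ s⊆M _ z k → s⊆M z (hs z k)) (countable⇒Small (λ z r → H₂⊆h z (s⊆ z r)) cs) }) }

      Cl⊆M : ∀ {δ M i} → Good M → i ⊆ ω₁ → δ ∈ ω₂ → δ ∈ M → p ∈ M →
             (∀[ x ∈ M ] (x ∈ h₂ → ∀[ x′ ∈ M ] (x′ ∈ h₂ → ∀ z → K x x′ z → z ∈ M))) → ∀ z → Cl δ i z → z ∈ M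
      Cl⊆M {δ} {M} g i⊆ω₁ δ∈ω₂ δ∈M p∈M c z q = case sep M (_∈ h₂) of λ (Y , hY) → proj₁ (to (hY z) (Cl-min
        (λ x r x′ r′ v k → case to (hY x) r of λ (s , t) → case to (hY x′) r′ of λ (s′ , t′) → from (hY v) (c x s t x′ s′ t′ v k , K⊆H₂ k))
        (from (hY p) (p∈M , p∈H₂))
        (λ ξ j _ r → case E-dom r of λ (_ , ξ∈δ , _) → from (hY ξ) (Good⇒⊆ g δ∈M δ∈ω₂ ξ ξ∈δ , ω₂⊆H₂ ξ (∈ω₂⇒⊆ω₂ δ∈ω₂ ξ ξ∈δ)))
        z q))

    private
      -- The closure conditions on M, pulled back along an injection f of M into ω₁.
      Pull : V → V → V → V → V → Set ℓ
      Pull f M j j′ b = ∀ x x′ → x ∈ M → x ∈ h₂ → x′ ∈ M → x′ ∈ h₂ → f [ x ]≈ j → f [ x′ ]≈ j′ →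
                        ∀ z → K x x′ z → ∃[ k ∈ b ] f [ z ]≈ k

      Pulled : V → V → V → V → V → Set ℓ
      Pulled f M b₀ l k = l ∈ k × b₀ ∈ k × (∀[ j ∈ l ] ∀[ j′ ∈ l ] Pull f M j j′ k)

      opaque

        def-Pull₃ : ∀ f M → Def₃ (Pull f M)
        def-Pull₃ f M = auto

        def-Pulled : ∀ f M b₀ → Def₂ (Pulled f M b₀)
        def-Pulled f M b₀ = def-× auto (def-× auto (def-∀ (def-→ auto (def-∀ (def-→ auto (get (atom₃ (def-Pull₃ f M))))))))

      module _ (f M : V) (tf : ∀[ x ∈ M ] ∃[ y ∈ ω₁ ] f [ x ]≈ y) (jf : ∀ x x′ y → f [ x ]≈ y → f [ x′ ]≈ y → x ≡ x′)
               (cM : ∀[ x ∈ M ] (x ∈ h₂ → ∀[ x′ ∈ M ] (x′ ∈ h₂ → ∀ z → K x x′ z → z ∈ M))) where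
        opaque
          pull : ∀ j j′ → ∃[ b ∈ ω₁ ] Pull f M j j′ b
          pull j j′ with em {∃[ x ] ∃[ x′ ] ((x ∈ M × x ∈ h₂ × f [ x ]≈ j) × (x′ ∈ M × x′ ∈ h₂ × f [ x′ ]≈ j′))}
          ... | no none = ω , ω∈ω₁ , λ x x′ a b a′ b′ r r′ → ⊥-elim (none (x , x′ , (a , b , r) , (a′ , b′ , r′)))
          ... | yes (x , x′ , (a , b , r) , (a′ , b′ , r′)) = case K-countable b b′ of λ (s , cs , s⊆ , hs) →
            case sep s (_∈ M) of λ (s′ , hs′) →
            case ω₁-bound s′ (≼-trans (⊆⇒≼ λ z q → proj₁ (to (hs′ z) q)) cs) (λ z k → f [ z ]≈ k)
              (λ z q → tf z (proj₂ (to (hs′ z) q))) of λ (c , c∈ω₁ , hc) →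
            c , c∈ω₁ , λ x₁ x₁′ _ _ _ _ r₁ r₁′ z k → hc z (from (hs′ z) (same (jf _ _ _ r r₁) (jf _ _ _ r′ r₁′) hs k a b a′ b′))
            where
            same : ∀ {x x′ x₁ x₁′ s z} → x ≡ x₁ → x′ ≡ x₁′ → (∀ z → K x x′ z → z ∈ s) → K x₁ x₁′ z →
                   x ∈ M → x ∈ h₂ → x′ ∈ M → x′ ∈ h₂ → z ∈ s × z ∈ M
            same {z = z} refl refl hs k a b a′ b′ = hs z k , cM _ a b _ a′ b′ z k

          Pull-mono : ∀ {j j′ b c} → b ⊆ c → Pull f M j j′ b → Pull f M j j′ c
          Pull-mono s P x x′ a b a′ b′ r r′ z k = case P x x′ a b a′ b′ r r′ z k of λ (i , q , t) → i , s i q , t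

          pulled : ∀ b₀ → b₀ ∈ ω₁ → ∀ l → l ∈ ω₁ → ∃[ k ∈ ω₁ ] Pulled f M b₀ l k
          pulled b₀ b₀∈ω₁ l l∈ω₁ =
            case ω₁-bound l cl (λ j b → b ∈ ω₁ × (∀[ j′ ∈ l ] ∃[ b′ ∈ b ] Pull f M j j′ b′)) {{d}}
              (λ j _ → case ω₁-bound l cl (Pull f M j) {{get (atom₃ (def-Pull₃ f M))}} (λ j′ _ → pull j j′) of λ (b , b∈ω₁ , hb) → b , b∈ω₁ , b∈ω₁ , hb)
            of λ (B , B∈ω₁ , hB) → case ω₁-max l∈ω₁ b₀∈ω₁ of λ (k₁ , k₁∈ω₁ , l∈k₁ , b₀∈k₁) → case ω₁-max k₁∈ω₁ B∈ω₁ of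
            λ (k , k∈ω₁ , k₁∈k , B∈k) → let ok = ∈ω₁-Ordinal k∈ω₁ ; oB = ∈ω₁-Ordinal B∈ω₁ in
            k , k∈ω₁ , proj₁ ok k₁ k₁∈k l l∈k₁ , proj₁ ok k₁ k₁∈k b₀ b₀∈k₁ , λ j j∈l j′ j′∈l →
            case hB j j∈l of λ (b , b∈B , _ , hb) → case hb j′ j′∈l of λ (b′ , b′∈b , P) →
            Pull-mono (λ i q → proj₁ ok B B∈k i (proj₁ oB b b∈B i (proj₁ (Ordinal-∈ oB b∈B) b′ b′∈b i q))) P
            where
            cl : l ≼ ω
            cl = ∈ω₁⇒countable l l∈ω₁
            d : Def₂ (λ j b → b ∈ ω₁ × (∀[ j′ ∈ l ] ∃[ b′ ∈ b ] Pull f M j j′ b′))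
            d = def-× auto (def-∀ (def-→ auto (def-∃ (def-× auto (get (atom₃ (def-Pull₃ f M)))))))

          -- The preimage under `f` of a closed point of `Pulled` is countable, and it inherits
          -- closure under `K` from that point.
          countable-closed : ∀ a → a ≼ ω → a ⊆ h₂ → a ⊆ M → ∃[ S ] (S ≼ ω × S ⊆ h₂ × a ⊆ S × Closed S)
          countable-closed a ca a⊆ a⊆M = case ω₁-bound a ca (λ x j → f [ x ]≈ j) (λ x q → tf x (a⊆M x q)) of λ (b₀ , b₀∈ω₁ , hb₀) →
            case Meets-rel ω₁-Meets (Pulled f M b₀) {{def-Pulled f M b₀}} (pulled b₀ b₀∈ω₁) of
              λ (i , i∈ω₁ , _ , (j₀ , j₀∈i) , up) → let oi = ∈ω₁-Ordinal i∈ω₁ in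
            case sep M (λ x → x ∈ h₂ × (∃[ j ∈ i ] f [ x ]≈ j)) of λ (S , hS) → S
            , ≼-trans (≼-rel S i (λ x j → f [ x ]≈ j) (λ x q → proj₂ (proj₂ (to (hS x) q))) (λ x x′ j _ _ → jf x x′ j))
                (∈ω₁⇒countable i i∈ω₁)
            , (λ x q → proj₁ (proj₂ (to (hS x) q)))
            , (λ x q → case hb₀ x q of λ (j , j∈b₀ , r) → case up j₀ j₀∈i of λ (k , k∈i , _ , b₀∈k , _) →
                from (hS x) (a⊆M x q , a⊆ x q , j , proj₁ oi k k∈i j (proj₁ (Ordinal-∈ oi k∈i) b₀ b₀∈k j j∈b₀) , r))
            , λ x q x′ q′ z r → case to (hS x) q of λ (xM , xH , j , j∈i , s) → case to (hS x′) q′ of λ (xM′ , xH′ , j′ , j′∈i , s′) →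
                case Ordinal-max oi (λ y y∈i → case up y y∈i of λ (k , k∈i , y∈k , _) → k , k∈i , y∈k) j∈i j′∈i of
                  λ (l , l∈i , j∈l , j′∈l) → case up l l∈i of λ (k , k∈i , _ , _ , P) →
                case P j j∈l j′ j′∈l x x′ xM xH xM′ xH′ s s′ z r of λ (k′ , k′∈k , t) →
                from (hS z) (cM x xM xH x′ xM′ xH′ z r , K⊆H₂ r , k′ , proj₁ oi k k∈i k′ k′∈k , t)

    opaque
      -- Instead of an ω-step iteration, the closure is caught in a countable closed subset of some
      -- M that is itself closed under `K`.
      Cl-countable : ∀ {δ i} → δ ∈ ω₂ → i ∈ ω₁ → ∃[ s ] (s ≼ ω × s ⊆ h₂ × (∀ z → Cl δ i z → z ∈ s))
      Cl-countable {δ} {i} δ∈ω₂ i∈ω₁ = case sep δ (λ ξ → ∃[ j ∈ i ] E δ ξ j) of λ (b , hb) → case sing p of λ (o , ho) →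
        case b ∪ o of λ (a , ha) →
        let ca : a ≼ ω
            ca = ∪-countable (≼-trans (≼-rel b i (E δ) (λ x q → proj₂ (to (hb x) q)) (λ _ _ _ _ _ → E-inj)) (∈ω₁⇒countable i i∈ω₁))
                             (sing-countable ho) ha
            a⊆ : a ⊆ h₂
            a⊆ z q = case to (ha z) q of λ
              { (inj₁ r) → ω₂⊆H₂ z (∈ω₂⇒⊆ω₂ δ∈ω₂ z (proj₁ (to (hb z) r)))
              ; (inj₂ r) → subst (_∈ h₂) (sym (to (ho z) r)) p∈H₂ }
        in case good (𝔸-∧ 𝔸-Closed (countable⇒Small (λ z q → H₂⊆h z (a⊆ z q)) ca)) of λ (M , g , c , a⊆M) →
        case GIS⇒≼ω₁ (Good.gis g) of λ (f , tf , jf) → case countable-closed f M tf jf c a ca a⊆ a⊆M of λ (S , cS , S⊆ , a⊆S , clS) →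
        S , cS , S⊆ , Cl-min clS (a⊆S p (from (ha p) (inj₂ (from (ho p) refl))))
          λ ξ j j∈i r → a⊆S ξ (from (ha ξ) (inj₁ (from (hb ξ) (proj₁ (proj₂ (E-dom r)) , j , j∈i , r))))

    -- At a closed point i of this relation, the closure of the i-th piece of δ has trace i on ω₁.
    Tracing : V → V → V → Set ℓ
    Tracing δ l k = l ∈ k × (∀[ z ∈ ω₁ ] (Cl δ l z → z ∈ k)) × (∃[ j ∈ k ] E δ l j)

    opaque
      def-Tracing : ∀ δ → Def₂ (Tracing δ)
      def-Tracing δ = auto

      tracing : ∀ {δ} → δ ∈ ω₂ → ω₁ ⊆ δ → ∀ l → l ∈ ω₁ → ∃[ k ∈ ω₁ ] Tracing δ l k
      tracing {δ} δ∈ω₂ ω₁⊆δ l l∈ω₁ = case Cl-countable δ∈ω₂ l∈ω₁ of λ (s , cs , _ , hs) → case sep s (_∈ ω₁) of λ (s′ , hs′) →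
        case ω₁-bounded (≼-trans (⊆⇒≼ λ z q → proj₁ (to (hs′ z) q)) cs) (λ z q → proj₂ (to (hs′ z) q)) of λ (b , b∈ω₁ , s′⊆b) →
        case E-tot δ∈ω₂ (ω₁⊆δ l l∈ω₁) of λ (j , j∈ω₁ , r) → case ω₁-max b∈ω₁ j∈ω₁ of λ (k₁ , k₁∈ω₁ , b∈k₁ , j∈k₁) →
        case ω₁-max k₁∈ω₁ l∈ω₁ of λ (k , k∈ω₁ , k₁∈k , l∈k) → let ok = ∈ω₁-Ordinal k∈ω₁ ; k₁⊆k = proj₁ ok k₁ k₁∈k in
        k , k∈ω₁ , l∈k , (λ z z∈ω₁ c → proj₁ ok b (k₁⊆k b b∈k₁) z (s′⊆b z (from (hs′ z) (hs z c , z∈ω₁)))) , j , k₁⊆k j j∈k₁ , r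

      trace : ∀ {δ i} → i ∈ ω₁ → (∃[ j ] j ∈ i) → (∀[ j ∈ i ] ∃[ k ∈ i ] Tracing δ j k) →
              (∀ z → z ∈ ω₁ → Cl δ i z ⇔ z ∈ i)
      trace {δ} {i} i∈ω₁ ne c z z∈ω₁ = let oi = ∈ω₁-Ordinal i∈ω₁ in mk⇔
        (λ q → case Cl-continuous oi ne (λ j p → case c j p of λ (k , k∈i , j∈k , _) → k , k∈i , j∈k) z q of λ (j , j∈i , q′) →
          case c j j∈i of λ (k , k∈i , _ , t , _) → proj₁ oi k k∈i z (t z z∈ω₁ q′))
        (λ z∈i → case c z z∈i of λ (k , k∈i , _ , _ , j , j∈k , r) → Cl-gen (proj₁ oi k k∈i j j∈k) r)

  -- The clauses yield the elements of a countable ordinal x, the element of x with index x′, the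
  -- index of x′ in x, and the trace of x on ω₁. The last one is for chains: a member that contains
  -- its predecessor as an element also contains the predecessor's trace.
  K₀ : V → V → V → Set ℓ
  K₀ x x′ z = z ∈ h₂ × ((x ∈ ω₁ × z ∈ x) ⊎ (E x z x′ ⊎ (E x x′ z ⊎ (z ∈ ω₁ × IsIntersection z x ω₁))))

  Closed₀ : V → Set ℓ
  Closed₀ Y = ∀[ x ∈ Y ] ∀[ x′ ∈ Y ] ∀ z → K₀ x x′ z → z ∈ Y

  CountableClass : (V → Set ℓ) → Set ℓ
  CountableClass P = ∃[ s ] (s ≼ ω × s ⊆ h₂ × (∀ z → P z → z ∈ s))

  opaque
    countable-set : ∀ {P s} → s ≼ ω → s ⊆ h₂ → (∀ z → P z → z ∈ s) → CountableClass P
    countable-set c k f = _ , c , k , f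

    countable-⊎ : ∀ {P Q} → CountableClass P → CountableClass Q → CountableClass (λ z → P z ⊎ Q z)
    countable-⊎ (s , cs , s⊆ , hs) (t , ct , t⊆ , ht) = case s ∪ t of λ (u , hu) → u , ∪-countable cs ct hu
      , (λ z q → [ s⊆ z , t⊆ z ]′ (to (hu z) q)) , λ z → [ (λ q → from (hu z) (inj₁ (hs z q))) , (λ q → from (hu z) (inj₂ (ht z q))) ]′

    countable-unique : ∀ {P} → (∀ z → P z → z ∈ h₂) → (∀ z z′ → P z → P z′ → z ≡ z′) → CountableClass P
    countable-unique {P} k u with em {∃[ z ] P z}
    ... | yes (z , Pz) = case sing z of λ (s , hs) → s , sing-countable hs
      , (λ v q → subst (_∈ h₂) (sym (to (hs v) q)) (k z Pz)) , λ v q → from (hs v) (u v z q Pz)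
    ... | no none = case ∃∅ of λ (s , hs) → s , ⊆⇒≼ (λ z q → ⊥-elim (hs z q)) , (λ z q → ⊥-elim (hs z q)) ,
      λ z q → ⊥-elim (none (z , q))

    countable-× : ∀ {A : Set ℓ} {P} → (A → CountableClass P) → CountableClass (λ z → A × P z)
    countable-× {A} f with em {A}
    ... | yes a = case f a of λ (s , cs , s⊆ , hs) → s , cs , s⊆ , λ z (_ , q) → hs z q
    ... | no n = case ∃∅ of λ (s , hs) → s , ⊆⇒≼ (λ z q → ⊥-elim (hs z q)) , (λ z q → ⊥-elim (hs z q)) , λ z (a , _) → ⊥-elim (n a)

    countable-⇒ : ∀ {P Q} → (∀ z → Q z → P z) → CountableClass P → CountableClass Q
    countable-⇒ f (s , cs , s⊆ , hs) = s , cs , s⊆ , λ z q → hs z (f z q)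

    ω₁⊆H₂ : ω₁ ⊆ h₂
    ω₁⊆H₂ z q = ω₂⊆H₂ z (ω₁⊆ω₂ z q)

    K₀-countable : ∀ x x′ → CountableClass (K₀ x x′)
    K₀-countable x x′ = countable-⇒ (λ z → proj₂) (countable-⊎
      (countable-× λ q → countable-set (∈ω₁⇒countable x q) (λ z r → ω₁⊆H₂ z (proj₁ Ordinal-ω₁ x q z r)) λ z r → r)
      (countable-⊎ (countable-unique (λ z r → case E-dom r of λ (p , q , _) → ω₂⊆H₂ z (∈ω₂⇒⊆ω₂ p z q)) λ z z′ → E-inj)
      (countable-⊎ (countable-unique (λ z r → ω₁⊆H₂ z (proj₂ (proj₂ (E-dom r)))) λ z z′ → E-fun)
        (countable-unique (λ z (r , _) → ω₁⊆H₂ z r) λ z z′ (_ , r) (_ , r′) → IsSetOf-unique r r′))))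

    Closed₀-∈ω₁ : ∀ {Y i j} → Closed₀ Y → i ∈ Y → i ∈ ω₁ → j ∈ i → j ∈ Y
    Closed₀-∈ω₁ c p q r = c _ p _ p _ (ω₁⊆H₂ _ (proj₁ Ordinal-ω₁ _ q _ r) , inj₁ (q , r))

    Closed₀-trace : ∀ {Y} → Closed₀ Y → Y ≼ ω → ∃[ ρ ∈ ω₁ ] IsIntersection ρ Y ω₁
    Closed₀-trace {Y} c cY = case sep Y (_∈ ω₁) of λ (ρ , hρ) → ρ , countable⇒∈ω₁
      (mkOrdinal (λ x p y q → case to (hρ x) p of λ (r , s) → from (hρ y) (Closed₀-∈ω₁ c r s q , proj₁ Ordinal-ω₁ x s y q))
        λ x p → ∈ω₁-Ordinal (proj₂ (to (hρ x) p)))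
      (≼-trans (⊆⇒≼ λ x p → proj₁ (to (hρ x) p)) cY) , hρ

    -- A closed set Y with trace i meets each of its elements β < ω₂ in the i-th piece of β.
    Closed₀-piece : ∀ {Y i β} → Closed₀ Y → IsIntersection i Y ω₁ → β ∈ ω₂ → β ∈ Y → ∀ ξ → ξ ∈ β →
                    (ξ ∈ Y ⇔ (∃[ j ∈ i ] E β ξ j))
    Closed₀-piece {Y} {i} {β} c hi β∈ω₂ β∈Y ξ ξ∈β = mk⇔
      (λ ξ∈Y → case E-tot β∈ω₂ ξ∈β of λ (j , j∈ω₁ , r) →
        j , from (hi j) (c β β∈Y ξ ξ∈Y j (ω₁⊆H₂ j j∈ω₁ , inj₂ (inj₂ (inj₁ r))) , j∈ω₁) , r)
      λ (j , j∈i , r) → c β β∈Y j (proj₁ (to (hi j) j∈i)) ξ (ω₂⊆H₂ ξ (∈ω₂⇒⊆ω₂ β∈ω₂ ξ ξ∈β) , inj₂ (inj₁ r))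

  -- Continuous chains from SRP

  record Chain (P : V) : Set ℓ where
    field
      ν    : V
      tot  : ∀[ ξ ∈ ω₁ ] ∃[ Y ] ν [ ξ ]≈ Y
      dom  : ∀ {ξ Y} → ν [ ξ ]≈ Y → ξ ∈ ω₁
      fun  : ∀ {ξ Y Y′} → ν [ ξ ]≈ Y → ν [ ξ ]≈ Y′ → Y ≡ Y′
      inP  : ∀ {ξ Y} → ν [ ξ ]≈ Y → Y ∈ P
      mono : ∀ {ξ ζ Y Y′} → ν [ ξ ]≈ Y → ν [ ζ ]≈ Y′ → ξ ∈ ζ → Y ⊆ Y′
      cont : ∀ {ξ Y} → ν [ ξ ]≈ Y → (∃[ j ] j ∈ ξ) → (∀[ j ∈ ξ ] ∃[ k ∈ ξ ] j ∈ k) →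
             ∀ x → x ∈ Y → ∃[ ζ ∈ ξ ] ∃[ Y′ ] (ν [ ζ ]≈ Y′ × x ∈ Y′)
      big  : ∀ {ξ Y} → ν [ ξ ]≈ Y → ξ ⊆ Y

  private
    module Build {N} (cec : ContinuousElementaryChain h₂ N) where
      open ContinuousElementaryChain cec

      opaque
        suc-or-limit : ∀ {ζ} → Ordinal ζ → (∀[ j ∈ ζ ] ∃[ k ∈ ζ ] j ∈ k) ⊎ (∃[ η ∈ ζ ] IsSuc ζ η)
        suc-or-limit {ζ} oζ with em {∀[ j ∈ ζ ] ∃[ k ∈ ζ ] j ∈ k}
        ... | yes l = inj₁ l
        ... | no nl = inj₂ (byContra λ none → nl λ j j∈ζ → byContra λ no′ → none (j , j∈ζ , λ x → mk⇔
          (λ p → case ≤-or-> (Ordinal-∈ oζ p) (Ordinal-∈ oζ j∈ζ) of λ { (inj₁ q) → q ; (inj₂ q) → ⊥-elim (no′ (x , p , q)) })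
          λ { (inj₁ p) → proj₁ oζ j j∈ζ x p ; (inj₂ refl) → j∈ζ }))

        increasing : ∀ ζ → ζ ∈ ω₁ → ∀ ξ → ξ ∈ ζ → ∀ Y Y′ → N [ ξ ]≈ Y → N [ ζ ]≈ Y′ → Y ⊆ Y′
        increasing = ∈-ind ω₁ (λ ζ → ∀ ξ → ξ ∈ ζ → ∀ Y Y′ → N [ ξ ]≈ Y → N [ ζ ]≈ Y′ → Y ⊆ Y′) λ ζ ζ∈ω₁ ih ξ ξ∈ζ Y Y′ r r′ →
          let oζ = ∈ω₁-Ordinal ζ∈ω₁ in case suc-or-limit oζ of λ
          { (inj₁ lim) → λ x x∈Y → from (limit ζ Y′ (oζ , (ξ , ξ∈ζ) , lim) (pa r′) x) (ξ , ξ∈ζ , Y , pa r , x∈Y)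
          ; (inj₂ (η , η∈ζ , hη)) → case to (hη ξ) ξ∈ζ of λ
            { (inj₂ refl) → proj₂ (successor ξ ζ Y Y′ hη (pa r) (pa r′))
            ; (inj₁ ξ∈η) → case proj₁ (proj₂ function) η (proj₁ Ordinal-ω₁ ζ ζ∈ω₁ η η∈ζ) of λ (Yη , rη) → λ x x∈Y →
                proj₂ (successor η ζ Yη Y′ hη rη (pa r′)) x
                  (ih η η∈ζ (proj₁ Ordinal-ω₁ ζ ζ∈ω₁ η η∈ζ) ξ ξ∈η Y Yη r (ap rη) x x∈Y) } }

        -- The j-th set is an element of the next one, which thus contains its trace on ω₁. That
        -- trace is an ordinal, at least j by induction, so j belongs to the next set.
        grows : (∀ {ξ Y} → N [ ξ ]≈ Y → Closed₀ Y) → ∀ ξ → ξ ∈ ω₁ → ∀ Y → N [ ξ ]≈ Y → ξ ⊆ Y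
        grows c = ∈-ind ω₁ (λ ξ → ∀ Y → N [ ξ ]≈ Y → ξ ⊆ Y) λ ξ ξ∈ω₁ ih Y r j j∈ξ →
          case ∃suc j of λ (j⁺ , hj) → let oξ = ∈ω₁-Ordinal ξ∈ω₁ ; j∈ω₁ = proj₁ Ordinal-ω₁ ξ ξ∈ω₁ j j∈ξ in
          let j⁺≤ξ : j⁺ ≤ ξ
              j⁺≤ξ = ⊆⇒≤ (Ordinal-suc (Ordinal-∈ oξ j∈ξ) hj) oξ λ x p → case to (hj x) p of λ
                { (inj₁ q) → proj₁ oξ j j∈ξ x q ; (inj₂ refl) → j∈ξ }
              j⁺∈ω₁ : j⁺ ∈ ω₁
              j⁺∈ω₁ = case j⁺≤ξ of λ { (inj₁ p) → proj₁ Ordinal-ω₁ ξ ξ∈ω₁ j⁺ p ; (inj₂ refl) → ξ∈ω₁ }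
          in case proj₁ (proj₂ function) j j∈ω₁ of λ (Yj , rj) → case proj₁ (proj₂ function) j⁺ j⁺∈ω₁ of λ (Y⁺ , r⁺) →
          case Closed₀-trace (c (ap rj)) (Countable⇒≼ (proj₁ (elementary j Yj rj))) of λ (ρ , ρ∈ω₁ , hρ) →
          let ρ∈Y⁺ : ρ ∈ Y⁺
              ρ∈Y⁺ = let q = proj₁ (successor j j⁺ Yj Y⁺ hj rj r⁺) in
                c (ap r⁺) Yj q Yj q ρ (ω₁⊆H₂ ρ ρ∈ω₁ , inj₂ (inj₂ (inj₂ (ρ∈ω₁ , hρ))))
              j∈Y⁺ : j ∈ Y⁺
              j∈Y⁺ = case ⊆⇒≤ (∈ω₁-Ordinal j∈ω₁) (∈ω₁-Ordinal ρ∈ω₁)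
                (λ x p → from (hρ x) (ih j j∈ξ j∈ω₁ Yj (ap rj) x p , proj₁ Ordinal-ω₁ j j∈ω₁ x p)) of λ
                { (inj₁ p) → Closed₀-∈ω₁ (c (ap r⁺)) ρ∈Y⁺ ρ∈ω₁ p ; (inj₂ refl) → ρ∈Y⁺ }
          in case j⁺≤ξ of λ
          { (inj₁ p) → increasing ξ ξ∈ω₁ j⁺ p Y⁺ Y (ap r⁺) r j j∈Y⁺
          ; (inj₂ refl) → subst (j ∈_) (proj₂ (proj₂ function) j⁺ Y⁺ Y r⁺ (pa r)) j∈Y⁺ }

  opaque
    chain : SRP[ω₂] → ∀ {P} → ProjectiveStationary h₂ P → (∀ Y → Y ∈ P → Closed₀ Y) → Chain P
    chain srp {P} ps c = case srp h₂ isH₂ P ps of λ (N , cec , inP) → build cec inP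
      where
      build : ∀ {N} → ContinuousElementaryChain h₂ N → (∀ ξ M → ⟨ ξ , M ⟩∈ N → M ∈ P) → Chain P
      build {N} cec inP = record
        { ν = N ; tot = λ ξ p → case proj₁ (proj₂ function) ξ p of λ (Y , r) → Y , ap r
        ; dom = d ; fun = λ r r′ → proj₂ (proj₂ function) _ _ _ (pa r) (pa r′)
        ; inP = λ r → inP _ _ (pa r)
        ; mono = λ r r′ p → increasing _ (d r′) _ p _ _ r r′
        ; cont = λ r ne lim x x∈Y → case to (limit _ _ (∈ω₁-Ordinal (d r) , ne , lim) (pa r) x) x∈Y of
            λ (ζ , p , Y′ , r′ , q) → ζ , p , Y′ , ap r′ , q
        ; big = λ r → grows (λ r → c _ (inP _ _ (pa r))) _ (d r) _ r }
        where
        open ContinuousElementaryChain cec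
        open Build cec
        d : ∀ {ξ Y} → N [ ξ ]≈ Y → ξ ∈ ω₁
        d = FunctionOn-dom function

  -- Operations whose closed sets belong to a given club

  module ClubClosure (C : V) (club : Club h₂ C) where
    open Club club

    Extends : V → V → Set ℓ
    Extends q y′ = ∃[ y ] ∃[ x ] (Pr q y x × (∀ z → z ∈ y → z ∈ y′) × x ∈ y′)

    opaque
      def-Extends : Def₂ Extends
      def-Extends = auto

      C-countable : ∀ {y} → y ∈ C → y ≼ ω
      C-countable p = Countable⇒≼ (proj₂ (subset _ p))

      C⊆H₂ : C ⊆ h₂
      C⊆H₂ y p = countable⇒∈H₂ (proj₁ (subset y p)) (C-countable p)

      ∃y₀ : ∃[ y ] y ∈ C
      ∃y₀ = case ∃∅ of λ (e , he) → case cofinal e ((λ z p → ⊥-elim (he z p)) , ≼⇒Countable (⊆⇒≼ λ z p → ⊥-elim (he z p))) of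
        λ (y , p , _) → y , p

      ∃c : ∃[ w ] ∃[ c ] (IsSetOf w (λ q → ∃[ y ∈ C ] ∃[ x ∈ h₂ ] Pr q y x) × Fn w C c × (∀ q y′ → c [ q ]≈ y′ → Extends q y′))
      ∃c = case prod C h₂ of λ (w , hw) → case choose w C Extends {{def-Extends}} (λ q q∈w → case to (hw q) q∈w of
          λ (y , y∈C , x , x∈ , r) → case sing x of λ (o , ho) → case y ∪ o of λ (u , hu) →
          case cofinal u ((λ z p → case to (hu z) p of λ { (inj₁ q) → proj₁ (subset y y∈C) z q
                                                        ; (inj₂ q) → subst (_∈ h₂) (sym (to (ho z) q)) x∈ })
            , ≼⇒Countable (∪-countable (C-countable y∈C) (sing-countable ho) hu)) of λ (y′ , y′∈C , u⊆y′) →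
          y′ , y′∈C , y , x , r , (λ z p → u⊆y′ z (from (hu z) (inj₁ p))) , u⊆y′ x (from (hu x) (inj₂ (from (ho x) refl))))
        of λ (c , fc , hc) → w , c , hw , fc , hc

    y₀ c : V
    y₀ = proj₁ ∃y₀
    c = proj₁ (proj₂ ∃c)

    opaque
      Next : V → V → V → Set ℓ
      Next x x′ z = ∃[ q ] (Pr q x x′ × c [ q ]≈ z)

      Next-tot : ∀ {y x} → y ∈ C → x ∈ h₂ → ∃[ y′ ] (Next y x y′ × y′ ∈ C × y ⊆ y′ × x ∈ y′)
      Next-tot {y} {x} p q = case proj₂ (proj₂ ∃c) of λ (hw , fc , hc) → case pair y x of λ (o , ho) →
        case Fn.tot fc o (from (hw o) (y , p , x , q , pr ho)) of λ (y′ , r) → case hc o y′ r of λ { (_ , _ , s , t , u) →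
        case IsPair-injective ho (rp s) of λ { (refl , refl) → y′ , (o , pr ho , r) , Fn.cod fc r , t , u } }

      Next-∈ : ∀ {x x′ z} → Next x x′ z → z ∈ C
      Next-∈ (_ , _ , r) = case proj₂ (proj₂ ∃c) of λ (_ , fc , _) → Fn.cod fc r

      Next-fun : ∀ {x x′ z z′} → Next x x′ z → Next x x′ z′ → z ≡ z′
      Next-fun (o , s , r) (o′ , s′ , r′) = case IsPair-unique (rp s) (rp s′) of λ { refl →
        case proj₂ (proj₂ ∃c) of λ (_ , fc , _) → Fn.fun fc r r′ }

      def-Next : Def₃ Next
      def-Next = auto {X = Def₃ (λ x x′ z → ∃[ q ] (Pr q x x′ × c [ q ]≈ z))}

    private
      instance
        i-Next : Atom₃ def-Next
        i-Next = atom₃ def-Next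

    -- Members of `C` are countable subsets of H(ω₂), hence elements of it. So one operation on
    -- H(ω₂) can both enlarge members of `C` and list their elements.
    K : V → V → V → Set ℓ
    K x x′ z = K₀ x x′ z ⊎ ((x ∈ C × z ∈ x) ⊎ (z ≡ y₀ ⊎ Next x x′ z))

    opaque
      def-K : Def₃ K
      def-K = auto

      K⊆H₂ : ∀ {x x′ z} → K x x′ z → z ∈ h₂
      K⊆H₂ (inj₁ (p , _)) = p
      K⊆H₂ (inj₂ (inj₁ (p , q))) = proj₁ (subset _ p) _ q
      K⊆H₂ (inj₂ (inj₂ (inj₁ refl))) = C⊆H₂ _ (proj₂ ∃y₀)
      K⊆H₂ (inj₂ (inj₂ (inj₂ r))) = C⊆H₂ _ (Next-∈ r)

      K-countable : ∀ {x x′} → x ∈ h₂ → x′ ∈ h₂ → ∃[ s ] (s ≼ ω × s ⊆ h₂ × (∀ z → K x x′ z → z ∈ s))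
      K-countable {x} {x′} _ _ = countable-⊎ (K₀-countable x x′) (countable-⊎
        (countable-× λ q → countable-set (C-countable q) (proj₁ (subset x q)) λ z r → r)
        (countable-⊎ (countable-unique (λ { z refl → C⊆H₂ z (proj₂ ∃y₀) }) λ { z z′ refl refl → refl })
          (countable-unique (λ z r → C⊆H₂ z (Next-∈ r)) λ z z′ → Next-fun)))

      K-∈ω₁ : ∀ {x x′ z} → x ∈ ω₁ → z ∈ x → K x x′ z
      K-∈ω₁ p q = inj₁ (ω₁⊆H₂ _ (proj₁ Ordinal-ω₁ _ p _ q) , inj₁ (p , q))

    module At (p : V) (p∈H₂ : p ∈ h₂) = Hull K def-K K⊆H₂ K-countable K-∈ω₁ p p∈H₂

    opaque
      closed⇒Closed₀ : ∀ {Y} → (∀[ x ∈ Y ] ∀[ x′ ∈ Y ] ∀ z → K x x′ z → z ∈ Y) → Closed₀ Y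
      closed⇒Closed₀ k x p x′ p′ z r = k x p x′ p′ z (inj₁ r)

      -- Along an enumeration of `Y`, `Next` builds an increasing ω-chain of members of `C` that are
      -- elements of `Y`. By closure they are also subsets of `Y`, and their union is `Y`.
      closed⇒∈C : ∀ {Y} → (∀[ x ∈ Y ] ∀[ x′ ∈ Y ] ∀ z → K x x′ z → z ∈ Y) → Y ⊆ h₂ → Y ≼ ω → (∃[ x ] x ∈ Y) → Y ∈ C
      closed⇒∈C {Y} k Y⊆ (φ , tφ , jφ) (x₀ , x₀∈Y) = case sep C (_∈ Y) of λ (X , hX) →
        case dc X (λ m y y′ → (∀ z → z ∈ y → z ∈ y′) × (∀[ x ∈ Y ] (φ [ x ]≈ m → x ∈ y′))) y₀
          (from (hX y₀) (proj₂ ∃y₀ , k x₀ x₀∈Y x₀ x₀∈Y y₀ (inj₂ (inj₂ (inj₁ refl)))))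
          (λ m _ y y∈X → case to (hX y) y∈X of λ (y∈C , y∈Y) → case em {∃[ x ∈ Y ] φ [ x ]≈ m} of λ
            { (no none) → y , y∈X , (λ _ q → q) , λ x q r → ⊥-elim (none (x , q , r))
            ; (yes (x , x∈Y , r)) → case Next-tot y∈C (Y⊆ x x∈Y) of λ (y′ , nx , y′∈C , y⊆y′ , x∈y′) →
                y′ , from (hX y′) (y′∈C , k y y∈Y x x∈Y y′ (inj₂ (inj₂ (inj₂ nx)))) , y⊆y′ ,
                λ x₁ _ r₁ → subst (_∈ y′) (jφ x x₁ m r r₁) x∈y′ }) of λ (s , fs , s₀ , s⁺) →
        finish X hX s fs s⁺
        where
        finish : ∀ X → (∀ y → y ∈ X ⇔ (y ∈ C × y ∈ Y)) → ∀ s → Fn ω X s →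
          (∀ m m⁺ y y′ → IsSuc m⁺ m → s [ m ]≈ y → s [ m⁺ ]≈ y′ → (∀ z → z ∈ y → z ∈ y′) × (∀[ x ∈ Y ] (φ [ x ]≈ m → x ∈ y′))) → Y ∈ C
        finish X hX s fs s⁺ = case sep C (λ y → ∃[ m ] s [ m ]≈ y) of λ (D , hD) → closed D (λ y q → proj₁ (to (hD y) q))
          (≼⇒Countable (≼-rel D ω (λ y m → s [ m ]≈ y) (λ y q → case to (hD y) q of λ (_ , m , r) → m , Fn.dom fs r , r)
            λ y y′ m _ _ → Fn.fun fs))
          (case ∃∅ of λ (e , he) → case Fn.tot fs e (zero-∈ω he) of λ (y , r) →
            y , from (hD y) (proj₁ (to (hX y) (Fn.cod fs r)) , e , r))
          (λ y q y′ q′ → case to (hD y) q of λ { (_ , m , r) → case to (hD y′) q′ of λ { (_ , m′ , r′) →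
            case ∈-tri (Ordinal-∈ Ordinal-ω (Fn.dom fs r)) (Ordinal-∈ Ordinal-ω (Fn.dom fs r′)) of λ
            { (inj₁ m∈m′) → inj₁ (up m′ (Fn.dom fs r′) m m∈m′ y y′ r r′)
            ; (inj₂ (inj₁ refl)) → inj₁ (λ z z∈y → subst (z ∈_) (Fn.fun fs r r′) z∈y)
            ; (inj₂ (inj₂ m′∈m)) → inj₂ (up m (Fn.dom fs r) m′ m′∈m y′ y r′ r) } } })
          Y λ x → mk⇔
            (λ x∈Y → case tφ x x∈Y of λ (m , m∈ω , r) → case ∃suc m of λ (m⁺ , hm) → case Fn.tot fs m m∈ω of λ (y , t) →
              case Fn.tot fs m⁺ (suc-∈ω m∈ω hm) of λ (y′ , t′) →
              y′ , from (hD y′) (proj₁ (to (hX y′) (Fn.cod fs t′)) , m⁺ , t′) , proj₂ (s⁺ m m⁺ y y′ hm t t′) x x∈Y r)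
            (λ (y , y∈D , x∈y) → case to (hD y) y∈D of λ (y∈C , m , r) →
              k y (proj₂ (to (hX y) (Fn.cod fs r))) y (proj₂ (to (hX y) (Fn.cod fs r))) x (inj₂ (inj₁ (y∈C , x∈y))))
          where
          up : ∀ m → m ∈ ω → ∀ l → l ∈ m → ∀ y y′ → s [ l ]≈ y → s [ m ]≈ y′ → y ⊆ y′
          up = ω-ind (λ m → ∀ l → l ∈ m → ∀ y y′ → s [ l ]≈ y → s [ m ]≈ y′ → y ⊆ y′) (λ e he l q → ⊥-elim (he l q))
            λ m m∈ω ih m⁺ hm l l∈m⁺ y y′ r r′ → case Fn.tot fs m m∈ω of λ (v , t) → case to (hm l) l∈m⁺ of λ
            { (inj₁ l∈m) z z∈y → proj₁ (s⁺ m m⁺ v y′ hm t r′) z (ih l l∈m y v r t z z∈y)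
            ; (inj₂ refl) → proj₁ (s⁺ m m⁺ y y′ hm r r′) }

  opaque
    -- The set is the closure of `p` and the i-th piece of ω₁, for a closed point i of `Tracing`
    -- that satisfies `T`.
    traced : ∀ {T} → Meets ω₁ T → ∀ {p} → p ∈ h₂ → ∀ C → Club h₂ C →
      ∃[ Y ∈ C ] (Y ⊆ h₂ × Y ≼ ω × Closed₀ Y × p ∈ Y × (∃[ i ∈ ω₁ ] (T i × IsIntersection i Y ω₁)))
    traced {T} m {p} p∈H₂ C club =
      case Meets-rel {ω₁} {T} m (Tracing ω₁) {{def-Tracing ω₁}} (tracing ω₁∈ω₂ (λ _ q → q)) of λ (i , i∈ω₁ , Ti , ne , cl) →
      case Cl-set ω₁ i of λ (Y , hY , cY , Y⊆) → case Cl-countable ω₁∈ω₂ i∈ω₁ of λ (s , cs , _ , hs) →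
      let cnt : Y ≼ ω
          cnt = ≼-trans (⊆⇒≼ λ z q → hs z (to (hY z) q)) cs
          p∈Y : p ∈ Y
          p∈Y = from (hY p) Cl-p
      in Y , closed⇒∈C cY Y⊆ cnt (p , p∈Y) , Y⊆ , cnt , closed⇒Closed₀ cY , p∈Y , i , i∈ω₁ , Ti , λ z → mk⇔
        (λ z∈i → let z∈ω₁ = proj₁ Ordinal-ω₁ i i∈ω₁ z z∈i in from (hY z) (from (trace i∈ω₁ ne cl z z∈ω₁) z∈i) , z∈ω₁)
        (λ (z∈Y , z∈ω₁) → to (trace i∈ω₁ ne cl z z∈ω₁) (to (hY z) z∈Y))
      where
      open ClubClosure C club
      open At p p∈H₂

  -- s is the set of the elements of α with index below i.
  IsPiece : V → V → V → Set ℓ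
  IsPiece s α i = IsSetOf s (λ ξ → ∃[ j ∈ i ] E α ξ j)

  -- Reflection of a family of sets of ordinals along a chain

  Avoids : V → V → Set ℓ
  Avoids F Y = Y ≼ ω × (Closed₀ Y × (∀ z → z ∈ F → ¬ IsIntersection z Y ω₂))

  module Reflect {P F : V} (ch : Chain P) (avoid : ∀ Y → Y ∈ P → Avoids F Y) where
    open Chain ch

    InChain : V → V → Set ℓ
    InChain ξ x = ∃[ Y ] (ν [ ξ ]≈ Y × x ∈ Y)

    opaque
      def-InChain : Def₂ InChain
      def-InChain = auto

      stage : ∀ {ξ} → ξ ∈ ω₁ → ∃[ Y ] (ν [ ξ ]≈ Y × Y ≼ ω × Closed₀ Y)
      stage p = case tot _ p of λ (Y , r) → case avoid Y (inP r) of λ (c , c′ , _) → Y , r , c , c′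

      in-⊆ : ∀ {ξ ζ x} → ξ ∈ ζ → ζ ∈ ω₁ → InChain ξ x → InChain ζ x
      in-⊆ p q (Y , r , x∈Y) = case tot _ q of λ (Y′ , r′) → Y′ , r′ , mono r r′ p _ x∈Y

      in-dom : ∀ {ξ x} → InChain ξ x → ξ ∈ ω₁
      in-dom (_ , r , _) = dom r

      in-join : ∀ {ξ ζ x y} → InChain ξ x → InChain ζ y → ∃[ η ] (InChain η x × InChain η y)
      in-join a b = case ω₁-max (in-dom a) (in-dom b) of λ (η , p , q , q′) → η , in-⊆ q p a , in-⊆ q′ p b

      in-ω₁ : ∀ {j} → j ∈ ω₁ → ∃[ ξ ] InChain ξ j
      in-ω₁ p = case ω₁-max p p of λ (ξ , q , r , _) → case tot ξ q of λ (Y , s) → ξ , Y , s , big s _ r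

      chain-Small : (∀ Y → Y ∈ P → Y ⊆ h₂) → 𝔸 (λ M → ∀[ ξ ∈ ω₁ ] ∀ x → InChain ξ x → x ∈ M)
      chain-Small k = Small-family ω₁-Small InChain {{def-InChain}} λ ξ p → case stage p of λ (Y , r , c , _) →
        𝔸-map (λ { M _ s x (Y′ , r′ , q) → case fun r r′ of λ { refl → s x q } })
          (countable⇒Small (λ x q → H₂⊆h x (k Y (inP r) x q)) c)

      -- The union of the chain includes ω₁ and is closed under passing from an index to its
      -- element, so its part below ω₂ is an initial segment. Some M includes the whole chain, and M
      -- ∩ ω₂ is a bound.
      ∃union : (∀ Y → Y ∈ P → Y ⊆ h₂) → ∃[ α ∈ ω₂ ] (ω₁ ⊆ α × (∀ x → x ∈ α ⇔ (x ∈ ω₂ × ∃[ ξ ] InChain ξ x)))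
      ∃union k = case sep ω₂ (λ x → ∃[ ξ ] InChain ξ x) of λ (α , hα) → case good (chain-Small k) of λ (M , g , s) →
        let open Good g
            oα : Ordinal α
            oα = mkOrdinal
              (λ x p y y∈x → case to (hα x) p of λ (x∈ω₂ , ξ , a) → case E-tot x∈ω₂ y∈x of λ (j , j∈ω₁ , r) →
                case in-ω₁ j∈ω₁ of λ (ζ , b) → case in-join a b of λ { (η , (Y , t , x∈Y) , (Y′ , t′ , j∈Y′)) →
                case fun t t′ of λ { refl → case avoid Y (inP t) of λ (_ , c , _) → let y∈ω₂ = ∈ω₂⇒⊆ω₂ x∈ω₂ y y∈x in
                  from (hα y) (y∈ω₂ , η , Y , t , c x x∈Y j j∈Y′ y (ω₂⊆H₂ y y∈ω₂ , inj₂ (inj₁ r))) } })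
              (λ x p → ∈ω₂-Ordinal (proj₁ (to (hα x) p)))
            α⊆κ : α ⊆ κ
            α⊆κ x p = case to (hα x) p of λ (x∈ω₂ , ξ , a) → from (hκ x) (s ξ (in-dom a) x a , x∈ω₂)
        in α , (case ⊆⇒≤ oα (∈ω₂-Ordinal κ∈) α⊆κ of λ { (inj₁ p) → ∈ω₂⇒⊆ω₂ κ∈ α p ; (inj₂ refl) → κ∈ })
          , (λ x p → from (hα x) (ω₁⊆ω₂ x p , in-ω₁ p)) , hα

    -- It interleaves two filtrations of α. At a closed point i they agree: the i-th set of the
    -- chain meets ω₂ in the i-th piece of α.
    Follow : V → V → V → Set ℓ
    Follow α j k = j ∈ k × (∀[ ξ ∈ ω₂ ] (InChain j ξ → ∃[ j′ ∈ k ] E α ξ j′)) × (∀ ξ → E α ξ j → ∃[ ζ ∈ k ] InChain ζ ξ)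

    opaque
      def-Follow : ∀ α → Def₂ (Follow α)
      def-Follow α = auto

      follow : ∀ {α} → α ∈ ω₂ → (∀ x → x ∈ α ⇔ (x ∈ ω₂ × ∃[ ξ ] InChain ξ x)) → ∀ j → j ∈ ω₁ → ∃[ k ∈ ω₁ ] Follow α j k
      follow {α} α∈ω₂ hα j j∈ω₁ = case stage j∈ω₁ of λ (Y , r , c , _) → case sep Y (_∈ ω₂) of λ (Y′ , hY′) →
        case ω₁-bound Y′ (≼-trans (⊆⇒≼ λ x q → proj₁ (to (hY′ x) q)) c) (E α)
          (λ ξ q → case to (hY′ ξ) q of λ (ξ∈Y , ξ∈ω₂) → E-tot α∈ω₂ (from (hα ξ) (ξ∈ω₂ , j , Y , r , ξ∈Y))) of λ (b , b∈ω₁ , hb) →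
        case back of λ (a , a∈ω₁ , ha) → case ω₁-max b∈ω₁ a∈ω₁ of λ (k₁ , k₁∈ω₁ , b∈k₁ , a∈k₁) →
        case ω₁-max k₁∈ω₁ j∈ω₁ of λ (k , k∈ω₁ , k₁∈k , j∈k) → let ok = ∈ω₁-Ordinal k∈ω₁ ; k₁⊆k = proj₁ ok k₁ k₁∈k in
        k , k∈ω₁ , j∈k
        , (λ { ξ ξ∈ω₂ (Y₁ , r₁ , q) → case fun r r₁ of λ { refl → case hb ξ (from (hY′ ξ) (q , ξ∈ω₂)) of λ (j′ , p , s) →
            j′ , proj₁ ok b (k₁⊆k b b∈k₁) j′ p , s } })
        , λ ξ s → case ha ξ s of λ (ζ , p , q) → ζ , proj₁ ok a (k₁⊆k a a∈k₁) ζ p , q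
        where
        back : ∃[ a ∈ ω₁ ] (∀ ξ → E α ξ j → ∃[ ζ ∈ a ] InChain ζ ξ)
        back with em {∃[ ξ ] E α ξ j}
        ... | no none = ω , ω∈ω₁ , λ ξ s → ⊥-elim (none (ξ , s))
        ... | yes (ξ , s) = case to (hα ξ) (proj₁ (proj₂ (E-dom s))) of λ (_ , ζ , q) → case ω₁-max (in-dom q) (in-dom q) of
          λ (a , a∈ω₁ , ζ∈a , _) → a , a∈ω₁ , λ ξ′ s′ → case E-inj s s′ of λ { refl → ζ , ζ∈a , q }

      contradiction : (∀ Y → Y ∈ P → Y ⊆ h₂) →
        (∀ α → α ∈ ω₂ → ω₁ ⊆ α → Meets ω₁ (λ i → ∃[ s ∈ F ] IsPiece s α i)) → ⊥
      contradiction k meets = case ∃union k of λ (α , α∈ω₂ , ω₁⊆α , hα) →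
        case Meets-rel (meets α α∈ω₂ ω₁⊆α) (Follow α) {{def-Follow α}} (follow α∈ω₂ hα) of
          λ (i , i∈ω₁ , (s , s∈F , hs) , ne , cl) → case stage i∈ω₁ of λ (Y , r , _) → let oi = ∈ω₁-Ordinal i∈ω₁ in
        proj₂ (proj₂ (avoid Y (inP r))) s s∈F λ ξ → mk⇔
          (λ p → case to (hs ξ) p of λ (j , j∈i , t) → case cl j j∈i of λ (k , k∈i , _ , _ , f) → case f ξ t of λ (ζ , ζ∈k , q) →
            case in-⊆ (proj₁ oi k k∈i ζ ζ∈k) i∈ω₁ q of λ { (Y′ , r′ , q′) →
              subst (ξ ∈_) (fun r′ r) q′ , ∈ω₂⇒⊆ω₂ α∈ω₂ ξ (proj₁ (proj₂ (E-dom t))) })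
          λ (ξ∈Y , ξ∈ω₂) → case cont r ne (λ j p → case cl j p of λ (k , k∈i , j∈k , _) → k , k∈i , j∈k) ξ ξ∈Y of
            λ (ζ , ζ∈i , Y′ , r′ , q) → case cl ζ ζ∈i of λ (k , k∈i , _ , f , _) → case f ξ ξ∈ω₂ (Y′ , r′ , q) of
            λ (j , j∈k , t) → from (hs ξ) (j , proj₁ oi k k∈i j j∈k , t)

  -- Every club C restricted to some stationary T consists of sets whose intersection with ω₂ is in F.
  Captures : V → V → V → Set ℓ
  Captures F T C = ∀ Y → Y ∈ C → Y ⊆ h₂ → Y ≼ ω → Closed₀ Y → ∀ i → i ∈ T → IsIntersection i Y ω₁ →
                   ∃[ z ∈ F ] IsIntersection z Y ω₂

  opaque
    -- Otherwise the sets avoiding `F` would be projective stationary, and SRP would give a chain of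
    -- them, contradicting `Reflect.contradiction`.
    captured : SRP[ω₂] → ∀ F → (∀ α → α ∈ ω₂ → ω₁ ⊆ α → Meets ω₁ (λ i → ∃[ s ∈ F ] IsPiece s α i)) →
               ∃[ T ] ∃[ C ] (Stationary₁ T × Club h₂ C × Captures F T C)
    captured srp F meets = case powerSet h₂ of λ (q , hq) → case sep q (Avoids F) of λ (P , hP) →
      byContra λ none → Reflect.contradiction
        (chain srp
          ((λ Y p → case to (hP Y) p of λ (a , c , _) → to (hq Y) a , ≼⇒Countable c)
          , λ T st C club → byContra λ no′ → none (T , C , st , club , λ Y Y∈C Y⊆ cY clY i i∈T hi → byContra λ no″ →
              no′ (Y , Y∈C , from (hP Y) (from (hq Y) Y⊆ , cY , clY , λ z z∈F hz → no″ (z , z∈F , hz)) , i , i∈T , hi)))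
          (λ Y p → proj₁ (proj₂ (proj₂ (to (hP Y) p)))))
        (λ Y p → proj₂ (to (hP Y) p)) (λ Y p → to (hq Y) (proj₁ (to (hP Y) p))) meets

    -- Internal stationarity: M ∩ ω₂ has uncountable cofinality.
    cover : 𝔸 (λ M → ∀ x → x ≼ ω → x ⊆ M → x ⊆ ω₂ → ∃[ k ∈ M ] (k ∈ ω₂ × x ⊆ k))
    cover = 𝔸-map (λ M _ (g , c) x cx x⊆M x⊆ω₂ → case powerSet M of λ (q , hq) → case sep q (λ Y → Y ≼ ω × x ⊆ Y) of λ (D , hD) →
        -- The countable supersets of `x` form a club in the countable subsets of M, so one of them
        -- is an element of M; closure of M then yields a bound for it in M.
        case proj₂ (proj₂ (proj₂ (proj₂ g))) D (record
          { subset = λ Y p → case to (hD Y) p of λ (a , b , _) → to (hq Y) a , ≼⇒Countable b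
          ; cofinal = λ y (y⊆M , cy) → case y ∪ x of λ (u , hu) → u ,
              from (hD u) (from (hq u) (λ z p → [ y⊆M z , x⊆M z ]′ (to (hu z) p)) , ∪-countable (Countable⇒≼ cy) cx hu ,
                λ z p → from (hu z) (inj₂ p)) , λ z p → from (hu z) (inj₁ p)
          ; closed = λ B B⊆D cB (b , b∈B) _ u hu → from (hD u)
              ( from (hq u) (λ z p → case to (hu z) p of λ (Y , Y∈B , z∈Y) → to (hq Y) (proj₁ (to (hD Y) (B⊆D Y Y∈B))) z z∈Y)
              , ⋃-countable (Countable⇒≼ cB) (λ Y Y∈B → proj₁ (proj₂ (to (hD Y) (B⊆D Y Y∈B)))) hu
              , λ z p → from (hu z) (b , b∈B , proj₂ (proj₂ (to (hD b) (B⊆D b b∈B))) z p)) }) of λ (Y , Y∈D , Y∈M , _) →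
        case c Y Y∈M (bnd Y (proj₁ (proj₂ (to (hD Y) Y∈D)))) of
          λ (k , k∈M , _ , k∈ω₂ , f) → k , k∈M , k∈ω₂ , λ z p → f z (proj₂ (proj₂ (to (hD Y) Y∈D)) z p) (x⊆ω₂ z p))
      (𝔸-∧ 𝔸-GIS (𝔸-clos (λ Y k → Y ≼ ω × k ∈ ω₂ × (∀ ξ → ξ ∈ Y → ξ ∈ ω₂ → ξ ∈ k))))
      where
      bnd : ∀ Y → Y ≼ ω → ∃[ k ∈ h ] (Y ≼ ω × k ∈ ω₂ × (∀ ξ → ξ ∈ Y → ξ ∈ ω₂ → ξ ∈ k))
      bnd Y cY = case sep Y (_∈ ω₂) of λ (Y′ , hY′) →
        case ω₂-bound (countable⇒Small (λ x p → ω₂⊆h x (proj₂ (to (hY′ x) p))) (≼-trans (⊆⇒≼ λ x p → proj₁ (to (hY′ x) p)) cY)) _≡_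
          (λ a p → a , proj₂ (to (hY′ a) p) , refl) of λ (k , k∈ω₂ , f) → k , ω₂⊆h k k∈ω₂ , cY , k∈ω₂ , λ ξ p q →
        case f ξ (from (hY′ ξ) (p , q)) of λ { (_ , r , refl) → r }

  -- Pressing down to a binary tree

  -- Below, S δ says that the closure Cl δ i has trace i on ω₁ and is cofinal in δ. For some i in T there are
  -- stationary many such δ, and pressing down yields a tree of ordinals β all of whose branches r ⊆ ω
  -- produce distinct sets of C with trace i.
  module Continuum (F T C : V) (st : Stationary₁ T) (club : Club h₂ C) (cap : Captures F T C) where
    open ClubClosure C club
    open At y₀ (C⊆H₂ _ (proj₂ ∃y₀))

    Traces : V → V → Set ℓ
    Traces i δ = ∀[ z ∈ ω₁ ] (Cl δ i z ⇔ z ∈ i)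

    opaque
      S : V → V → Set ℓ
      S i δ = Traces i δ × (∀[ ξ ∈ δ ] ∃[ ρ ∈ δ ] (ξ ∈ ρ × Cl δ i ρ))

      mkS : ∀ {i δ} → Traces i δ → (∀[ ξ ∈ δ ] ∃[ ρ ∈ δ ] (ξ ∈ ρ × Cl δ i ρ)) → S i δ
      mkS t c = t , c

      S-traces : ∀ {i δ} → S i δ → Traces i δ
      S-traces = proj₁

      S-cofinal : ∀ {i δ} → S i δ → ∀[ ξ ∈ δ ] ∃[ ρ ∈ δ ] (ξ ∈ ρ × Cl δ i ρ)
      S-cofinal = proj₂

      def-S : Def₂ S
      def-S = auto {X = Def₂ (λ i δ → Traces i δ × (∀[ ξ ∈ δ ] ∃[ ρ ∈ δ ] (ξ ∈ ρ × Cl δ i ρ)))}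

    private
      instance
        i-S : Atom₂ def-S
        i-S = atom₂ def-S

        ×S : Atom₂× def-S
        ×S = atom₂× def-S

    Hit : V → V → V → V → Set ℓ
    Hit δ r j k = Tracing δ j k × (∀[ ρ ∈ r ] ∃[ j′ ∈ k ] E δ ρ j′)

    opaque
      def-Hit : ∀ δ r → Def₂ (Hit δ r)
      def-Hit δ r = def-× (def-Tracing δ) auto

      -- Every nonempty closed point of `Hit` exceeds the indices of all members of the countable
      -- cofinal set `r`, so the closure is cofinal in δ. Since i < ω₁ < δ, the map from δ to i is
      -- regressive.
      some-trace : ∀ {δ} → δ ∈ ω₂ → ω₁ ∈ δ → Cofinal δ → ∃[ i ∈ δ ] (i ∈ T × S i δ)
      some-trace {δ} δ∈ω₂ ω₁∈δ (r , cr , r⊆δ , cof) =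
        case ω₁-bound r cr (E δ) (λ ρ p → E-tot δ∈ω₂ (r⊆δ ρ p)) of λ (b , b∈ω₁ , hb) →
        case Meets-rel (Stationary₁⇒Meets st) (Hit δ r) {{def-Hit δ r}}
          (λ l l∈ω₁ → case tracing δ∈ω₂ ω₁⊆δ l l∈ω₁ of λ (k₁ , k₁∈ω₁ , l∈k₁ , t , j , j∈k₁ , e) →
            case ω₁-max k₁∈ω₁ b∈ω₁ of λ (k , k∈ω₁ , k₁∈k , b∈k) → let ok = ∈ω₁-Ordinal k∈ω₁ in
            k , k∈ω₁ , (proj₁ ok k₁ k₁∈k l l∈k₁ , (λ z p q → proj₁ ok k₁ k₁∈k z (t z p q)) , j , proj₁ ok k₁ k₁∈k j j∈k₁ , e)
            , λ ρ p → case hb ρ p of λ (j′ , q , e′) → j′ , proj₁ ok b b∈k j′ q , e′) of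
          λ (i , i∈ω₁ , i∈T , (j₀ , j₀∈i) , cl) → let oi = ∈ω₁-Ordinal i∈ω₁ in
        i , ω₁⊆δ i i∈ω₁ , i∈T , mkS
        (trace i∈ω₁ (j₀ , j₀∈i) (λ j p → case cl j p of λ (k , k∈i , t , _) → k , k∈i , t))
        λ ξ ξ∈δ → case cof ξ ξ∈δ of λ (ρ , ρ∈r , ξ∈ρ) → case cl j₀ j₀∈i of λ (k , k∈i , _ , f) → case f ρ ρ∈r of
            λ (j , j∈k , e) → ρ , r⊆δ ρ ρ∈r , ξ∈ρ , Cl-gen (proj₁ oi k k∈i j j∈k) e
        where
        ω₁⊆δ : ω₁ ⊆ δ
        ω₁⊆δ = proj₁ (∈ω₂-Ordinal δ∈ω₂) ω₁ ω₁∈δ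

      common-trace : ∃[ i ∈ T ] Meets ω₂ (S i)
      common-trace = case Fodor.fodor (λ δ i → i ∈ T × S i δ) d
          (Meets-⊆ (λ δ δ∈ω₂ (p , c) → some-trace δ∈ω₂ p c) (ω₂-Meets ω₁∈ω₂)) of λ (i , _ , m) →
        case Meets-rel {ω₂} {λ δ → i ∈ T × S i δ} m _∈_ (λ j p → case ω₂-max p p of λ (k , q , r , _) → k , q , r) of
          λ (_ , _ , (i∈T , _) , _) → i , i∈T , Meets-⊆ (λ _ _ → proj₂) m
        where
        d : Def₂ (λ δ i → i ∈ T × S i δ)
        d = auto

    module Tree (i : V) (i∈T : i ∈ T) (mS : Meets ω₂ (S i)) where
      opaque
        -- Stationarily many δ with trace i have both ordinals in their closure.
        Ext : V → V → Set ℓ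
        Ext β β′ = ∀ q → (∀[ j ∈ ω₂ ] ∃[ k ∈ ω₂ ] q [ j ]≈ k) →
          ∃[ δ ∈ ω₂ ] ((S i δ × Cl δ i β × Cl δ i β′) × (∃[ j ] j ∈ δ) × (∀[ j ∈ δ ] ∃[ k ∈ δ ] q [ j ]≈ k))

        Ext→ : ∀ {β β′} → Ext β β′ → Meets ω₂ (λ δ → S i δ × Cl δ i β × Cl δ i β′)
        Ext→ e = e

        Ext← : ∀ {β β′} → Meets ω₂ (λ δ → S i δ × Cl δ i β × Cl δ i β′) → Ext β β′
        Ext← e = e

        def-Ext : Def₂ Ext
        def-Ext = auto {X = Def₂ (λ β β′ → Meets ω₂ (λ δ → S i δ × Cl δ i β × Cl δ i β′))}

      private
        instance
          i-Ext : Atom₂ def-Ext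
          i-Ext = atom₂ def-Ext

          ×Ext : Atom₂× def-Ext
          ×Ext = atom₂× def-Ext

      Big : V → Set ℓ
      Big β = β ∈ ω₂ × ω₁ ∈ β × Ext β β

      -- The two extensions of β exclude each other in one direction: a closed set with trace i that
      -- contains β″ meets it in its i-th piece, and so omits β′.
      Split : V → V → V → Set ℓ
      Split β β′ β″ = β ∈ β′ × β′ ∈ β″ × β″ ∈ ω₂ × Ext β β′ × Ext β β″ × (∀ j → j ∈ i → ¬ E β″ β′ j)

      Succ : V → V → Set ℓ
      Succ β β′ = β ∈ β′ × (∀ z → Cl β i z → Cl β′ i z) × Cl β′ i β

      opaque
        i∈ω₁ : i ∈ ω₁
        i∈ω₁ = proj₁ st i i∈T

        Ext-some : ∀ {β β′} → Ext β β′ → ∃[ δ ∈ ω₂ ] (S i δ × Cl δ i β × Cl δ i β′)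
        Ext-some {β} {β′} e = case Meets-rel {ω₂} {λ δ → S i δ × Cl δ i β × Cl δ i β′} (Ext→ e) _∈_
          (λ j p → case ω₂-max p p of λ (k , q , r , _) → k , q , r) of λ (δ , p , q , _) → δ , p , q

        Ext-Big : ∀ {β β′} → β′ ∈ ω₂ → ω₁ ∈ β′ → Ext β β′ → Big β′
        Ext-Big p q e = p , q , Ext← (Meets-⊆ (λ δ _ (s , _ , c) → s , c , c) (Ext→ e))

        -- The closure belonging to δ is cofinal in δ, so it has an element above α; pressing that
        -- element down makes it constant on a stationary set.
        extend : ∀ (P : V → Set ℓ) → Def₁ P → Meets ω₂ (λ δ → S i δ × P δ) → ∀ {α} → α ∈ ω₂ →
                 ∃[ β ∈ ω₂ ] (α ∈ β × Meets ω₂ (λ δ → S i δ × P δ × Cl δ i β))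
        extend P dP m {α} α∈ω₂ = case Fodor.fodor (λ δ β → S i δ × α ∈ β × Cl δ i β × P δ) d
            (Meets-⊆ (λ { δ _ (α∈δ , s , p) → case S-cofinal s α α∈δ of λ (ρ , ρ∈δ , α∈ρ , c) → ρ , ρ∈δ , s , α∈ρ , c , p })
              (Meets-above {S = λ δ → S i δ × P δ} α∈ω₂ m)) of λ (β , β∈ω₂ , m′) →
          β , β∈ω₂
          , (case Meets-rel {ω₂} {λ δ → S i δ × α ∈ β × Cl δ i β × P δ} m′ _∈_
              (λ j p → case ω₂-max p p of λ (k , q , r , _) → k , q , r) of λ (_ , _ , (_ , α∈β , _) , _) → α∈β)
          , Meets-⊆ (λ δ _ (s , _ , c , p) → s , p , c) m′
          where
          d : Def₂ (λ δ β → S i δ × α ∈ β × Cl δ i β × P δ)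
          d = auto where
            instance
              _ : Atom₁ dP
              _ = atom₁ dP

        Big-extend : ∀ {β α} → Big β → α ∈ ω₂ → ∃[ β′ ∈ ω₂ ] (α ∈ β′ × Ext β β′)
        Big-extend {β} (_ , _ , e) p =
          case extend (λ δ → Cl δ i β) auto (Meets-⊆ (λ δ _ (s , c , _) → s , c) (Ext→ e)) p of λ (β′ , q , r , m) →
          β′ , q , r , Ext← m

        root : ∃[ β ] Big β
        root = case extend (λ δ → δ ≡ δ) auto (Meets-⊆ (λ δ _ s → s , refl) mS) ω₁∈ω₂ of λ (β , p , q , m) →
          β , p , q , Ext← (Meets-⊆ (λ δ _ (s , _ , c) → s , c , c) m)

        closure : ∀ {δ} → S i δ → ∃[ Y ] (IsSetOf Y (Cl δ i) × Closed₀ Y × IsIntersection i Y ω₁)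
        closure {δ} s = let t = S-traces s in case Cl-set δ i of λ (Y , hY , cY , _) → Y , hY , closed⇒Closed₀ cY , λ z → mk⇔
          (λ p → let q = proj₁ Ordinal-ω₁ i i∈ω₁ z p in from (hY z) (from (t z q) p) , q)
          λ (p , q) → to (t z q) (to (hY z) p)

        piece : ∀ {δ β} → S i δ → β ∈ ω₂ → Cl δ i β → ∀ ξ → ξ ∈ β → (Cl δ i ξ ⇔ (∃[ j ∈ i ] E β ξ j))
        piece s p c ξ q = case closure s of λ (Y , hY , cY , hi) → let e = Closed₀-piece cY hi p (from (hY _) c) ξ q in
          mk⇔ (λ c′ → to e (from (hY ξ) c′)) λ x → to (hY ξ) (from e x)

        below : ∀ {δ β} → S i δ → β ∈ ω₂ → Cl δ i β → ∀ z → Cl β i z → Cl δ i z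
        below s p c = Cl-⊆ λ ξ j q r → from (piece s p c ξ (proj₁ (proj₂ (E-dom r)))) (j , q , r)

        -- The closure of a common δ meets β and β′ in their i-th pieces, so the piece of β is the
        -- part below β of the piece of β′, and β itself lies in the latter.
        Ext⇒Succ : ∀ {β β′} → β ∈ β′ → β′ ∈ ω₂ → Ext β β′ → Succ β β′
        Ext⇒Succ {β} {β′} p q e = case Ext-some e of λ (δ , _ , s , c , c′) → let β∈ω₂ = ∈ω₂⇒⊆ω₂ q β p in p
          , Cl-⊆ (λ ξ j j∈i r → let ξ∈β = proj₁ (proj₂ (E-dom r)) in
              case to (piece s q c′ ξ (proj₁ (∈ω₂-Ordinal q) β p ξ ξ∈β)) (from (piece s β∈ω₂ c ξ ξ∈β) (j , j∈i , r)) of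
                λ (j′ , j′∈i , r′) → Cl-gen j′∈i r′)
          , (case to (piece s q c′ β p) c of λ (j , j∈i , r) → Cl-gen j∈i r)

        Big-trace : ∀ {β} → Big β → Traces i β
        Big-trace {β} (p , ω₁∈β , e) z z∈ω₁ = case Ext-some e of λ (δ , _ , s , c , _) → mk⇔
          (λ q → to (S-traces s z z∈ω₁) (below s p c z q))
          λ q → case to (piece s p c z (proj₁ (∈ω₂-Ordinal p) ω₁ ω₁∈β z z∈ω₁)) (from (S-traces s z z∈ω₁) q) of
            λ (j , j∈i , r) → Cl-gen j∈i r

      Up : V → V → V → Set ℓ
      Up β a b = (a ∈ ω₂ × b ∈ ω₂) × (a ∈ b × (β ∈ b × Ext β b))

      opaque
        def-Up : ∀ β → Def₂ (Up β)
        def-Up β = auto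

        up : ∀ {β} → Big β → ∀ a → a ∈ ω₂ → ∃[ b ] Up β a b
        up bβ a a∈ω₂ = case ω₂-max a∈ω₂ (proj₁ bβ) of λ (c , c∈ω₂ , a∈c , β∈c) → case Big-extend bβ c∈ω₂ of
          λ (b , b∈ω₂ , c∈b , e) → let ob = ∈ω₂-Ordinal b∈ω₂ in
          b , (a∈ω₂ , b∈ω₂) , proj₁ ob c c∈b a a∈c , proj₁ ob c c∈b _ β∈c , e

        -- Here β″ lies above κ = M ∩ ω₂. Its i-th piece meets κ in a countable subset of M, bounded
        -- by some `a` in M; an extension β′ of β in M above `a` is not in that piece.
        split-in : ∀ {M κ β β″} → IsIntersection κ M ω₂ → κ ∈ ω₂ →
          (∀ x → x ≼ ω → x ⊆ M → x ⊆ ω₂ → ∃[ k ∈ M ] (k ∈ ω₂ × x ⊆ k)) →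
          (∀ a → a ∈ M → a ∈ ω₂ → ∃[ b ∈ M ] Up β a b) → Up β κ β″ → ∃[ β′ ] Split β β′ β″
        split-in {M} {κ} {β} {β″} hκ κ∈ω₂ cov grow ((_ , β″∈ω₂) , κ∈β″ , _ , e″) = byContra λ none →
          case sep κ (λ ξ → ∃[ j ∈ i ] E β″ ξ j) of λ (x , hx) →
          case cov x (≼-trans (≼-rel x i (E β″) (λ ξ p → proj₂ (to (hx ξ) p)) λ _ _ _ _ _ → E-inj) (∈ω₁⇒countable i i∈ω₁))
            (λ ξ p → proj₁ (to (hκ ξ) (proj₁ (to (hx ξ) p)))) (λ ξ p → ∈ω₂⇒⊆ω₂ κ∈ω₂ ξ (proj₁ (to (hx ξ) p))) of λ (a , a∈M , a∈ω₂ , x⊆a) →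
          case grow a a∈M a∈ω₂ of λ (β′ , β′∈M , (_ , β′∈ω₂) , a∈β′ , β∈β′ , e′) →
          let β′∈κ = from (hκ β′) (β′∈M , β′∈ω₂) in
          none (β′ , β∈β′ , proj₁ (∈ω₂-Ordinal β″∈ω₂) κ κ∈β″ β′ β′∈κ , β″∈ω₂ , e′ , e″ , λ j j∈i r →
            ∈-asym a∈β′ (x⊆a β′ (from (hx β′) (β′∈κ , j , j∈i , r))))

        split : ∀ {β} → Big β → ∃[ β′ ] ∃[ β″ ] Split β β′ β″
        split {β} bβ = case good (𝔸-∧ cover (𝔸-clos (Up β) {{def-Up β}})) of λ (M , g , cov , cl) →
          case up bβ (Good.κ g) (Good.κ∈ g) of λ (β″ , u) →
          case split-in (Good.hκ g) (Good.κ∈ g) cov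
            (λ a a∈M a∈ω₂ → cl a a∈M (case up bβ a a∈ω₂ of λ (b , v) → b , ω₂⊆h b (proj₂ (proj₁ v)) , v)) u of λ (β′ , s) →
          β′ , β″ , s

        Split-left : ∀ {β β′ β″} → Big β → Split β β′ β″ → Big β′ × Succ β β′
        Split-left (_ , p , _) (β∈β′ , β′∈β″ , β″∈ω₂ , e′ , _) = let q = ∈ω₂⇒⊆ω₂ β″∈ω₂ _ β′∈β″ in
          Ext-Big q (proj₁ (∈ω₂-Ordinal q) _ β∈β′ _ p) e′ , Ext⇒Succ β∈β′ q e′

        Split-right : ∀ {β β′ β″} → Big β → Split β β′ β″ → Big β″ × Succ β β″
        Split-right (_ , p , _) (β∈β′ , β′∈β″ , q , _ , e″ , _) = let r = proj₁ (∈ω₂-Ordinal q) _ β′∈β″ _ β∈β′ in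
          Ext-Big q (proj₁ (∈ω₂-Ordinal q) _ r _ p) e″ , Ext⇒Succ r q e″

        def-Big : Def₁ Big
        def-Big = auto

        tree : ∃[ Σ′ ] ∃[ L ] ∃[ R ] ((∀ β → β ∈ Σ′ ⇔ Big β) × Fn Σ′ Σ′ L × Fn Σ′ Σ′ R ×
               (∀ β β′ β″ → L [ β ]≈ β′ → R [ β ]≈ β″ → Split β β′ β″))
        tree = case sep ω₂ Big {{def-Big}} of λ (Σ′ , hΣ) →
          let isBig : ∀ β → β ∈ Σ′ ⇔ Big β
              isBig β = mk⇔ (λ p → proj₂ (to (hΣ β) p)) λ b → from (hΣ β) (proj₁ b , b)
          in case choose Σ′ Σ′ (λ β β′ → ∃[ β″ ] Split β β′ β″) {{dL}}
            (λ β p → let b = to (isBig β) p in case split b of λ (β′ , β″ , s) → β′ , from (isBig β′) (proj₁ (Split-left b s)) , β″ , s)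
          of λ (L , fL , hL) → case choose Σ′ Σ′ (λ β β″ → ∃[ β′ ] (L [ β ]≈ β′ × Split β β′ β″)) {{dR L}}
            (λ β p → let b = to (isBig β) p in case Fn.tot fL β p of λ (β′ , r) → case hL β β′ r of λ (β″ , s) →
              β″ , from (isBig β″) (proj₁ (Split-right b s)) , β′ , r , s)
          of λ (R , fR , hR) → Σ′ , L , R , isBig , fL , fR , λ β β′ β″ r r′ → case hR β β″ r′ of λ { (β₁ , r₁ , s) →
            case Fn.fun fL r r₁ of λ { refl → s } }
          where
          dL : Def₂ (λ β β′ → ∃[ β″ ] Split β β′ β″)
          dL = auto
          dR : ∀ L → Def₂ (λ β β″ → ∃[ β′ ] (L [ β ]≈ β′ × Split β β′ β″))
          dR L = auto

  -- Branches of the tree and the sets they code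

  module Branches (F T C : V) (st : Stationary₁ T) (club : Club h₂ C) (cap : Captures F T C)
                  (i : V) (i∈T : i ∈ T) (mS : Meets ω₂ (Continuum.S F T C st club cap i)) where
    open Continuum F T C st club cap
    open ClubClosure C club
    open At y₀ (C⊆H₂ _ (proj₂ ∃y₀))
    open Tree i i∈T mS

    module Along (Σ′ L R : V) (isBig : ∀ β → β ∈ Σ′ ⇔ Big β) (fL : Fn Σ′ Σ′ L) (fR : Fn Σ′ Σ′ R)
                 (LR : ∀ β β′ β″ → L [ β ]≈ β′ → R [ β ]≈ β″ → Split β β′ β″) (β₀ : V) (β₀∈ : β₀ ∈ Σ′) where

      -- The clauses of `Fn` are spelled out because instance search has formulas for connectives
      -- and atoms, not for records.
      Branch : V → V → Set ℓ
      Branch r s = (∀[ k ∈ ω ] ∃[ y ] s [ k ]≈ y) × ((∀ k y → s [ k ]≈ y → k ∈ ω × y ∈ Σ′) ×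
        ((∀ k x y → s [ k ]≈ x → s [ k ]≈ y → x ≡ y) × ((∀ e → IsEmpty e → s [ e ]≈ β₀) ×
        (∀ k k⁺ x y → IsSuc k⁺ k → s [ k ]≈ x → s [ k⁺ ]≈ y → (k ∈ r → L [ x ]≈ y) × (k ∉ r → R [ x ]≈ y)))))

      In : V → V → Set ℓ
      In s z = ∃[ k ] ∃[ β ] (s [ k ]≈ β × Cl β i z)

      Codes : V → V → Set ℓ
      Codes r z = ∃[ s ] (Branch r s × (∀ ξ → ξ ∈ z ⇔ (ξ ∈ ω₂ × In s ξ)))

      opaque

        def-Branch : Def₂ Branch
        def-Branch = auto

        def-Codes : Def₂ Codes
        def-Codes = def-∃ (def-× (get (atom₂ def-Branch)) auto)

        branch : ∀ r → ∃[ s ] Branch r s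
        branch r = case dc Σ′ (λ k x y → (k ∈ r → L [ x ]≈ y) × (k ∉ r → R [ x ]≈ y)) β₀ β₀∈
            (λ k _ x x∈ → case em {k ∈ r} of λ
              { (yes p) → case Fn.tot fL x x∈ of λ (y , q) → y , Fn.cod fL q , (λ _ → q) , λ n → ⊥-elim (n p)
              ; (no n) → case Fn.tot fR x x∈ of λ (y , q) → y , Fn.cod fR q , (λ p → ⊥-elim (n p)) , λ _ → q })
          of λ (s , fs , s₀ , s⁺) → s , Fn.tot fs , (λ k y p → Fn.dom fs p , Fn.cod fs p) , (λ k x y → Fn.fun fs) , s₀ , s⁺

      module _ {r s} (b : Branch r s) where
        private
          tot = proj₁ b
          typ = proj₁ (proj₂ b)
          fun = proj₁ (proj₂ (proj₂ b))
          start = proj₁ (proj₂ (proj₂ (proj₂ b)))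
          next = proj₂ (proj₂ (proj₂ (proj₂ b)))

        opaque
          big : ∀ {k β} → s [ k ]≈ β → Big β
          big p = to (isBig _) (proj₂ (typ _ _ p))

          after : ∀ {k β} → s [ k ]≈ β → ∃[ k⁺ ] ∃[ β′ ] (IsSuc k⁺ k × s [ k⁺ ]≈ β′)
          after {k} p = case ∃suc k of λ (k⁺ , hk) → case tot k⁺ (suc-∈ω (proj₁ (typ _ _ p)) hk) of λ (β′ , q) → k⁺ , β′ , hk , q

          step : ∀ {k k⁺ β β′} → IsSuc k⁺ k → s [ k ]≈ β → s [ k⁺ ]≈ β′ → Succ β β′
          step {k} {β = β} hk p q = case Fn.tot fL β (proj₂ (typ _ _ p)) of λ (a , ra) →
            case Fn.tot fR β (proj₂ (typ _ _ p)) of λ (c , rc) → let sp = LR β a c ra rc in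
            case em {k ∈ r} of λ
            { (yes y) → case Fn.fun fL ra (proj₁ (next _ _ _ _ hk p q) y) of λ { refl → proj₂ (Split-left (big p) sp) }
            ; (no n) → case Fn.fun fR rc (proj₂ (next _ _ _ _ hk p q) n) of λ { refl → proj₂ (Split-right (big p) sp) } }

          growing : ∀ m → m ∈ ω → ∀ k → k ∈ m → ∀ β β′ → s [ k ]≈ β → s [ m ]≈ β′ → ∀ z → Cl β i z → Cl β′ i z
          growing = ω-ind (λ m → ∀ k → k ∈ m → ∀ β β′ → s [ k ]≈ β → s [ m ]≈ β′ → ∀ z → Cl β i z → Cl β′ i z)
            (λ e he k p → ⊥-elim (he k p))
            λ m m∈ω ih m⁺ hm k k∈m⁺ β β′ p q z c → case to (hm k) k∈m⁺ of λ
            { (inj₁ k∈m) → case tot m m∈ω of λ (v , t) → proj₁ (proj₂ (step hm t q)) z (ih k k∈m β v p t z c)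
            ; (inj₂ refl) → proj₁ (proj₂ (step hm p q)) z c }

          In-join : ∀ {x y} → In s x → In s y → ∃[ β ] ((∃[ k ] s [ k ]≈ β) × Cl β i x × Cl β i y)
          In-join (k , β , p , c) (k′ , β′ , p′ , c′) =
            case ∈-tri (Ordinal-∈ Ordinal-ω (proj₁ (typ _ _ p))) (Ordinal-∈ Ordinal-ω (proj₁ (typ _ _ p′))) of λ
            { (inj₁ q) → β′ , (k′ , p′) , growing k′ (proj₁ (typ _ _ p′)) k q β β′ p p′ _ c , c′
            ; (inj₂ (inj₁ refl)) → case fun _ _ _ p p′ of λ { refl → β , (k , p) , c , c′ }
            ; (inj₂ (inj₂ q)) → β , (k , p) , c , growing k (proj₁ (typ _ _ p)) k′ q β′ β p′ p _ c′ }

          In-next : ∀ {k β} → s [ k ]≈ β → In s β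
          In-next p = case after p of λ (k⁺ , β′ , hk , q) → k⁺ , β′ , q , proj₂ (proj₂ (step hk p q))

          In-countable : ∀ {Y} → (∀ z → z ∈ Y → In s z) → Y ≼ ω
          In-countable {Y} hY = case powerSet h₂ of λ (q , hq) →
            case sep q (λ a → ∃[ k ] ∃[ β ] (s [ k ]≈ β × (∀ z → z ∈ a ⇔ Cl β i z))) of λ (A , hA) → case ⋃ A of λ (U , hU) →
            ≼-trans (⊆⇒≼ (λ z z∈Y → case hY z z∈Y of λ (k , β , p , c) → case Cl-set β i of λ (a , ha , _ , a⊆) →
                from (hU z) (a , from (hA a) (from (hq a) a⊆ , k , β , p , ha) , from (ha z) c)))
            (⋃-countable
              (≼-rel A ω (λ a k → ∃[ β ] (s [ k ]≈ β × (∀ z → z ∈ a ⇔ Cl β i z)))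
                (λ a a∈A → case to (hA a) a∈A of λ (_ , k , β , p , e) → k , proj₁ (typ _ _ p) , β , p , e)
                λ { a a′ k _ _ (β , p , e) (β′ , p′ , e′) → case fun _ _ _ p p′ of λ { refl → IsSetOf-unique e e′ } })
              (λ a a∈A → case to (hA a) a∈A of λ (_ , k , β , p , e) → case Cl-countable (proj₁ (big p)) i∈ω₁ of
                λ (t , ct , _ , ht) → ≼-trans (⊆⇒≼ λ z z∈a → ht z (to (e z) z∈a)) ct) hU)

          In-closed : ∀ {Y} → (∀ z → z ∈ Y ⇔ In s z) → ∀[ x ∈ Y ] ∀[ x′ ∈ Y ] ∀ z → K x x′ z → z ∈ Y
          In-closed e x p x′ p′ z t = case In-join (to (e x) p) (to (e x′) p′) of λ (β , (k , q) , c , c′) →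
            from (e z) (k , β , q , Cl-closed c c′ t)

          In-trace : ∀ {Y} → (∀ z → z ∈ Y ⇔ In s z) → IsIntersection i Y ω₁
          In-trace e z = mk⇔
            (λ p → case ∃∅ of λ (o , ho) → let z∈ω₁ = proj₁ Ordinal-ω₁ i i∈ω₁ z p in
              from (e z) (o , β₀ , start o ho , from (Big-trace (big (start o ho)) z z∈ω₁) p) , z∈ω₁)
            λ (p , z∈ω₁) → case to (e z) p of λ (k , β , q , c) → to (Big-trace (big q) z z∈ω₁) c

          In-set₀ : ∃[ Y ] ((∀ z → z ∈ Y ⇔ In s z) × Y ⊆ h₂)
          In-set₀ = case sep h₂ (In s) of λ (Y , hY) → Y
            , (λ z → mk⇔ (λ p → proj₂ (to (hY z) p)) λ { (k , β , p , c) → from (hY z) (Cl⊆H₂ c , k , β , p , c) })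
            , λ z p → proj₁ (to (hY z) p)

          In-inhabited : ∀ {Y} → (∀ z → z ∈ Y ⇔ In s z) → ∃[ x ] x ∈ Y
          In-inhabited e = case ∃∅ of λ (o , ho) → β₀ , from (e β₀) (In-next (start o ho))

          -- The union of the closures along a branch is closed, countable and nonempty, hence in
          -- `C`; its trace is i because each node is `Big`.
          In-set : ∃[ Y ] ((∀ z → z ∈ Y ⇔ In s z) × Y ∈ C × Y ⊆ h₂ × Y ≼ ω × Closed₀ Y × IsIntersection i Y ω₁)
          In-set with In-set₀
          ... | Y , e , Y⊆ = Y , e , closed⇒∈C (In-closed e) Y⊆ cY (In-inhabited e) , Y⊆ , cY , closed⇒Closed₀ (In-closed e) , In-trace e
            where
            cY : Y ≼ ω
            cY = In-countable λ z p → to (e z) p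

          coded : ∃[ z ∈ F ] Codes r z
          coded = case In-set of λ (Y , e , Y∈C , Y⊆ , cY , clY , hi) → case cap Y Y∈C Y⊆ cY clY i i∈T hi of λ (z , z∈F , hz) →
            z , z∈F , s , b , λ ξ → mk⇔ (λ p → case to (hz ξ) p of λ (q , q′) → q′ , to (e ξ) q)
              λ (q , q′) → from (hz ξ) (from (e ξ) q′ , q)

          -- A model that contains the root and is closed under `L`, `R` and `K` includes the sets
          -- of all branches at once. This is what bounds all codes by one α.
          In-M : ∀ {M} → Good M → β₀ ∈ M → y₀ ∈ M →
            (∀[ x ∈ M ] (x ∈ h₂ → ∀[ x′ ∈ M ] (x′ ∈ h₂ → ∀ z → K x x′ z → z ∈ M))) →
            (∀ x → x ∈ M → ∀ y → L [ x ]≈ y ⊎ R [ x ]≈ y → y ∈ M) → ∀ z → In s z → z ∈ M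
          In-M {M} g β₀∈M y₀∈M cM cLR z (k , β , p , c) =
            Cl⊆M g (proj₁ Ordinal-ω₁ i i∈ω₁) (proj₁ (big p)) (stays k (proj₁ (typ _ _ p)) β p) y₀∈M cM z c
            where
            stays : ∀ k → k ∈ ω → ∀ β → s [ k ]≈ β → β ∈ M
            stays = ω-ind (λ k → ∀ β → s [ k ]≈ β → β ∈ M)
              (λ e he β q → subst (_∈ M) (fun _ _ _ (start e he) q) β₀∈M)
              λ k k∈ω ih k⁺ hk β q → case tot k k∈ω of λ (α , t) → cLR α (ih α t) β (case em {k ∈ r} of λ
                { (yes y) → inj₁ (proj₁ (next _ _ _ _ hk t q) y) ; (no n) → inj₂ (proj₂ (next _ _ _ _ hk t q) n) })

      opaque
        -- The first branch continues to the left child a, the second to the right child c. If the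
        -- second set contained a too, then a would be in the i-th piece of c, which `Split`
        -- excludes.
        clash : ∀ {r r′ s s′ k x} → Branch r s → Branch r′ s′ → s [ k ]≈ x → s′ [ k ]≈ x → k ∈ r → k ∉ r′ →
                (∀ ξ → ξ ∈ ω₂ → In s ξ → In s′ ξ) → ⊥
        clash {x = x} b b′ p p′ k∈r k∉r′ same = case after b p of λ (k⁺ , a , hk , q) → case after b′ p′ of λ (_ , c , hk′ , q′) →
          case LR x a c (proj₁ (proj₂ (proj₂ (proj₂ (proj₂ b))) _ _ _ _ hk p q) k∈r)
                        (proj₂ (proj₂ (proj₂ (proj₂ (proj₂ b′))) _ _ _ _ hk′ p′ q′) k∉r′) of
            λ (_ , a∈c , c∈ω₂ , _ , _ , apart) → case In-set b′ of λ (Y , e , _ , _ , _ , clY , hi) →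
          case to (Closed₀-piece clY hi c∈ω₂ (from (e c) (In-next b′ q′)) a a∈c)
                  (from (e a) (same a (∈ω₂⇒⊆ω₂ c∈ω₂ a a∈c) (In-next b q))) of λ (j , j∈i , t) → apart j j∈i t

        agree : ∀ {r r′ s s′} → Branch r s → Branch r′ s′ → (∀ ξ → ξ ∈ ω₂ → In s ξ → In s′ ξ) →
                (∀ ξ → ξ ∈ ω₂ → In s′ ξ → In s ξ) → ∀ k → k ∈ ω → ∀ x x′ → s [ k ]≈ x → s′ [ k ]≈ x′ → x ≡ x′
        agree {r} {r′} {s} {s′} b b′ h h′ = ω-ind (λ k → ∀ x x′ → s [ k ]≈ x → s′ [ k ]≈ x′ → x ≡ x′)
          (λ e he x x′ p p′ → trans (f b p (st₀ b he)) (f b′ (st₀ b′ he) p′))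
          λ k k∈ω ih k⁺ hk x x′ p p′ → case proj₁ b k k∈ω of λ (y , q) → case proj₁ b′ k k∈ω of λ { (y′ , q′) →
          case ih y y′ q q′ of λ { refl → case em {k ∈ r} of λ
            { (yes u) → case em {k ∈ r′} of λ
                { (yes u′) → Fn.fun fL (proj₁ (nx b hk q p) u) (proj₁ (nx b′ hk q′ p′) u′)
                ; (no n′) → ⊥-elim (clash b b′ q q′ u n′ h) }
            ; (no n) → case em {k ∈ r′} of λ
                { (yes u′) → ⊥-elim (clash b′ b q′ q u′ n h′)
                ; (no n′) → Fn.fun fR (proj₂ (nx b hk q p) n) (proj₂ (nx b′ hk q′ p′) n′) } } } }
          where
          f : ∀ {r s} → Branch r s → ∀ {k x y} → s [ k ]≈ x → s [ k ]≈ y → x ≡ y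
          f b = proj₁ (proj₂ (proj₂ b)) _ _ _
          st₀ : ∀ {r s} → Branch r s → ∀ {e} → IsEmpty e → s [ e ]≈ β₀
          st₀ b = proj₁ (proj₂ (proj₂ (proj₂ b))) _
          nx : ∀ {r s} → Branch r s → ∀ {k k⁺ x y} → IsSuc k⁺ k → s [ k ]≈ x → s [ k⁺ ]≈ y → (k ∈ r → L [ x ]≈ y) × (k ∉ r → R [ x ]≈ y)
          nx b = proj₂ (proj₂ (proj₂ (proj₂ b))) _ _ _ _

        Codes-injective : ∀ {r r′ z} → r ⊆ ω → r′ ⊆ ω → Codes r z → Codes r′ z → r ≡ r′
        Codes-injective {r} {r′} r⊆ω r′⊆ω (s , b , e) (s′ , b′ , e′) = ⊆-antisym
          (λ k p → byContra λ n → case proj₁ b k (r⊆ω k p) of λ (x , q) → case proj₁ b′ k (r⊆ω k p) of λ { (x′ , q′) →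
            case agree b b′ forth back k (r⊆ω k p) x x′ q q′ of λ { refl → clash b b′ q q′ p n forth } })
          (λ k p → byContra λ n → case proj₁ b k (r′⊆ω k p) of λ (x , q) → case proj₁ b′ k (r′⊆ω k p) of λ { (x′ , q′) →
            case agree b b′ forth back k (r′⊆ω k p) x x′ q q′ of λ { refl → clash b′ b q′ q p n back } })
          where
          forth : ∀ ξ → ξ ∈ ω₂ → In s ξ → In s′ ξ
          forth ξ p q = proj₂ (to (e′ ξ) (from (e ξ) (p , q)))
          back : ∀ ξ → ξ ∈ ω₂ → In s′ ξ → In s ξ
          back ξ p q = proj₂ (to (e ξ) (from (e′ ξ) (p , q)))

        Codes-bounded : ∃[ α ∈ ω₂ ] (∀ r z → Codes r z → z ⊆ α)
        Codes-bounded = case good (𝔸-∧ (𝔸-∧ (𝔸-fine (ω₂⊆h β₀ (proj₁ (to (isBig β₀) β₀∈)))) (𝔸-fine (H₂⊆h y₀ (C⊆H₂ _ (proj₂ ∃y₀)))))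
            (𝔸-∧ 𝔸-Closed (𝔸-∧ (𝔸-clos (λ x y → L [ x ]≈ y)) (𝔸-clos (λ x y → R [ x ]≈ y))))) of
          λ (M , g , (β₀∈M , y₀∈M) , cM , cL , cR) → Good.κ g , Good.κ∈ g , λ r z (s , b , e) ξ ξ∈z → case to (e ξ) ξ∈z of λ (p , q) →
          from (Good.hκ g ξ) (In-M b g β₀∈M y₀∈M cM (λ x x∈M y → λ
            { (inj₁ t) → case cL x x∈M (y , inh (Fn.cod fL t) , t) of λ (y′ , y′∈M , t′) → subst (_∈ M) (Fn.fun fL t′ t) y′∈M
            ; (inj₂ t) → case cR x x∈M (y , inh (Fn.cod fR t) , t) of λ (y′ , y′∈M , t′) → subst (_∈ M) (Fn.fun fR t′ t) y′∈M }) ξ q , p)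
          where
          inh : ∀ {y} → y ∈ Σ′ → y ∈ h
          inh p = ω₂⊆h _ (proj₁ (to (isBig _) p))

        codes : ∃[ α ∈ ω₂ ] ∃[ q ] ∃[ w ] ((∀ r → r ∈ q ⇔ r ⊆ ω) × Fn q F w × (∀ r z → w [ r ]≈ z → z ⊆ α) ×
                (∀ r r′ z → w [ r ]≈ z → w [ r′ ]≈ z → r ≡ r′))
        codes = case Codes-bounded of λ (α , α∈ω₂ , bd) → case powerSet ω of λ (q , hq) →
          case choose q F Codes {{def-Codes}} (λ r _ → case branch r of λ (s , b) → coded b) of λ (w , fw , hw) →
          α , α∈ω₂ , q , w , hq , fw , (λ r z p → bd r z (hw r z p)) ,
          λ r r′ z p p′ → Codes-injective (to (hq r) (Fn.dom fw p)) (to (hq r′) (Fn.dom fw p′)) (hw r z p) (hw r′ z p′)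

  opaque
    continuum : SRP[ω₂] → ∀ F → (∀ α → α ∈ ω₂ → ω₁ ⊆ α → Meets ω₁ (λ i → ∃[ s ∈ F ] IsPiece s α i)) →
      ∃[ α ∈ ω₂ ] ∃[ q ] ∃[ w ] ((∀ r → r ∈ q ⇔ r ⊆ ω) × Fn q F w × (∀ r z → w [ r ]≈ z → z ⊆ α) ×
        (∀ r r′ z → w [ r ]≈ z → w [ r′ ]≈ z → r ≡ r′))
    continuum srp F meets = case captured srp F meets of λ (T , C , st , club , cap) →
      case Continuum.common-trace F T C st club cap of λ (i , i∈T , mS) →
      case Continuum.Tree.tree F T C st club cap i i∈T mS of λ (Σ′ , L , R , isBig , fL , fR , LR) →
      case Continuum.Tree.root F T C st club cap i i∈T mS of λ (β₀ , b₀) →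
      Branches.Along.codes F T C st club cap i i∈T mS Σ′ L R isBig fL fR LR β₀ (from (isBig β₀) b₀)

-- The transitive collapses of the models

module Models {ℓ} (em : ExcludedMiddle ℓ) (𝔐 : Structure ℓ) (zfc : SetTheory.ZFC 𝔐) (ℵ : Cardinals 𝔐) (𝔍 : Ideal 𝔐 ℵ) where
  open SetTheory 𝔐
  open Cardinals ℵ
  open Alephs ω ω₁ ω₂
  open Ideal 𝔍
  open Closure em 𝔐 zfc ℵ 𝔍 public
  open Chosen chosen

  opaque
    -- Membership in the collapse of M, with the unique collapsing map quantified away so that M can
    -- vary inside formulas.
    InH : V → V → Set ℓ
    InH M z = ∃[ π ] ∃[ x ] (Col M π × π [ x ]≈ z)

    def-InH : Def₂ InH
    def-InH = auto {X = Def₂ (λ M z → ∃[ π ] ∃[ x ] (Col M π × π [ x ]≈ z))}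

    -- Countable elements of the collapse whose preimage is a set of ordinals included in M;
    -- countability is asked of the preimage.
    HC : V → V → Set ℓ
    HC M z = ∃[ π ] ∃[ x ] (Col M π × π [ x ]≈ z × x ≼ ω × x ⊆ M × (∀ ξ → ξ ∈ x → Ordinal ξ))

    def-HC : Def₂ HC
    def-HC = auto {X = Def₂ (λ M z → ∃[ π ] ∃[ x ] (Col M π × π [ x ]≈ z × x ≼ ω × x ⊆ M × (∀ ξ → ξ ∈ x → Ordinal ξ)))}

    -- Ordinals of the collapse. The preimage is required to be an ordinal, so that its subsets are
    -- sets of ordinals as in `HC`.
    Ht : V → V → Set ℓ
    Ht M α = ∃[ π ] ∃[ x ] (Col M π × π [ x ]≈ α × Ordinal x)

    def-Ht : Def₂ Ht
    def-Ht = auto {X = Def₂ (λ M α → ∃[ π ] ∃[ x ] (Col M π × π [ x ]≈ α × Ordinal x))}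

    Col-unique : ∀ {B c c′} → Col B c → Col B c′ → ∀ x → x ∈ B → ∀ y y′ → c [ x ]≈ y → c′ [ x ]≈ y′ → y ≡ y′
    Col-unique {B} {c} {c′} h h′ = ∈-ind B (λ x → ∀ y y′ → c [ x ]≈ y → c′ [ x ]≈ y′ → y ≡ y′) λ x x∈B ih y y′ r r′ → ⊆-antisym
      (λ z p → case to (proj₂ (proj₂ h x y r) z) p of λ (ζ , ζ∈B , ζ∈x , s) → case proj₁ h′ ζ ζ∈B of λ (z′ , s′) →
        subst (_∈ y′) (sym (ih ζ ζ∈x ζ∈B z z′ s s′)) (from (proj₂ (proj₂ h′ x y′ r′) z′) (ζ , ζ∈B , ζ∈x , s′)))
      (λ z p → case to (proj₂ (proj₂ h′ x y′ r′) z) p of λ (ζ , ζ∈B , ζ∈x , s′) → case proj₁ h ζ ζ∈B of λ (z′ , s) →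
        subst (_∈ y) (ih ζ ζ∈x ζ∈B z′ z s s′) (from (proj₂ (proj₂ h x y r) z′) (ζ , ζ∈B , ζ∈x , s)))

  instance
    i-InH : Atom₂ def-InH
    i-InH = atom₂ def-InH

    ×InH : Atom₂× def-InH
    ×InH = atom₂× def-InH

    i-HC : Atom₂ def-HC
    i-HC = atom₂ def-HC

    ×HC : Atom₂× def-HC
    ×HC = atom₂× def-HC

    i-Ht : Atom₂ def-Ht
    i-Ht = atom₂ def-Ht

    ×Ht : Atom₂× def-Ht
    ×Ht = atom₂× def-Ht

  module Collapse {M π : V} (hπ : Col M π) (gis : GIS M) where
    opaque
      extensional : ∀ {x y} → x ∈ M → y ∈ M → (∀ z → z ∈ M → z ∈ x ⇔ z ∈ y) → x ≡ y
      extensional = ZF⁻.extensionality (proj₁ (proj₂ gis)) _ _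

      π-dom : ∀ {x v} → π [ x ]≈ v → x ∈ M
      π-dom r = proj₁ (proj₂ hπ _ _ r)

      π-fun : ∀ {x v v′} → π [ x ]≈ v → π [ x ]≈ v′ → v ≡ v′
      π-fun = Col-fun hπ

      π-∈ : ∀ {x v z} → π [ x ]≈ v → z ∈ v ⇔ (∃[ u ∈ M ] (u ∈ x × π [ u ]≈ z))
      π-∈ r = proj₂ (proj₂ hπ _ _ r) _

      π-injective : ∀ {x y v} → π [ x ]≈ v → π [ y ]≈ v → x ≡ y
      π-injective r = ∈-ind M (λ x → ∀ y v → π [ x ]≈ v → π [ y ]≈ v → x ≡ y)
        (λ x x∈M ih y v r r′ → extensional x∈M (π-dom r′) λ z z∈M → mk⇔
          (λ z∈x → case proj₁ hπ z z∈M of λ (a , s) → case to (π-∈ r′) (from (π-∈ r) (z , z∈M , z∈x , s)) of λ (u , _ , u∈y , s′) →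
            subst (_∈ y) (sym (ih z z∈x z∈M u a s s′)) u∈y)
          (λ z∈y → case proj₁ hπ z z∈M of λ (a , s) → case to (π-∈ r) (from (π-∈ r′) (z , z∈M , z∈y , s)) of λ (u , u∈M , u∈x , s′) →
            subst (_∈ x) (ih u u∈x u∈M z a s′ s) u∈x))
        _ (π-dom r) _ _ r

      π-reflects : ∀ {x y a b} → π [ x ]≈ a → π [ y ]≈ b → a ∈ b → x ∈ y
      π-reflects r s p = case to (π-∈ s) p of λ (u , _ , u∈y , t) → subst (_∈ _) (π-injective t r) u∈y

      π-preserves : ∀ {x y a b} → π [ x ]≈ a → π [ y ]≈ b → x ∈ y → a ∈ b
      π-preserves r s p = from (π-∈ s) (_ , π-dom r , p , r)

    opaque
      unfolding InH
      InH→ : ∀ {z} → InH M z → ∃[ x ] π [ x ]≈ z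
      InH→ (π′ , x , h′ , r) = case proj₁ hπ x (proj₁ (proj₂ h′ x _ r)) of λ (v , s) →
        x , subst (π [ x ]≈_) (Col-unique hπ h′ x (proj₁ (proj₂ h′ x _ r)) v _ s r) s

      InH← : ∀ {x z} → π [ x ]≈ z → InH M z
      InH← r = π , _ , hπ , r

      HC→ : ∀ {z} → HC M z → ∃[ x ] (π [ x ]≈ z × x ≼ ω × x ⊆ M × (∀ ξ → ξ ∈ x → Ordinal ξ))
      HC→ (π′ , x , h′ , r , q) = case proj₁ hπ x (proj₁ (proj₂ h′ x _ r)) of λ (v , s) →
        x , subst (π [ x ]≈_) (Col-unique hπ h′ x (proj₁ (proj₂ h′ x _ r)) v _ s r) s , q

      HC← : ∀ {x z} → π [ x ]≈ z → x ≼ ω → x ⊆ M → (∀ ξ → ξ ∈ x → Ordinal ξ) → HC M z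
      HC← r a b c = π , _ , hπ , r , a , b , c

      Ht→ : ∀ {z} → Ht M z → ∃[ x ] (π [ x ]≈ z × Ordinal x)
      Ht→ (π′ , x , h′ , r , q) = case proj₁ hπ x (proj₁ (proj₂ h′ x _ r)) of λ (v , s) →
        x , subst (π [ x ]≈_) (Col-unique hπ h′ x (proj₁ (proj₂ h′ x _ r)) v _ s r) s , q

      Ht← : ∀ {x z} → π [ x ]≈ z → Ordinal x → Ht M z
      Ht← r q = π , _ , hπ , r , q

    opaque
      HC⇒InH : ∀ {z} → HC M z → InH M z
      HC⇒InH p = case HC→ p of λ (x , r , _) → InH← r

      Ht⇒InH : ∀ {z} → Ht M z → InH M z
      Ht⇒InH p = case Ht→ p of λ (x , r , _) → InH← r

      Ht-below : ∀ {α β} → Ht M α → β ∈ α → Ht M β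
      Ht-below p q = case Ht→ p of λ (x , r , ox) → case to (π-∈ r) q of λ (u , _ , u∈x , s) → Ht← s (Ordinal-∈ ox u∈x)

      -- Order types of M ∩ ORD and heights of the collapse agree.
      orderType⇒Ht : ∀ {o β} → IsOrderType o (λ x → x ∈ M × Ordinal x) _∈_ → β ∈ o → Ht M β
      orderType⇒Ht {o} {β} (oo , f , (prs , tot , _) , typ , surj , iso) β∈o =
        case tot β β∈o of λ (x , r) → Ht← (collapses β β∈o x (ap r)) (proj₂ (typ β x r))
        where
        collapses : ∀ ξ → ξ ∈ o → ∀ x → f [ ξ ]≈ x → π [ x ]≈ ξ
        collapses = ∈-ind o (λ ξ → ∀ x → f [ ξ ]≈ x → π [ x ]≈ ξ) λ ξ ξ∈o ih x r →
          case typ ξ x (pa r) of λ (x∈M , ox) → case proj₁ hπ x x∈M of λ (y , s) → subst (π [ x ]≈_) (⊆-antisym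
            (λ z z∈y → case to (π-∈ s) z∈y of λ (u , u∈M , u∈x , t) → case surj u (u∈M , Ordinal-∈ ox u∈x) of λ (ζ , q) →
              case from (proj₂ (iso ζ ξ u x q (pa r))) u∈x of λ ζ∈ξ →
              subst (_∈ ξ) (π-fun (ih ζ ζ∈ξ (proj₁ oo ξ ξ∈o ζ ζ∈ξ) u (ap q)) t) ζ∈ξ)
            (λ ζ ζ∈ξ → case proj₁ oo ξ ξ∈o ζ ζ∈ξ of λ ζ∈o → case tot ζ ζ∈o of λ (u , q) →
              from (π-∈ s) (u , proj₁ (typ ζ u q) , to (proj₂ (iso ζ ξ u x q (pa r))) ζ∈ξ , ih ζ ζ∈ξ ζ∈o u (ap q)))) s

  opaque
    GIS⇒Col : ∀ {M} → GIS M → ∃[ π ] Col M π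
    GIS⇒Col ((( _ , H , (π , fπ , hπ , _) , _) , _) , _) = π , (λ x p → case proj₁ (proj₂ fπ) x p of λ (y , r) → y , ap r)
      , λ x y r → FunctionOn-dom fπ r , λ z → mk⇔
        (λ p → case to (hπ x y (pa r) z) p of λ (u , q , q′ , s) → u , q , q′ , ap s)
        λ (u , q , q′ , s) → from (hπ x y (pa r) z) (u , q , q′ , pa s)

    -- A set countable in the collapse is countable in V, so it is enough to test the sets `z` that
    -- are countable in V.
    approximation : ∀ {M} → GIS M → ∀ η → InH M η → ∀ A → A ⊆ η →
      (∀ z → InH M z → z ≼ ω → ∃[ w ] (InH M w × IsIntersection w z A)) → InH M A
    approximation {M} g@(((_ , H , (π′ , fπ , hπ , hH) , apx) , _) , _) η hη A A⊆η f with GIS⇒Col g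
    ... | π , hcol = to e (ω₁-Approximation.approx apx η (from e hη) A A⊆η
        λ z z∈H (φ , _ , inj) → case f z (to e z∈H) (Injection⇒≼ inj) of λ (w , hw , i) → w , from e hw , i)
      where
      open Collapse hcol g
      hcol′ : Col M π′
      hcol′ = (λ x p → case proj₁ (proj₂ fπ) x p of λ (y , r) → y , ap r)
        , λ x y r → FunctionOn-dom fπ r , λ z → mk⇔
          (λ p → case to (hπ x y (pa r) z) p of λ (u , q , q′ , s) → u , q , q′ , ap s)
          λ (u , q , q′ , s) → from (hπ x y (pa r) z) (u , q , q′ , pa s)
      e : ∀ {z} → z ∈ H ⇔ InH M z
      e {z} = mk⇔ (λ p → case to (hH z) p of λ (u , r) → Collapse.InH← hcol′ g (ap r))
        λ p → case Collapse.InH→ hcol′ g p of λ (u , r) → from (hH z) (u , pa r)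

    GIS⇒ω₁∈H : ∀ {M} → GIS M → InH M ω₁
    GIS⇒ω₁∈H {M} g@(((_ , H , (π′ , fπ , hπ , hH) , apx) , _) , _) = case to (hH ω₁) (ω₁-Approximation.ω₁∈H apx) of λ (u , r) →
      Collapse.InH← {M} {π′} ((λ x p → case proj₁ (proj₂ fπ) x p of λ (y , r) → y , ap r)
        , λ x y r → FunctionOn-dom fπ r , λ z → mk⇔
          (λ p → case to (hπ x y (pa r) z) p of λ (u , q , q′ , s) → u , q , q′ , ap s)
          λ (u , q , q′ , s) → from (hπ x y (pa r) z) (u , q , q′ , pa s)) g (ap r)

  -- Coding countable subsets of ω₁ by ordinals below ω₂

  record Coding : Set ℓ where
    field
      b q wr F₁ : V
      b-tot    : ∀[ ρ ∈ ω₁ ] ∃[ f ] (b [ ρ ]≈ f)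
      b-fun    : ∀ {ρ f f′} → b [ ρ ]≈ f → b [ ρ ]≈ f′ → f ≡ f′
      b-inj    : ∀ ρ f → b [ ρ ]≈ f → (∀[ ζ ∈ ρ ] ∃[ k ∈ ω ] f [ ζ ]≈ k) × (∀ ζ ζ′ k → f [ ζ ]≈ k → f [ ζ′ ]≈ k → ζ ≡ ζ′)
      hq       : ∀ r → r ∈ q ⇔ r ⊆ ω
      fw       : Fn q F₁ wr
      w-piece  : ∀ z → z ∈ F₁ → ∃[ α ∈ ω₂ ] ∃[ i ∈ ω₁ ] IsPiece z α i
      w-inj    : ∀ r r′ z → wr [ r ]≈ z → wr [ r′ ]≈ z → r ≡ r′

  opaque
    -- The family of all pieces captures every piece of every α, so `continuum` injects the reals
    -- into pieces. A piece is given by a pair in ω₂ × ω₁, whence the bound ω₂.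
    ∃Coding : SRP[ω₂] → Coding
    ∃Coding srp = case powerSet ω₂ of λ (u , hu) → case sep u (λ z → ∃[ α ∈ ω₂ ] ∃[ i ∈ ω₁ ] IsPiece z α i) of λ (F₁ , hF₁) →
      case continuum srp F₁ (λ α α∈ω₂ _ → Meets-⊆ (λ i i∈ω₁ _ → case sep α (λ ξ → ∃[ j ∈ i ] E α ξ j) of λ (s , hs) →
        let e : IsPiece s α i
            e ξ = mk⇔ (λ p → proj₂ (to (hs ξ) p)) λ (j , p , r) → from (hs ξ) (proj₁ (proj₂ (E-dom r)) , j , p , r)
        in s , from (hF₁ s) (from (hu s) (λ ξ p → ∈ω₂⇒⊆ω₂ α∈ω₂ ξ (proj₁ (to (hs ξ) p))) , α , α∈ω₂ , i , i∈ω₁ , e) , e) ω₁-Meets) of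
        λ (_ , _ , q , w , hq , fw , _ , inj) →
      case prod ω₁ ω of λ (c , hc) → case powerSet c of λ (v , hv) →
      case choose ω₁ v (λ ρ f → (∀[ ζ ∈ ρ ] ∃[ k ∈ ω ] f [ ζ ]≈ k) × (∀ ζ ζ′ k → f [ ζ ]≈ k → f [ ζ′ ]≈ k → ζ ≡ ζ′))
        (λ ρ ρ∈ω₁ → case ≼-injects (∈ω₁⇒countable ρ ρ∈ω₁) of λ (f , ff , jf) → f
          , from (hv f) (λ p p∈f → case Fn.prs ff p p∈f of λ (x , x∈ρ , y , y∈ω , r) → from (hc p) (x , proj₁ Ordinal-ω₁ ρ ρ∈ω₁ x x∈ρ , y , y∈ω , r))
          , (λ ζ p → case Fn.tot ff ζ p of λ (k , r) → k , Fn.cod ff r , r) , jf) of λ (b , fb , hb) →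
      record { b = b ; q = q ; wr = w ; F₁ = F₁ ; b-tot = Fn.tot fb ; b-fun = Fn.fun fb ; b-inj = hb ; hq = hq ; fw = fw
             ; w-piece = λ z p → proj₂ (to (hF₁ z) p) ; w-inj = inj }

  module Reals (cd : Coding) where
    open Coding cd

    RealCode : V → V → V → Set ℓ
    RealCode ρ r c = c ⊆ ρ × (∀ k → k ∈ r ⇔ (k ∈ ω × ∃[ ζ ∈ c ] ∃[ f ] (b [ ρ ]≈ f × f [ ζ ]≈ k)))

    -- The set `c` is coded by a real and the real by the i-th piece of α. As `i` and ρ are below
    -- ω₁, they lie in almost all M; α alone decides whether M can decode.
    PairCode : V → V → V → V → Set ℓ
    PairCode α i ρ c = ∃[ r ] (RealCode ρ r c × ∃[ z ] (wr [ r ]≈ z × IsPiece z α i))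

    CountablePart : V → Set ℓ
    CountablePart c = c ⊆ ω₁ × c ≼ ω

    opaque

      RealCode-injective : ∀ {ρ r c c′} → ρ ∈ ω₁ → RealCode ρ r c → RealCode ρ r c′ → c ≡ c′
      RealCode-injective {ρ} {r} p h h′ = ⊆-antisym (half p h h′) (half p h′ h)
        where
        half : ∀ {ρ r c c′} → ρ ∈ ω₁ → RealCode ρ r c → RealCode ρ r c′ → c ⊆ c′
        half {ρ} {c′ = c′} p (c⊆ρ , e) (_ , e′) ζ ζ∈c = case b-tot ρ p of λ (f , s) → case proj₁ (b-inj ρ f s) ζ (c⊆ρ ζ ζ∈c) of
          λ (k , k∈ω , t) → case to (e′ k) (from (e k) (k∈ω , ζ , ζ∈c , f , s , t)) of λ { (_ , ζ′ , ζ′∈c′ , f′ , s′ , t′) →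
          case b-fun s s′ of λ { refl → subst (_∈ c′) (proj₂ (b-inj ρ f s) _ _ _ t′ t) ζ′∈c′ } }

      real : ∀ {ρ c} → ρ ∈ ω₁ → c ⊆ ρ → ∃[ r ∈ q ] RealCode ρ r c
      real {ρ} {c} p c⊆ρ = case sep ω (λ k → ∃[ ζ ∈ c ] ∃[ f ] (b [ ρ ]≈ f × f [ ζ ]≈ k)) of λ (r , hr) →
        r , from (hq r) (λ k s → proj₁ (to (hr k) s)) , c⊆ρ , hr

      IsPiece-unique : ∀ {z z′ α i} → IsPiece z α i → IsPiece z′ α i → z ≡ z′
      IsPiece-unique = IsSetOf-unique

      PairCode-injective : ∀ {α i ρ c c′} → ρ ∈ ω₁ → PairCode α i ρ c → PairCode α i ρ c′ → c ≡ c′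
      PairCode-injective p (r , e , z , s , h) (r′ , e′ , z′ , s′ , h′) = case IsPiece-unique h h′ of λ
        { refl → case w-inj r r′ z s s′ of λ { refl → RealCode-injective p e e′ } }

      pairCode : ∀ {c} → CountablePart c → ∃[ α ∈ ω₂ ] ∃[ i ∈ ω₁ ] ∃[ ρ ∈ ω₁ ] PairCode α i ρ c
      pairCode (s , cc) = case ω₁-bounded cc s of λ (ρ , ρ∈ω₁ , c⊆ρ) → case real ρ∈ω₁ c⊆ρ of λ (r , r∈q , e) →
        case Fn.tot fw r r∈q of λ (z , t) → case w-piece z (Fn.cod fw t) of λ (α , α∈ω₂ , i , i∈ω₁ , h) →
        α , α∈ω₂ , i , i∈ω₁ , ρ , ρ∈ω₁ , r , e , z , t , h

      ⊆∈ω₁⇒∈h : ∀ {ρ c} → ρ ∈ ω₁ → c ⊆ ρ → c ∈ h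
      ⊆∈ω₁⇒∈h p s = H₂⊆h _ (⊆ω₁⇒∈H₂ λ x t → proj₁ Ordinal-ω₁ _ p x (s x t))

      -- A set that is unique for each ρ < ω₁ lies in almost all M.
      𝔸-family : (R : V → V → Set ℓ) → Def₂ R → (∀ {ρ c} → ρ ∈ ω₁ → R ρ c → c ∈ h) → (∀ {ρ c c′} → ρ ∈ ω₁ → R ρ c → R ρ c′ → c ≡ c′) →
                 𝔸 (λ M → ∀[ ρ ∈ ω₁ ] ∀ c → R ρ c → c ∈ M)
      𝔸-family R d k u = Small-family ω₁-Small R {{d}} λ ρ p → case em {∃[ c ] R ρ c} of λ
        { (yes (c , r)) → 𝔸-map (λ M _ c∈M c′ r′ → subst (_∈ M) (u p r r′) c∈M) (𝔸-fine (k p r))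
        ; (no none) → 𝔸-all λ M _ c r → ⊥-elim (none (c , r)) }

      𝔸-RealCode : 𝔸 (λ M → ∀[ r ∈ M ] ∀[ ρ ∈ ω₁ ] ∀ c → RealCode ρ r c → c ∈ M)
      𝔸-RealCode = 𝔸-diag (λ r M → ∀[ ρ ∈ ω₁ ] ∀ c → RealCode ρ r c → c ∈ M) {{d}} λ r _ →
        𝔸-family (λ ρ c → RealCode ρ r c) auto (λ p (s , _) → ⊆∈ω₁⇒∈h p s) RealCode-injective
        where
        d : Def₂ (λ r M → ∀[ ρ ∈ ω₁ ] ∀ c → RealCode ρ r c → c ∈ M)
        d = auto

      𝔸-decode : 𝔸 (λ M → ∀[ α ∈ M ] ∀[ i ∈ ω₁ ] ∀[ ρ ∈ ω₁ ] ∀ c → PairCode α i ρ c → c ∈ M)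
      𝔸-decode = 𝔸-diag (λ α M → ∀[ i ∈ ω₁ ] ∀[ ρ ∈ ω₁ ] ∀ c → PairCode α i ρ c → c ∈ M) {{d}} λ α _ →
        𝔸-map (λ M _ f i i∈ρ ρ ρ∈ω₁ c r → f i i∈ρ c (ρ , ρ∈ω₁ , r))
          (Small-family ω₁-Small (λ i c → ∃[ ρ ∈ ω₁ ] PairCode α i ρ c) λ i _ →
            𝔸-map (λ M _ f c (ρ , ρ∈ω₁ , r) → f ρ ρ∈ω₁ c r)
              (𝔸-family (PairCode α i) auto (λ p (_ , (s , _) , _) → ⊆∈ω₁⇒∈h p s) PairCode-injective))
        where
        d : Def₂ (λ α M → ∀[ i ∈ ω₁ ] ∀[ ρ ∈ ω₁ ] ∀ c → PairCode α i ρ c → c ∈ M)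
        d = auto

      𝔸-encode : 𝔸 (λ M → ∀[ c ∈ M ] (CountablePart c → ∃[ α ∈ M ] (α ∈ ω₂ × ∃[ i ∈ ω₁ ] ∃[ ρ ∈ ω₁ ] PairCode α i ρ c)))
      𝔸-encode = 𝔸-map
        (λ M p f c c∈M k → f c c∈M (case pairCode k of λ (α , α∈ω₂ , r) → α , ω₂⊆h α α∈ω₂ , α∈ω₂ , r))
        (𝔸-clos (λ c α → α ∈ ω₂ × ∃[ i ∈ ω₁ ] ∃[ ρ ∈ ω₁ ] PairCode α i ρ c))

  -- Moving countable sets between collapses

  OrdSet : V → Set ℓ
  OrdSet x = x ≼ ω × (∀ ξ → ξ ∈ x → Ordinal ξ)

  -- The part of `B` in a countable set `x` of ordinals is compressed to a subset of the order type
  -- of `x`, where it can be coded by a real.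
  Encode : V → V → V → Set ℓ
  Encode x B c = ∃[ f ] (Col x f × (∀ v → v ∈ c ⇔ (∃[ ξ ∈ x ] (ξ ∈ B × f [ ξ ]≈ v))))

  Decode : V → V → V → Set ℓ
  Decode x c y = ∃[ f ] (Col x f × (∀ ξ → ξ ∈ y ⇔ (ξ ∈ x × ∃[ v ∈ c ] f [ ξ ]≈ v)))

  opaque
    def-Encode : Def₃ Encode
    def-Encode = auto

    def-Decode : Def₃ Decode
    def-Decode = auto

    Encode-countable : ∀ {x B c} → OrdSet x → Encode x B c → c ⊆ ω₁ × c ≼ ω
    Encode-countable {x} {B} {c} (cx , ox) (f , hf , hc) = case col x ox of λ (g , _ , hg , og , _) →
      (λ v v∈c → case to (hc v) v∈c of λ (ξ , ξ∈x , _ , r) → case proj₁ hg ξ ξ∈x of λ (v′ , r′) →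
        countable⇒∈ω₁ (subst Ordinal (Col-unique hg hf ξ ξ∈x v′ v r′ r) (proj₁ (og ξ v′ r′)))
          (≼-trans (≼-rel v x (λ z ζ → f [ ζ ]≈ z) (λ z z∈v → case to (proj₂ (proj₂ hf ξ v r) z) z∈v of λ (ζ , ζ∈x , _ , s) → ζ , ζ∈x , s)
            λ _ _ _ _ _ → Col-fun hf) cx))
      , ≼-trans (≼-rel c x (λ v ξ → f [ ξ ]≈ v) (λ v v∈c → case to (hc v) v∈c of λ (ξ , ξ∈x , _ , r) → ξ , ξ∈x , r)
          λ _ _ _ _ _ → Col-fun hf) cx

    encode : ∀ {x} B → OrdSet x → ∃[ c ∈ h ] Encode x B c
    encode {x} B (cx , ox) = case col x ox of λ (f , ρ , hf , _ , hρ) → case sep ρ (λ v → ∃[ ξ ∈ x ] (ξ ∈ B × f [ ξ ]≈ v)) of λ (c , hc) →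
      let k : Encode x B c
          k = f , hf , λ v → mk⇔ (λ p → proj₂ (to (hc v) p)) λ (ξ , p , q , r) → from (hc v) (from (hρ v) (ξ , r) , ξ , p , q , r)
      in c , H₂⊆h c (⊆ω₁⇒∈H₂ (proj₁ (Encode-countable (cx , ox) k))) , k

    decode : ∀ {x} c → x ∈ h → OrdSet x → ∃[ y ∈ h ] Decode x c y
    decode {x} c x∈h (cx , ox) = case col x ox of λ (f , _ , hf , _) → case sep x (λ ξ → ∃[ v ∈ c ] f [ ξ ]≈ v) of λ (y , hy) →
      y , h-⊆ x∈h (λ ξ p → proj₁ (to (hy ξ) p)) , f , hf , hy

  module Agreement (cd : Coding) where
    open Reals cd

    record Nice (M : V) : Set ℓ where
      field
        isGood : Good M
        π      : V
        hπ     : Col M π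
        int    : ∀[ x ∈ M ] ∀[ y ∈ M ] ∃[ z ∈ M ] IsIntersection z x y
        cod    : ∀[ x ∈ M ] ∀[ B ∈ M ] (OrdSet x → ∃[ c ∈ M ] Encode x B c)
        dec    : ∀[ x ∈ M ] ∀[ c ∈ M ] (OrdSet x → ∃[ y ∈ M ] Decode x c y)
        renc   : ∀[ c ∈ M ] (CountablePart c → ∃[ α ∈ M ] (α ∈ ω₂ × ∃[ i ∈ ω₁ ] ∃[ ρ ∈ ω₁ ] PairCode α i ρ c))
        rdec   : ∀[ α ∈ M ] ∀[ i ∈ ω₁ ] ∀[ ρ ∈ ω₁ ] ∀ c → PairCode α i ρ c → c ∈ M
      open Good isGood public
      open Collapse hπ gis public

    opaque
      𝔸-Nice : 𝔸 Nice
      𝔸-Nice = 𝔸-map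
        (λ M M∈Z (g , i , c , d , e , f) → let hπ = GIS⇒Col (Good.gis g) in record
          { isGood = g ; π = proj₁ hπ ; hπ = proj₂ hπ
          ; int = λ x p y q → i x p y q (case sep x (_∈ y) of λ (z , hz) → z , h-⊆ (⊆h M∈Z x p) (λ v r → proj₁ (to (hz v) r)) , hz)
          ; cod = λ x p B q o → c x p B q (encode B o)
          ; dec = λ x p b q o → d x p b q (decode b (⊆h M∈Z x p) o)
          ; renc = e ; rdec = f })
        (𝔸-∧ 𝔸-Good (𝔸-∧ (𝔸-clos₂ (λ x y z → IsIntersection z x y)) (𝔸-∧ (𝔸-clos₂ Encode {{def-Encode}})
          (𝔸-∧ (𝔸-clos₂ Decode {{def-Decode}}) (𝔸-∧ 𝔸-encode 𝔸-decode)))))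

    module Single {M : V} (nice : Nice M) where
      open Nice nice

      opaque
        image : ∀ {x} → x ∈ M → ∃[ v ] (π [ x ]≈ v)
        image p = proj₁ hπ _ p

        InH-∩ : ∀ {a c} → InH M a → InH M c → ∃[ e ] (InH M e × IsIntersection e a c)
        InH-∩ p q = case InH→ p of λ (x , r) → case InH→ q of λ (y , s) → case int x (π-dom r) y (π-dom s) of λ (z , z∈M , hz) →
          case image z∈M of λ (e , t) → e , InH← t , λ v → mk⇔
            (λ v∈e → case to (π-∈ t) v∈e of λ (u , u∈M , u∈z , k) → case to (hz u) u∈z of λ (u∈x , u∈y) →
              π-preserves k r u∈x , π-preserves k s u∈y)
            λ (v∈a , v∈c) → case to (π-∈ r) v∈a of λ (u , u∈M , u∈x , k) → π-preserves k t (from (hz u) (u∈x , π-reflects k s v∈c))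

        HC-⊆ : ∀ {s s′} → InH M s → HC M s′ → s ⊆ s′ → HC M s
        HC-⊆ {s} p q s⊆s′ = case InH→ p of λ (x , r) → case HC→ q of λ (x′ , r′ , cx′ , x′⊆M , ox′) →
          case int x (π-dom r) x′ (π-dom r′) of λ (z , z∈M , hz) → case image z∈M of λ (e , t) →
          let z⊆x′ : z ⊆ x′
              z⊆x′ v p = proj₂ (to (hz v) p)
              e≡s : e ≡ s
              e≡s = ⊆-antisym
                (λ v v∈e → case to (π-∈ t) v∈e of λ (u , _ , u∈z , k) → π-preserves k r (proj₁ (to (hz u) u∈z)))
                (λ v v∈s → case to (π-∈ r) v∈s of λ (u , _ , u∈x , k) →
                  π-preserves k t (from (hz u) (u∈x , π-reflects k r′ (s⊆s′ v v∈s))))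
          in HC← (subst (π [ z ]≈_) e≡s t) (≼-trans (⊆⇒≼ z⊆x′) cx′) (λ v p → x′⊆M v (z⊆x′ v p)) λ ξ p → ox′ ξ (z⊆x′ ξ p)

    module Double {M M′ κ : V} (nice : Nice M) (nice′ : Nice M′) (hκ : IsIntersection κ M ω₂) (hκ′ : IsIntersection κ M′ ω₂) where
      private
        module N = Nice nice
        module N′ = Nice nice′

      opaque
        -- The coding ordinal α is in M ∩ ω₂, which equals M′ ∩ ω₂, and M′ can decode it.
        real-transfer : ∀ {c} → c ∈ M → CountablePart c → c ∈ M′
        real-transfer {c} p q = case N.renc c p q of λ (α , α∈M , α∈ω₂ , i , i∈ω₁ , ρ , ρ∈ω₁ , k) →
          N′.rdec α (proj₁ (to (hκ′ α) (from (hκ α) (α∈M , α∈ω₂)))) i i∈ω₁ ρ ρ∈ω₁ c k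

        -- Countable sets of ordinals with the same image in both collapses have the same collapse.
        same-collapse : ∀ {x x′ s f f′} → N.π [ x ]≈ s → N′.π [ x′ ]≈ s → x ⊆ M → x′ ⊆ M′ → Col x f → Col x′ f′ →
          ∀ ξ → ξ ∈ x → ∀ ξ′ v a a′ → ξ′ ∈ x′ → N.π [ ξ ]≈ v → N′.π [ ξ′ ]≈ v → f [ ξ ]≈ a → f′ [ ξ′ ]≈ a′ → a ≡ a′
        same-collapse {x} {x′} {s} {f} {f′} r r′ x⊆M x′⊆M′ hf hf′ = ∈-ind x
          (λ ξ → ∀ ξ′ v a a′ → ξ′ ∈ x′ → N.π [ ξ ]≈ v → N′.π [ ξ′ ]≈ v → f [ ξ ]≈ a → f′ [ ξ′ ]≈ a′ → a ≡ a′)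
          λ ξ ξ∈x ih ξ′ v a a′ ξ′∈x′ t t′ k k′ → ⊆-antisym
            (λ z z∈a → case to (proj₂ (proj₂ hf ξ a k) z) z∈a of λ (ζ , ζ∈x , ζ∈ξ , m) → case proj₁ N.hπ ζ (x⊆M ζ ζ∈x) of λ (u , tu) →
              case to (N′.π-∈ r′) (N.π-preserves tu r ζ∈x) of λ (ζ′ , _ , ζ′∈x′ , tu′) → case proj₁ hf′ ζ′ ζ′∈x′ of λ (z′ , m′) →
              case ih ζ ζ∈ξ ζ∈x ζ′ u z z′ ζ′∈x′ tu tu′ m m′ of λ { refl →
                Col-mono hf′ k′ m′ (N′.π-reflects tu′ t′ (N.π-preserves tu t ζ∈ξ)) })
            (λ z z∈a′ → case to (proj₂ (proj₂ hf′ ξ′ a′ k′) z) z∈a′ of λ (ζ′ , ζ′∈x′ , ζ′∈ξ′ , m′) →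
              case proj₁ N′.hπ ζ′ (x′⊆M′ ζ′ ζ′∈x′) of λ (u , tu′) →
              case to (N.π-∈ r) (N′.π-preserves tu′ r′ ζ′∈x′) of λ (ζ , _ , ζ∈x , tu) → case proj₁ hf ζ ζ∈x of λ (z₁ , m) →
              let ζ∈ξ = N.π-reflects tu t (N′.π-preserves tu′ t′ ζ′∈ξ′) in
              case ih ζ ζ∈ξ ζ∈x ζ′ u z₁ z ζ′∈x′ tu tu′ m m′ of λ { refl → Col-mono hf k m ζ∈ξ })

        -- The preimages of `s` in the two models have the same order type. So the compressed form
        -- of the part of `s` in `A`, once moved to M′, decodes there to a preimage of s ∩ A.
        transfer : ∀ {s A} → HC M s → HC M′ s → InH M A → ∃[ t ] (InH M′ t × IsIntersection t s A)
        transfer {s} {A} p p′ q = case N.HC→ p of λ (x , r , cx , x⊆M , ox) → case N′.HC→ p′ of λ (x′ , r′ , cx′ , x′⊆M′ , ox′) →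
          case N.InH→ q of λ (B , rB) → case N.cod x (N.π-dom r) B (N.π-dom rB) (cx , ox) of λ (c , c∈M , kc) →
          case N′.dec x′ (N′.π-dom r′) c (real-transfer c∈M (Encode-countable (cx , ox) kc)) (cx′ , ox′) of λ (y , y∈M′ , kd) →
          finish r r′ x⊆M x′⊆M′ ox rB kc y∈M′ kd
          where
          finish : ∀ {x x′ B c y} → N.π [ x ]≈ s → N′.π [ x′ ]≈ s → x ⊆ M → x′ ⊆ M′ → (∀ ξ → ξ ∈ x → Ordinal ξ) → N.π [ B ]≈ A →
            Encode x B c → y ∈ M′ → Decode x′ c y → ∃[ t ] (InH M′ t × IsIntersection t s A)
          finish {x} {x′} {B} {c} {y} r r′ x⊆M x′⊆M′ ox rB (f , hf , hc) y∈M′ (f′ , hf′ , hy) = case proj₁ N′.hπ y y∈M′ of λ (t , rt) →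
            t , N′.InH← rt , λ v → mk⇔
              (λ v∈t → case to (N′.π-∈ rt) v∈t of λ (ξ′ , _ , ξ′∈y , m′) → case to (hy ξ′) ξ′∈y of λ { (ξ′∈x′ , a , a∈c , k′) →
                case to (hc a) a∈c of λ { (ξ₁ , ξ₁∈x , ξ₁∈B , k₁) → let v∈s = N′.π-preserves m′ r′ ξ′∈x′ in
                case to (N.π-∈ r) v∈s of λ { (ξ , _ , ξ∈x , m) → case proj₁ hf ξ ξ∈x of λ { (a₁ , k) →
                case same-collapse r r′ x⊆M x′⊆M′ hf hf′ ξ ξ∈x ξ′ v a₁ a ξ′∈x′ m m′ k k′ of λ { refl →
                case Col-inj ox hf k k₁ of λ { refl → v∈s , N.π-preserves m rB ξ₁∈B } } } } } })
              λ (v∈s , v∈A) → case to (N.π-∈ r) v∈s of λ (ξ , _ , ξ∈x , m) → case to (N′.π-∈ r′) v∈s of λ (ξ′ , _ , ξ′∈x′ , m′) →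
                case proj₁ hf ξ ξ∈x of λ (a , k) → case proj₁ hf′ ξ′ ξ′∈x′ of λ (a′ , k′) →
                case same-collapse r r′ x⊆M x′⊆M′ hf hf′ ξ ξ∈x ξ′ v a a′ ξ′∈x′ m m′ k k′ of λ { refl →
                  N′.π-preserves m′ rt (from (hy ξ′) (ξ′∈x′ , a , from (hc a) (ξ , ξ∈x , N.π-reflects m rB v∈A , k) , k′)) }

        -- For `z` countable in the collapse of M′, a late common piece `s` includes z ∩ γ, so z ∩ A
        -- = z ∩ (s ∩ A), where s ∩ A comes from `transfer`.
        agree : ∀ {γ} → γ ∈ ω₂ → InH M′ γ → (∀ b → b ∈ ω₁ → ∃[ i ∈ ω₁ ] (b ∈ i × ∃[ s ] (IsPiece s γ i × HC M s × HC M′ s))) →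
                ∀ A → A ⊆ γ → InH M A → InH M′ A
        agree {γ} γ∈ω₂ γ∈H′ common A A⊆γ p = approximation N′.gis γ γ∈H′ A A⊆γ λ z z∈H′ cz →
          case sep z (_∈ γ) of λ (z₀ , hz₀) →
          case ω₁-bound z₀ (≼-trans (⊆⇒≼ λ v q → proj₁ (to (hz₀ v) q)) cz) (E γ)
            (λ v q → E-tot γ∈ω₂ (proj₂ (to (hz₀ v) q))) of λ (b , b∈ω₁ , hb) →
          case common b b∈ω₁ of λ (i , i∈ω₁ , b∈i , s , hs , c , c′) → case transfer c c′ p of λ (t , t∈H′ , ht) →
          case Single.InH-∩ nice′ z∈H′ t∈H′ of λ (w , w∈H′ , hw) → w , w∈H′ , λ v → mk⇔
            (λ v∈w → case to (hw v) v∈w of λ (v∈z , v∈t) → v∈z , proj₂ (to (ht v) v∈t))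
            λ (v∈z , v∈A) → case hb v (from (hz₀ v) (v∈z , A⊆γ v v∈A)) of λ (j , j∈b , e) →
              from (hw v) (v∈z , from (ht v) (from (hs v) (j , proj₁ (∈ω₁-Ordinal i∈ω₁) b b∈i j j∈b , e) , v∈A))

  -- Internal stationarity: countable pieces that are elements of M

  record Enumeration (M m : V) : Set ℓ where
    field
      m-tot  : ∀[ x ∈ M ] ∃[ j ∈ ω₁ ] m [ x ]≈ j
      m-dom  : ∀ {x j} → m [ x ]≈ j → x ∈ M
      m-fun  : ∀ {x j j′} → m [ x ]≈ j → m [ x ]≈ j′ → j ≡ j′
      m-inj  : ∀ {x x′ j} → m [ x ]≈ j → m [ x′ ]≈ j → x ≡ x′
      m-surj : ∀[ j ∈ ω₁ ] ∃[ x ] m [ x ]≈ j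

  opaque
    enumerate : ∀ {M} → GIS M → ∃[ m ] Enumeration M m
    enumerate ((_ , (m , (((prs , tot , fun) , cod′) , inj) , surj) , _) , _) = m , record
      { m-tot = λ x p → case tot x p of λ (j , r) → j , cod′ x j r , ap r
      ; m-dom = FunctionOn-dom (prs , tot , fun)
      ; m-fun = λ r r′ → fun _ _ _ (pa r) (pa r′)
      ; m-inj = λ r r′ → inj _ _ _ (pa r) (pa r′)
      ; m-surj = λ j p → case surj j p of λ (x , r) → x , ap r }

  module InternalPieces {M m : V} (gis : GIS M) (en : Enumeration M m)
                        (q : V) (q-tot : ∀[ j ∈ ω₁ ] ∃[ k ∈ ω₁ ] q [ j ]≈ k) where
    open Enumeration en

    ClosedPoint : V → Set ℓ
    ClosedPoint i = (∃[ j ] j ∈ i) × (∀[ j ∈ i ] ∃[ k ∈ i ] q [ j ]≈ k)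

    PieceOf : V → V → Set ℓ
    PieceOf Y i = ClosedPoint i × (∀ x → x ∈ Y ⇔ (x ∈ M × ∃[ j ∈ i ] m [ x ]≈ j))

    opaque

      PieceOf-injective : ∀ {Y i i′} → i ∈ ω₁ → PieceOf Y i → PieceOf Y i′ → i ⊆ i′
      PieceOf-injective {i′ = i′} i∈ω₁ (_ , e) (_ , e′) j j∈i = case m-surj j (proj₁ Ordinal-ω₁ _ i∈ω₁ j j∈i) of λ (x , r) →
        case to (e′ x) (from (e x) (m-dom r , j , j∈i , r)) of λ (_ , j′ , j′∈i′ , r′) → subst (_∈ i′) (m-fun r′ r) j′∈i′

      PieceOf-countable : ∀ {Y i} → i ∈ ω₁ → PieceOf Y i → Y ≼ ω
      PieceOf-countable {Y} {i} i∈ω₁ (_ , e) = ≼-trans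
        (≼-rel Y i (λ x j → m [ x ]≈ j) (λ x p → proj₂ (to (e x) p)) λ _ _ _ _ _ → m-inj) (∈ω₁⇒countable i i∈ω₁)

      def-Index : ∀ D → Def₁ (λ i → ∃[ Y ∈ D ] PieceOf Y i)
      def-Index D = auto

      def-HasIndex : Def₁ (λ Y → ∃[ i ∈ ω₁ ] PieceOf Y i)
      def-HasIndex = auto

      def-PieceOf⁻ : Def₂ (λ i Y → PieceOf Y i)
      def-PieceOf⁻ = auto

      index-∈ω₁ : ∀ {D J i} → D ≼ ω → (∀ j → j ∈ J ⇔ (j ∈ ω₁ × ∃[ Y ∈ D ] PieceOf Y j)) → IsUnion i J → i ∈ ω₁
      index-∈ω₁ {D} {J} cD hJ hi = countable⇒∈ω₁ (Ordinal-⋃ (λ j p → ∈ω₁-Ordinal (proj₁ (to (hJ j) p))) hi)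
        (⋃-countable (≼-trans (≼-rel J D (λ j Y → PieceOf Y j) {{def-PieceOf⁻}} (λ j p → proj₂ (to (hJ j) p))
            λ j j′ Y p p′ s s′ → ⊆-antisym (PieceOf-injective (proj₁ (to (hJ j) p)) s s′) (PieceOf-injective (proj₁ (to (hJ j′) p′)) s′ s)) cD)
          (λ j p → ∈ω₁⇒countable j (proj₁ (to (hJ j) p))) hi)

      index-closed : ∀ {D J i} → (∃[ Y ] Y ∈ D) → (∀ Y → Y ∈ D → ∃[ i ∈ ω₁ ] PieceOf Y i) →
        (∀ j → j ∈ J ⇔ (j ∈ ω₁ × ∃[ Y ∈ D ] PieceOf Y j)) → IsUnion i J → ClosedPoint i
      index-closed (Y₀ , Y₀∈D) h hJ hi =
        (case h Y₀ Y₀∈D of λ (i₀ , p , s) → case proj₁ (proj₁ s) of λ (j , q) → j , from (hi j) (i₀ , from (hJ i₀) (p , Y₀ , Y₀∈D , s) , q))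
        , λ j j∈i → case to (hi j) j∈i of λ (i₁ , i₁∈J , j∈i₁) → case to (hJ i₁) i₁∈J of λ (_ , _ , _ , s) →
            case proj₂ (proj₁ s) j j∈i₁ of λ (k , k∈i₁ , r) → k , from (hi k) (i₁ , i₁∈J , k∈i₁) , r

      index-piece : ∀ {D J i u} → (∀ Y → Y ∈ D → ∃[ i ∈ ω₁ ] PieceOf Y i) → (∀ j → j ∈ J ⇔ (j ∈ ω₁ × ∃[ Y ∈ D ] PieceOf Y j)) →
        IsUnion i J → IsUnion u D → ∀ x → x ∈ u ⇔ (x ∈ M × ∃[ j ∈ i ] m [ x ]≈ j)
      index-piece h hJ hi hu x = mk⇔
        (λ p → case to (hu x) p of λ (Y , Y∈D , x∈Y) → case h Y Y∈D of λ (i₁ , i₁∈ω₁ , s) → case to (proj₂ s x) x∈Y of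
          λ (x∈M , j , j∈i₁ , r) → x∈M , j , from (hi j) (i₁ , from (hJ i₁) (i₁∈ω₁ , Y , Y∈D , s) , j∈i₁) , r)
        λ (x∈M , j , j∈i , r) → case to (hi j) j∈i of λ (i₁ , i₁∈J , j∈i₁) → case to (hJ i₁) i₁∈J of λ (_ , Y , Y∈D , s) →
          from (hu x) (Y , Y∈D , from (proj₂ s x) (x∈M , j , j∈i₁ , r))

      union-piece : ∀ {D u} → D ≼ ω → (∃[ Y ] Y ∈ D) → (∀ Y → Y ∈ D → ∃[ i ∈ ω₁ ] PieceOf Y i) → IsUnion u D →
                    ∃[ i ∈ ω₁ ] PieceOf u i
      union-piece {D} cD ne h hu with sep ω₁ (λ i → ∃[ Y ∈ D ] PieceOf Y i) {{def-Index D}}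
      ... | J , hJ with ⋃ J
      ... | i , hi = i , index-∈ω₁ cD hJ hi , index-closed ne h hJ hi , index-piece h hJ hi hu

      piece-above : ∀ {y} → y ⊆ M → y ≼ ω → ∃[ Y ] ((∃[ i ∈ ω₁ ] PieceOf Y i) × y ⊆ Y × Y ⊆ M)
      piece-above {y} y⊆M cy = case ω₁-bound y cy (λ x j → m [ x ]≈ j) (λ x p → m-tot x (y⊆M x p)) of λ (b , b∈ω₁ , hb) →
        case ω₁-closed-point q q-tot b b∈ω₁ of λ (i , i∈ω₁ , b∈i , c) → case sep M (λ x → ∃[ j ∈ i ] m [ x ]≈ j) of λ (Y , hY) →
        Y , (i , i∈ω₁ , ((b , b∈i) , c) , hY)
          , (λ x p → case hb x p of λ (j , j∈b , r) → from (hY x) (y⊆M x p , j , proj₁ (∈ω₁-Ordinal i∈ω₁) b b∈i j j∈b , r))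
          , λ x p → proj₁ (to (hY x) p)

      -- The pieces of M at closed points of `q` form a club in the countable subsets of M.
      internal-piece : ∃[ i ∈ ω₁ ] ∃[ Y ∈ M ] PieceOf Y i
      internal-piece = case powerSet M of λ (u , hu) →
        case sep u (λ Y → ∃[ i ∈ ω₁ ] PieceOf Y i) {{def-HasIndex}} of λ (C , hC) →
        case proj₂ (proj₂ (proj₂ (proj₂ gis))) C (record
          { subset = λ Y p → case to (hC Y) p of λ (a , i , i∈ω₁ , s) → to (hu Y) a , ≼⇒Countable (PieceOf-countable i∈ω₁ s)
          ; cofinal = λ y (y⊆M , cy) → case piece-above y⊆M (Countable⇒≼ cy) of λ (Y , s , y⊆Y , Y⊆M) →
              Y , from (hC Y) (from (hu Y) Y⊆M , s) , y⊆Y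
          ; closed = λ D D⊆C cD ne _ v hv → from (hC v)
              ( from (hu v) (λ x p → case to (hv x) p of λ (Y , Y∈D , x∈Y) → to (hu Y) (proj₁ (to (hC Y) (D⊆C Y Y∈D))) x x∈Y)
              , union-piece (Countable⇒≼ cD) ne (λ Y p → proj₂ (to (hC Y) (D⊆C Y p))) hv) }) of λ (Y , Y∈C , Y∈M , _) →
        case to (hC Y) Y∈C of λ (_ , i , i∈ω₁ , s) → i , i∈ω₁ , Y , Y∈M , s

  -- Pieces of α in the collapse

  module Trace (cd : Coding) where
    open Agreement cd public

    module _ {M α : V} (nice : Nice M) (α∈ω₂ : α ∈ ω₂) where
      open Nice nice

      -- The correspondence between a filtration m of M and the filtration of α, below the preimage a of α.
      Match : V → V → V → V → V → Set ℓ
      Match m a q l k = (∀ x v → m [ x ]≈ l → x ∈ a → π [ x ]≈ v → ∃[ j ∈ k ] E α v j) ×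
        ((∀ ξ → E α ξ l → ∃[ x ] (x ∈ a × π [ x ]≈ ξ × ∃[ j ∈ k ] m [ x ]≈ j)) × (∃[ j ∈ k ] q [ l ]≈ j))

      opaque
        def-Match : ∀ m a q → Def₂ (Match m a q)
        def-Match m a q = auto

        match₁ : ∀ m a l → π [ a ]≈ α → (∀ {x x′ j} → m [ x ]≈ j → m [ x′ ]≈ j → x ≡ x′) →
                 ∃[ k ∈ ω₁ ] (∀ x v → m [ x ]≈ l → x ∈ a → π [ x ]≈ v → ∃[ j ∈ k ] E α v j)
        match₁ m a l r inj with em {∃[ x ] ∃[ v ] (m [ x ]≈ l × x ∈ a × π [ x ]≈ v)}
        ... | no none = ω , ω∈ω₁ , λ x v p p′ p″ → ⊥-elim (none (x , v , p , p′ , p″))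
        ... | yes (x , v , p , p′ , p″) = case E-tot α∈ω₂ (π-preserves p″ r p′) of λ (j , j∈ω₁ , e) →
          case ω₁-max j∈ω₁ j∈ω₁ of λ (k , k∈ω₁ , j∈k , _) → k , k∈ω₁ , λ x₁ v₁ p₁ _ p₁″ → case inj p p₁ of λ
          { refl → case π-fun p″ p₁″ of λ { refl → j , j∈k , e } }

        match₂ : ∀ m a l → π [ a ]≈ α → (∀[ x ∈ M ] ∃[ j ∈ ω₁ ] m [ x ]≈ j) →
                 ∃[ k ∈ ω₁ ] (∀ ξ → E α ξ l → ∃[ x ] (x ∈ a × π [ x ]≈ ξ × ∃[ j ∈ k ] m [ x ]≈ j))
        match₂ m a l r tot with em {∃[ ξ ] E α ξ l}
        ... | no none = ω , ω∈ω₁ , λ ξ e → ⊥-elim (none (ξ , e))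
        ... | yes (ξ , e) = case to (π-∈ r) (proj₁ (proj₂ (E-dom e))) of λ (x , x∈M , x∈a , s) → case tot x x∈M of λ (j , j∈ω₁ , t) →
          case ω₁-max j∈ω₁ j∈ω₁ of λ (k , k∈ω₁ , j∈k , _) → k , k∈ω₁ , λ ξ′ e′ → case E-inj e e′ of λ { refl → x , x∈a , s , j , j∈k , t }

        match : ∀ {m a q l} → π [ a ]≈ α → (∀ {x x′ j} → m [ x ]≈ j → m [ x′ ]≈ j → x ≡ x′) → (∀[ x ∈ M ] ∃[ j ∈ ω₁ ] m [ x ]≈ j) →
                (∃[ k ∈ ω₁ ] q [ l ]≈ k) → ∃[ k ∈ ω₁ ] Match m a q l k
        match {m} {a} {q} {l} r inj tot (k₀ , k₀∈ω₁ , s) = case match₁ m a l r inj of λ (k₁ , k₁∈ω₁ , f₁) → case match₂ m a l r tot of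
          λ (k₂ , k₂∈ω₁ , f₂) → case ω₁-max k₁∈ω₁ k₂∈ω₁ of λ (k₃ , k₃∈ω₁ , k₁∈k₃ , k₂∈k₃) → case ω₁-max k₃∈ω₁ k₀∈ω₁ of
          λ (k , k∈ω₁ , k₃∈k , k₀∈k) → let ok = ∈ω₁-Ordinal k∈ω₁ ; k₃⊆k = proj₁ ok k₃ k₃∈k in
          k , k∈ω₁ , (λ x v p p′ p″ → case f₁ x v p p′ p″ of λ (j , j∈k₁ , e) → j , proj₁ ok k₁ (k₃⊆k k₁ k₁∈k₃) j j∈k₁ , e)
          , (λ ξ e → case f₂ ξ e of λ (x , x∈a , t , j , j∈k₂ , u) → x , x∈a , t , j , proj₁ ok k₂ (k₃⊆k k₂ k₂∈k₃) j j∈k₂ , u)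
          , k₀ , k₀∈k , s

        -- At a closed point i of `Match`, the collapse carries the elements of `a` in the i-th
        -- piece of M onto the i-th piece of α.
        finish : ∀ {q} m a → π [ a ]≈ α → Ordinal a → (∀ {x x′ j} → m [ x ]≈ j → m [ x′ ]≈ j → x ≡ x′) → ∀ {i Y} → i ∈ ω₁ → (∃[ j ] j ∈ i) →
          (∀[ j ∈ i ] ∃[ k ∈ i ] Match m a q j k) → Y ∈ M → (∀ x → x ∈ Y ⇔ (x ∈ M × ∃[ j ∈ i ] m [ x ]≈ j)) →
          ∃[ i ∈ ω₁ ] ((∃[ s ] (IsPiece s α i × HC M s)) × (∃[ j ] j ∈ i) × (∀[ j ∈ i ] ∃[ k ∈ i ] q [ j ]≈ k))
        finish {q} m a ra oa m-inj {i} {Y} i∈ω₁ ne cl Y∈M hY = case int Y Y∈M a (π-dom ra) of λ (x₀ , x₀∈M , h₀) → case proj₁ hπ x₀ x₀∈M of λ (s , rs) →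
          let oi = ∈ω₁-Ordinal i∈ω₁
              inY : ∀ x → x ∈ x₀ → x ∈ M × ∃[ j ∈ i ] m [ x ]≈ j
              inY x p = to (hY x) (proj₁ (to (h₀ x) p))
          in i , i∈ω₁ , (s
            , (λ ξ → mk⇔
                (λ p → case to (π-∈ rs) p of λ (x , _ , x∈x₀ , t) → case inY x x∈x₀ of λ (_ , j , j∈i , u) →
                  case cl j j∈i of λ (k , k∈i , f , _) → case f x ξ u (proj₂ (to (h₀ x) x∈x₀)) t of λ (j′ , j′∈k , e) →
                  j′ , proj₁ oi k k∈i j′ j′∈k , e)
                λ (j , j∈i , e) → case cl j j∈i of λ (k , k∈i , _ , f , _) → case f ξ e of λ (x , x∈a , t , j′ , j′∈k , u) →
                  π-preserves t rs (from (h₀ x) (from (hY x) (π-dom t , j′ , proj₁ oi k k∈i j′ j′∈k , u) , x∈a)))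
            , HC← rs (≼-trans (≼-rel x₀ i (λ x j → m [ x ]≈ j) (λ x p → proj₂ (inY x p)) (λ _ _ _ _ _ → m-inj)) (∈ω₁⇒countable i i∈ω₁))
                (λ x p → proj₁ (inY x p)) (λ x p → Ordinal-∈ oa (proj₂ (to (h₀ x) p))))
          , ne , λ j p → case cl j p of λ (k , k∈i , _ , _ , j′ , j′∈k , r) → j′ , proj₁ oi k k∈i j′ j′∈k , r

        through : ∀ {q m a Q} → Enumeration M m → π [ a ]≈ α → Ordinal a →
          (∀ x y → Q [ x ]≈ y ⇔ (x ∈ ω₁ × y ∈ ω₁ × Match m a q x y)) → (∀[ j ∈ ω₁ ] ∃[ k ∈ ω₁ ] q [ j ]≈ k) →
          ∃[ i ∈ ω₁ ] ((∃[ s ] (IsPiece s α i × HC M s)) × (∃[ j ] j ∈ i) × (∀[ j ∈ i ] ∃[ k ∈ i ] q [ j ]≈ k))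
        through {q} {m} {a} {Q} en ra oa hQ q-tot =
          case InternalPieces.internal-piece gis en Q (λ l p → total l p (match ra m-inj m-tot (q-tot l p))) of
            λ (i , i∈ω₁ , Y , Y∈M , (ne , cl) , hY) → finish m a ra oa m-inj i∈ω₁ ne (λ j p → matched j (cl j p)) Y∈M hY
          where
          open Enumeration en
          total : ∀ l → l ∈ ω₁ → (∃[ k ∈ ω₁ ] Match m a q l k) → ∃[ k ∈ ω₁ ] Q [ l ]≈ k
          total l p (k , k∈ω₁ , s) = k , k∈ω₁ , from (hQ l k) (p , k∈ω₁ , s)
          matched : ∀ {i} j → (∃[ k ∈ i ] Q [ j ]≈ k) → ∃[ k ∈ i ] Match m a q j k
          matched j (k , k∈i , r) = k , k∈i , proj₂ (proj₂ (to (hQ j k) r))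

        -- By internal stationarity, stationary many pieces of α are countable in the collapse of M.
        pieces : Ht M α → Meets ω₁ (λ i → ∃[ s ] (IsPiece s α i × HC M s))
        pieces ht q q-tot = case enumerate gis of λ (m , en) → case Ht→ ht of λ (a , ra , oa) →
          case rel ω₁ ω₁ (Match m a q) {{def-Match m a q}} of λ (Q , hQ , _) → through {q} {m} {a} {Q} en ra oa hQ q-tot

  -- Stationary sets recorded at β

  module Count (cd : Coding) (A κ : V) (niceA : ∀ M → M ∈ A → Agreement.Nice cd M) where
    open Trace cd public

    Model : V → Set ℓ
    Model M = M ∈ A × IsIntersection κ M ω₂

    -- T records which pieces of β are countable in the collapse of M.
    Records : V → V → V → Set ℓ
    Records β M T = ∀ i → i ∈ T ⇔ (i ∈ ω₁ × ∃[ s ] (IsPiece s β i × HC M s))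

    opaque
      TSet : V → V → Set ℓ
      TSet β T = ∃[ M ] (Model M × Ht M β × Records β M T)

      TSet→ : ∀ {β T} → TSet β T → ∃[ M ] (Model M × Ht M β × Records β M T)
      TSet→ t = t

      TSet← : ∀ {β T M} → Model M → Ht M β → Records β M T → TSet β T
      TSet← m ht r = _ , m , ht , r

      def-TSet : Def₂ TSet
      def-TSet = auto {X = Def₂ (λ β T → ∃[ M ] (Model M × Ht M β × Records β M T))}

      -- The intersection of the two sets is stationary in ω₁.
      Both : V → V → Set ℓ
      Both T T′ = Meets ω₁ (λ i → i ∈ T × i ∈ T′)

      Both→ : ∀ {T T′} → Both T T′ → Meets ω₁ (λ i → i ∈ T × i ∈ T′)
      Both→ m = m

      Both← : ∀ {T T′} → Meets ω₁ (λ i → i ∈ T × i ∈ T′) → Both T T′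
      Both← m = m

      def-Both : Def₂ Both
      def-Both = auto {X = Def₂ (λ T T′ → Meets ω₁ (λ i → i ∈ T × i ∈ T′))}

    private
      instance
        i-TSet : Atom₂ def-TSet
        i-TSet = atom₂ def-TSet

        →TSet : Atom₂→ def-TSet
        →TSet = atom₂→ def-TSet

        i-Both : Atom₂ def-Both
        i-Both = atom₂ def-Both

        ×Both : Atom₂× def-Both
        ×Both = atom₂× def-Both

    opaque
      Records-⊆ : ∀ {β M T} → Records β M T → T ⊆ ω₁
      Records-⊆ r i p = proj₁ (to (r i) p)

      Records-Meets : ∀ {β M T} → Model M → β ∈ ω₂ → Ht M β → Records β M T → Both T T
      Records-Meets (M∈A , _) p ht r = Both← (Meets-⊆ (λ i i∈ω₁ s → from (r i) (i∈ω₁ , s) , from (r i) (i∈ω₁ , s)) (pieces (niceA _ M∈A) p ht))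

      Both-common : ∀ {T T′} → Both T T′ → ∀ b → b ∈ ω₁ → ∃[ i ∈ ω₁ ] (b ∈ i × i ∈ T × i ∈ T′)
      Both-common {T} {T′} m b b∈ω₁ = case Meets-rel {ω₁} {λ i → i ∈ T × i ∈ T′} (Both→ m) (λ j k → b ∈ k)
        (λ j p → case ω₁-max b∈ω₁ b∈ω₁ of λ (k , q , r , _) → k , q , r) of λ (i , i∈ω₁ , t , (j , j∈i) , c) →
        case c j j∈i of λ (k , k∈i , b∈k) → i , i∈ω₁ , proj₁ (∈ω₁-Ordinal i∈ω₁) k k∈i b b∈k , t

      IsPiece-⊆ : ∀ {s β i} → IsPiece s β i → s ⊆ β
      IsPiece-⊆ hs ξ p = case to (hs ξ) p of λ (_ , _ , e) → proj₁ (proj₂ (E-dom e))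

      IsPiece-mono : ∀ {s s′ β i i′} → i′ ∈ ω₁ → i ∈ i′ → IsPiece s β i → IsPiece s′ β i′ → s ⊆ s′
      IsPiece-mono p q hs hs′ ξ r = case to (hs ξ) r of λ (j , j∈i , e) → from (hs′ ξ) (j , proj₁ (∈ω₁-Ordinal p) _ q j j∈i , e)

      agree-InH : ∀ {β M M′ T T′} → β ∈ ω₂ → Model M → Model M′ → Ht M′ β → Records β M T → Records β M′ T′ → Both T T′ →
                  ∀ B → B ⊆ β → InH M B → InH M′ B
      agree-InH β∈ω₂ (M∈A , hκ) (M′∈A , hκ′) ht r r′ m = let nice′ = niceA _ M′∈A in
        Double.agree (niceA _ M∈A) nice′ hκ hκ′ β∈ω₂ (Nice.Ht⇒InH nice′ ht) λ b b∈ω₁ →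
          case Both-common m b b∈ω₁ of λ (i , i∈ω₁ , b∈i , i∈T , i∈T′) → case to (r i) i∈T of λ { (_ , s , hs , c) →
          case to (r′ i) i∈T′ of λ { (_ , s′ , hs′ , c′) → case IsSetOf-unique hs hs′ of λ { refl → i , i∈ω₁ , b∈i , s , hs , c , c′ } } }

      -- A piece recorded in `T` lies in the other collapse by `agree-InH`, and it is countable
      -- there because a later common piece includes it.
      Records-agree : ∀ {β M M′ T T′} → β ∈ ω₂ → Model M → Model M′ → Ht M′ β → Records β M T → Records β M′ T′ → Both T T′ → T ⊆ T′
      Records-agree β∈ω₂ mM mM′ ht r r′ m i i∈T = case to (r i) i∈T of λ (i∈ω₁ , s , hs , c) →
        case Both-common m i i∈ω₁ of λ (i′ , i′∈ω₁ , i∈i′ , _ , i′∈T′) → case to (r′ i′) i′∈T′ of λ (_ , s′ , hs′ , c′) →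
        from (r′ i) (i∈ω₁ , s , hs , Single.HC-⊆ (niceA _ (proj₁ mM′))
          (agree-InH β∈ω₂ mM mM′ ht r r′ m s (IsPiece-⊆ hs) (Nice.HC⇒InH (niceA _ (proj₁ mM)) c)) c′ (IsPiece-mono i′∈ω₁ i∈i′ hs hs′))

      Both-sym : ∀ {T T′} → Both T T′ → Both T′ T
      Both-sym m = Both← (Meets-⊆ (λ _ _ (p , q) → q , p) (Both→ m))

      -- Hence the sets recorded at β form an antichain modulo nonstationary sets, and a saturation
      -- argument can count them.
      TSet-equal : ∀ {β T T′} → β ∈ ω₂ → TSet β T → TSet β T′ → Both T T′ → T ≡ T′
      TSet-equal p t t′ m = case TSet→ t of λ (M , mM , ht , r) → case TSet→ t′ of λ (M′ , mM′ , ht′ , r′) →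
        ⊆-antisym (Records-agree p mM mM′ ht′ r r′ m) (Records-agree p mM′ mM ht r′ r (Both-sym m))

    -- Counting recorded sets: the saturation argument

    module Level {β : V} (β∈ω₂ : β ∈ ω₂) where
      -- T is stationary but almost disjoint from all the sets recorded at β.
      Other : V → Set ℓ
      Other T = T ⊆ ω₁ × (Both T T × (∀ T′ → TSet β T′ → ¬ Both T T′))

      -- This is the sealing of an antichain known from the proof that SRP makes the nonstationary
      -- ideal saturated: the trace of `Y` must belong to a member of the antichain, or to a set of
      -- the second kind, that is an element of `Y`.
      Sealed : V → Set ℓ
      Sealed Y = Y ≼ ω × (Closed₀ Y × (∃[ T ∈ Y ] ∃[ i ] (IsIntersection i Y ω₁ × (i ∈ T × (TSet β T ⊎ Other T)))))

      opaque
        def-Sealed : Def₁ Sealed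
        def-Sealed = auto

        TSet-⊆ : ∀ {T} → TSet β T → T ⊆ ω₁
        TSet-⊆ t = case TSet→ t of λ (_ , _ , _ , r) → Records-⊆ r

        diag-⊆ω₁ : ∀ {T} → TSet β T ⊎ Other T → T ⊆ ω₁
        diag-⊆ω₁ (inj₁ t) = TSet-⊆ t
        diag-⊆ω₁ (inj₂ o) = proj₁ o

        -- If no recorded set meets T₀ stationarily often, then T₀ itself is of the kind `Other`.
        -- Adding that kind makes the sealing sets predense, which projective stationarity requires.
        catch : ∀ {T₀} → T₀ ⊆ ω₁ → Meets ω₁ (_∈ T₀) → ∃[ T ] ((TSet β T ⊎ Other T) × Meets ω₁ (λ i → i ∈ T₀ × i ∈ T))
        catch {T₀} s m with em {∃[ T ] (TSet β T × Both T₀ T)}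
        ... | yes (T , t , b) = T , inj₁ t , Both→ b
        ... | no none = let m′ = Meets-⊆ {T = _∈ T₀} (λ i _ p → p , p) m in
          T₀ , inj₂ (s , Both← m′ , λ T t b → none (T , t , b)) , m′

        projective : ∀ {P} → (∀ Y → Y ∈ P ⇔ (Y ⊆ h₂ × Sealed Y)) → ProjectiveStationary h₂ P
        projective {P} hP = (λ Y p → case to (hP Y) p of λ (a , c , _) → a , ≼⇒Countable c) , λ T₀ st C club →
          case catch (proj₁ st) (Stationary₁⇒Meets st) of λ (T , d , m) → case traced m (⊆ω₁⇒∈H₂ (diag-⊆ω₁ d)) C club of
            λ (Y , Y∈C , Y⊆ , cY , clY , T∈Y , i , i∈ω₁ , (i∈T₀ , i∈T) , hi) →
          Y , Y∈C , from (hP Y) (Y⊆ , cY , clY , T , T∈Y , i , hi , i∈T , d) , i , i∈T₀ , hi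

      -- q witnesses that T ∩ T′ is nonstationary.
      Miss : V → V → V → Set ℓ
      Miss T T′ q = (∀[ j ∈ ω₁ ] ∃[ k ∈ ω₁ ] q [ j ]≈ k) ×
        (∀[ i ∈ ω₁ ] ((∃[ j ] j ∈ i) → (∀[ j ∈ i ] ∃[ k ∈ i ] q [ j ]≈ k) → ¬ (i ∈ T × i ∈ T′)))

      opaque
        def-Miss : ∀ T → Def₂ (Miss T)
        def-Miss T = auto

        miss : ∀ {c w T T′} → IsSetOf c (λ p → ∃[ x ∈ ω₁ ] ∃[ y ∈ ω₁ ] Pr p x y) → (∀ p → p ∈ w ⇔ p ⊆ c) → ¬ Both T T′ →
               ∃[ q ∈ w ] Miss T T′ q
        miss hc hw fails = byContra λ none → fails (Both← λ q t → byContra λ gap →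
          case rel ω₁ ω₁ (λ j k → q [ j ]≈ k) of λ (q′ , hq , pq) → none (q′
          , from (hw q′) (λ p p∈q → from (hc p) (pq p p∈q))
          , (λ j p → case t j p of λ (k , k∈ω₁ , r) → k , k∈ω₁ , from (hq j k) (p , k∈ω₁ , r))
          , λ i i∈ω₁ ne cl s → gap (i , i∈ω₁ , s , ne , λ j p → case cl j p of λ (k , k∈i , r) →
              k , k∈i , proj₂ (proj₂ (to (hq j k) r)))))

      module Press {P N : V} (ch : Chain P) (hP : ∀ Y → Y ∈ P ⇔ (Y ⊆ h₂ × Sealed Y)) (empty : IsEmpty N)
                   (T : V) (tT : TSet β T) where
        avoid : ∀ Y → Y ∈ P → Avoids N Y
        avoid Y p = case to (hP Y) p of λ (_ , c , d , _) → c , d , λ z q → ⊥-elim (empty z q)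

        open Chain ch
        open Reflect ch avoid

        -- At a closed point i the chain has trace i, and i lies in the clubs chosen for all members
        -- of `B` that occur in the chain before i.
        Pressing : V → V → V → V → Set ℓ
        Pressing B F l k = l ∈ k × ((∀ z → z ∈ ω₁ → InChain l z → z ∈ k) ×
          (∀ T′ → T′ ∈ B → InChain l T′ → ∀[ l′ ∈ l ] ∃[ k′ ∈ k ] ∃[ q ] (F [ T′ ]≈ q × q [ l′ ]≈ k′)))

        opaque
          def-Pressing : ∀ B F → Def₂ (Pressing B F)
          def-Pressing B F = auto

          inner : ∀ F {l T′ q} → l ∈ ω₁ → F [ T′ ]≈ q → Miss T T′ q →
            ∃[ b ∈ ω₁ ] (∀[ l′ ∈ l ] ∃[ k′ ∈ b ] ∃[ q ] (F [ T′ ]≈ q × q [ l′ ]≈ k′))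
          inner F {l} {T′} {q} l∈ω₁ r reg = ω₁-bound l (∈ω₁⇒countable l l∈ω₁) (λ l′ k′ → ∃[ q ] (F [ T′ ]≈ q × q [ l′ ]≈ k′))
            λ l′ l′∈l → case proj₁ reg l′ (proj₁ Ordinal-ω₁ l l∈ω₁ l′ l′∈l) of λ (k , p , s) → k , p , q , r , s

          pressing : ∀ B F → (∀ T′ → T′ ∈ B → ∃[ q ] (F [ T′ ]≈ q × Miss T T′ q)) → ∀ l → l ∈ ω₁ → ∃[ k ∈ ω₁ ] Pressing B F l k
          pressing B F f l l∈ω₁ = case stage l∈ω₁ of λ (Y , r , cY , _) → case sep Y (_∈ B) of λ (Y′ , hY′) → case sep Y (_∈ ω₁) of λ (Y″ , hY″) →
            case ω₁-bounded (≼-trans (⊆⇒≼ λ x p → proj₁ (to (hY″ x) p)) cY) (λ x p → proj₂ (to (hY″ x) p)) of λ (a , a∈ω₁ , Y″⊆a) →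
            case ω₁-bound Y′ (≼-trans (⊆⇒≼ λ x p → proj₁ (to (hY′ x) p)) cY)
              (λ T′ b → b ∈ ω₁ × (∀[ l′ ∈ l ] ∃[ k′ ∈ b ] ∃[ q ] (F [ T′ ]≈ q × q [ l′ ]≈ k′)))
              (λ T′ p → case f T′ (proj₂ (to (hY′ T′) p)) of λ (q , s , reg) → case inner F l∈ω₁ s reg of λ (b , b∈ω₁ , hb) → b , b∈ω₁ , b∈ω₁ , hb)
            of λ (b , b∈ω₁ , hb) → case ω₁-max a∈ω₁ b∈ω₁ of λ (k₁ , k₁∈ω₁ , a∈k₁ , b∈k₁) → case ω₁-max k₁∈ω₁ l∈ω₁ of
            λ (k , k∈ω₁ , k₁∈k , l∈k) → let ok = ∈ω₁-Ordinal k∈ω₁ ; k₁⊆k = proj₁ ok k₁ k₁∈k in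
            k , k∈ω₁ , l∈k
            , (λ { z z∈ω₁ (Y₁ , r₁ , q) → case fun r r₁ of λ { refl → proj₁ ok a (k₁⊆k a a∈k₁) z (Y″⊆a z (from (hY″ z) (q , z∈ω₁))) } })
            , λ { T′ T′∈B (Y₁ , r₁ , q) l′ l′∈l → case fun r r₁ of λ { refl → case hb T′ (from (hY′ T′) (q , T′∈B)) of λ (b₁ , b₁∈b , _ , hb₁) →
                case hb₁ l′ l′∈l of λ (k′ , k′∈b₁ , s) →
                k′ , proj₁ ok b (k₁⊆k b b∈k₁) k′ (proj₁ (∈ω₁-Ordinal b∈ω₁) b₁ b₁∈b k′ k′∈b₁) , s } }

          -- A point of T closed under Pressing lies in no set of B that appears in the chain before it.
          separated : ∀ B F → (∀ {T′ q q′} → F [ T′ ]≈ q → F [ T′ ]≈ q′ → q ≡ q′) → (∀ T′ q → F [ T′ ]≈ q → Miss T T′ q) → ∀ {i} → i ∈ ω₁ → i ∈ T → (∃[ j ] j ∈ i) →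
            (∀[ j ∈ i ] ∃[ k ∈ i ] Pressing B F j k) → ∀ {T′ q ζ} → T′ ∈ B → F [ T′ ]≈ q → ζ ∈ i → InChain ζ T′ → i ∈ T′ → ⊥
          separated B F fn hF {i} i∈ω₁ i∈T ne cl {T′} {q} {ζ} T′∈B r ζ∈i c i∈T′ = let oi = ∈ω₁-Ordinal i∈ω₁ in
            proj₂ (hF T′ q r) i i∈ω₁ ne (λ l l∈i →
              case Ordinal-max oi (λ x p → case cl x p of λ (k , k∈i , x∈k , _) → k , k∈i , x∈k) ζ∈i l∈i of λ (j , j∈i , ζ∈j , l∈j) →
              case cl j j∈i of λ (k , k∈i , _ , _ , f) → case f T′ T′∈B (in-⊆ ζ∈j (proj₁ Ordinal-ω₁ i i∈ω₁ j j∈i) c) l l∈j of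
                λ { (k′ , k′∈k , q′ , r′ , s) → case fn r r′ of λ { refl → k′ , proj₁ oi k k∈i k′ k′∈k , s } })
              (i∈T , i∈T′)

          -- If `T` never occurred in the chain, every sealing set that occurs would meet `T` in a
          -- nonstationary set. But at a closed point i of `Pressing` in `T`, the i-th set is sealed
          -- by some T′ containing i, and T′ occurs before i by continuity; the diagonal
          -- intersection forbids this.
          captured-T : ∃[ ξ ] InChain ξ T
          captured-T = byContra λ out → case powerSet ω₁ of λ (u , hu) → case sep u (λ T′ → ¬ Both T T′) of λ (B , hB) →
            case prod ω₁ ω₁ of λ (c , hc) → case powerSet c of λ (w , hw) →
            case choose B w (Miss T) {{def-Miss T}} (λ T′ p → miss hc hw (proj₂ (to (hB T′) p))) of λ (F , fF , hF) →
            contra out B F (λ T′ s n → from (hB T′) (from (hu T′) s , n)) fF hF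
            where
            contra : ¬ (∃[ ξ ] InChain ξ T) → ∀ B F {w} → (∀ T′ → T′ ⊆ ω₁ → ¬ Both T T′ → T′ ∈ B) → Fn B w F → (∀ T′ q → F [ T′ ]≈ q → Miss T T′ q) → ⊥
            contra out B F inB fF hF = case TSet→ tT of λ (M , mM , ht , rec) →
              case Meets-rel {ω₁} {λ i → i ∈ T × i ∈ T} (Both→ (Records-Meets mM β∈ω₂ ht rec)) (Pressing B F) {{def-Pressing B F}}
                (pressing B F λ T′ p → case Fn.tot fF T′ p of λ (q , r) → q , r , hF T′ q r) of
                λ (i , i∈ω₁ , (i∈T , _) , ne , cl) → case tot i i∈ω₁ of λ (Y , r) →
              case to (hP Y) (inP r) of λ (_ , _ , _ , T′ , T′∈Y , i′ , hi′ , i′∈T′ , d) →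
              let oi = ∈ω₁-Ordinal i∈ω₁
                  early : ∀ x → x ∈ Y → ∃[ ζ ∈ i ] InChain ζ x
                  early x p = case cont r ne (λ j q → case cl j q of λ (k , k∈i , j∈k , _) → k , k∈i , j∈k) x p of
                    λ (ζ , ζ∈i , Y₁ , r₁ , q) → ζ , ζ∈i , Y₁ , r₁ , q
                  i≡i′ : i ≡ i′
                  i≡i′ = ⊆-antisym (λ z p → from (hi′ z) (big r z p , proj₁ Ordinal-ω₁ i i∈ω₁ z p))
                    λ z p → case to (hi′ z) p of λ (z∈Y , z∈ω₁) → case early z z∈Y of λ (ζ , ζ∈i , c) → case cl ζ ζ∈i of
                      λ (k , k∈i , _ , f , _) → proj₁ oi k k∈i z (f z z∈ω₁ c)
                  T′∈B : T′ ∈ B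
                  T′∈B = inB T′ (diag-⊆ω₁ d) λ b → case d of λ
                    { (inj₁ t) → out (case TSet-equal β∈ω₂ tT t b of λ { refl → case early T′ T′∈Y of λ (ζ , _ , c) → ζ , c })
                    ; (inj₂ (_ , _ , o)) → o T tT (Both-sym b) }
              in case early T′ T′∈Y of λ (ζ , ζ∈i , c) → case Fn.tot fF T′ T′∈B of λ (q , s) →
              separated B F (Fn.fun fF) hF i∈ω₁ i∈T ne cl T′∈B s ζ∈i c (subst (_∈ T′) (sym i≡i′) i′∈T′)

      opaque
        -- All sets recorded at β occur in one chain of length ω₁ of countable sets, and almost all
        -- M include the union of that chain.
        count : SRP[ω₂] → 𝔸 (λ M → ∀ T → TSet β T → T ∈ M)
        count srp = case powerSet h₂ of λ (u , hu) → case sep u Sealed {{def-Sealed}} of λ (P , hP) → case ∃∅ of λ (N , empty) →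
          let hP′ : ∀ Y → Y ∈ P ⇔ (Y ⊆ h₂ × Sealed Y)
              hP′ Y = mk⇔ (λ p → case to (hP Y) p of λ (a , b) → to (hu Y) a , b) λ (a , b) → from (hP Y) (from (hu Y) a , b)
              ch = chain srp (projective hP′) (λ Y p → proj₁ (proj₂ (proj₂ (to (hP′ Y) p))))
              avoid : ∀ Y → Y ∈ P → Avoids N Y
              avoid Y p = case to (hP′ Y) p of λ (_ , c , d , _) → c , d , λ z q → ⊥-elim (empty z q)
          in 𝔸-map (λ M _ f T t → case Press.captured-T ch hP′ empty T t of λ { (ξ , Y , r , q) → f ξ (Chain.dom ch r) T (Y , r , q) })
            (Reflect.chain-Small ch avoid (λ Y p → proj₁ (to (hP′ Y) p)))

  -- All reals in one model, and the contradiction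

  module Final (srp : SRP[ω₂]) where
    cd : Coding
    cd = ∃Coding srp

    open Reals cd

    opaque
      models : ∃[ A ] ((∀ M → M ∈ A → Agreement.Nice cd M) × 𝔸 (_∈ A))
      models = case Agreement.𝔸-Nice cd of λ (S , S∈I , k) → case sep Z (_∉ S) of λ (A , hA) → A
        , (λ M p → case to (hA M) p of λ (M∈Z , M∉S) → byContra λ n → M∉S (k M M∈Z n))
        , S , S∈I , λ M M∈Z n → byContra λ M∉S → n (from (hA M) (M∈Z , M∉S))

      -- A function choosing for every κ a missed height is a function from ω₂ to ω₂; order types
      -- above its values give those heights after all, by `orderType⇒Ht`.
      tall : ∀ A → (∀ M → M ∈ A → Agreement.Nice cd M) → 𝔸 (_∈ A) →
             ∃[ κ ] (∀ b → b ∈ ω₂ → ∃[ M ] (M ∈ A × IsIntersection κ M ω₂ × Ht M b))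
      tall A niceA 𝔸A = byContra λ none →
        case choose ω₂ ω₂ (λ κ b → ∀ M → M ∈ A → IsIntersection κ M ω₂ → ¬ Ht M b)
          (λ κ _ → byContra λ no′ → none (κ , λ b b∈ω₂ → byContra λ no″ → no′ (b , b∈ω₂ , λ M p q r → no″ (M , p , q , r)))) of
        λ (f , ff , hf) → case 𝔸-witness (𝔸-∧ 𝔸A (proj₂ bounded f (Fn→Function ff))) of
        λ (M , _ , M∈A , κ , _ , β , o , hκ , r , ot , β∈o) →
          hf κ β (ap r) M M∈A hκ (Agreement.Nice.orderType⇒Ht (niceA M M∈A) ot β∈o)

    module At (A κ : V) (niceA : ∀ M → M ∈ A → Agreement.Nice cd M)
              (high : ∀ b → b ∈ ω₂ → ∃[ M ] (M ∈ A × IsIntersection κ M ω₂ × Ht M b)) where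
      open Count cd A κ niceA

      InModel : V → V → V → Set ℓ
      InModel M β z = (Model M × Ht M β) × (z ⊆ β × InH M z)

      Covered : V → Set ℓ
      Covered z = ∃[ M ] (∃[ β ∈ ω₂ ] InModel M β z)

      opaque
        def-Covered : Def₁ Covered
        def-Covered = auto

        family : ∃[ F ] (∀ z → z ∈ F ⇔ (z ⊆ ω₂ × Covered z))
        family = case powerSet ω₂ of λ (u , hu) → case sep u Covered {{def-Covered}} of λ (F , hF) → F , λ z → mk⇔
          (λ p → case to (hF z) p of λ (a , b) → to (hu z) a , b) λ (a , b) → from (hF z) (from (hu z) a , b)

        family-Meets : ∀ {F} → (∀ z → z ∈ F ⇔ (z ⊆ ω₂ × Covered z)) → ∀ α → α ∈ ω₂ → Meets ω₁ (λ i → ∃[ s ∈ F ] IsPiece s α i)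
        family-Meets hF α α∈ω₂ = case high α α∈ω₂ of λ (M , M∈A , hκ , ht) → Meets-⊆
          (λ i _ (s , hs , c) → s , from (hF s) ((λ ξ p → ∈ω₂⇒⊆ω₂ α∈ω₂ ξ (IsPiece-⊆ hs ξ p)) , M , α , α∈ω₂ ,
            ((M∈A , hκ) , ht) , IsPiece-⊆ hs , Agreement.Nice.HC⇒InH (niceA M M∈A) c) , hs)
          (pieces (niceA M M∈A) α∈ω₂ ht)

      module Coded (α q w : V) (α∈ω₂ : α ∈ ω₂) (hq : ∀ r → r ∈ q ⇔ r ⊆ ω) (w-cov : ∀[ r ∈ q ] ∃[ z ] (w [ r ]≈ z × Covered z))
                   (w-⊆ : ∀ r z → w [ r ]≈ z → z ⊆ α) (w-inj : ∀ r r′ z → w [ r ]≈ z → w [ r′ ]≈ z → r ≡ r′) where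

        -- The real r is coded by a set in the collapse of a model recorded by T at β.
        Via : V → V → V → Set ℓ
        Via β T r = r ∈ q × ∃[ M ] ∃[ z ] (InModel M β z × (Records β M T × w [ r ]≈ z))

        opaque

          q⊆h : q ⊆ h
          q⊆h r p = H₂⊆h r (⊆ω₁⇒∈H₂ λ x s → proj₁ Ordinal-ω₁ ω ω∈ω₁ x (to (hq r) p x s))

          -- Models with the same record `T` at β have the same subsets of β in their collapses, so
          -- all these codes lie in the collapse of `M₀`; a real is recovered from its code.
          Via-≼ : ∀ {β T X M₀ π} → β ∈ ω₂ → (hπ : Col M₀ π) → Model M₀ → Ht M₀ β → Records β M₀ T → (∀ r → r ∈ X → Via β T r) → X ≼ M₀
          Via-≼ {X = X} {M₀} {π} β∈ω₂ hπ m₀ ht₀ r₀ hX = ≼-rel X M₀ (λ r u → ∃[ z ] (w [ r ]≈ z × π [ u ]≈ z))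
            (λ r p → case hX r p of λ (_ , M , z , ((m , ht) , z⊆β , c) , rc , s) →
              case Collapse.InH→ hπ gis₀ (agree-InH β∈ω₂ m m₀ ht₀ rc r₀ (Records-Meets m β∈ω₂ ht rc) z z⊆β c) of λ (u , t) →
              u , Collapse.π-dom hπ gis₀ t , z , s , t)
            λ { r r′ u _ _ (z , s , t) (z′ , s′ , t′) → case Col-fun hπ t t′ of λ { refl → w-inj r r′ z s s′ } }
            where
            gis₀ : GIS M₀
            gis₀ = Agreement.Nice.gis (niceA M₀ (proj₁ m₀))

          Via-Small : ∀ {β T} → β ∈ ω₂ → 𝔸 (λ M → ∀ r → Via β T r → r ∈ M)
          Via-Small {β} {T} β∈ω₂ = case em {∃[ r ] Via β T r} of λ
            { (no none) → 𝔸-all λ M _ r v → ⊥-elim (none (r , v))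
            ; (yes (_ , _ , M₀ , _ , ((m₀ , ht₀) , _) , r₀ , _)) → case sep q (Via β T) of λ (X , hX) →
                let n₀ = niceA M₀ (proj₁ m₀) in
                𝔸-map (λ M _ s r v → s r (from (hX r) (proj₁ v , v)))
                  (≼ω₁⇒Small (λ r p → q⊆h r (proj₁ (to (hX r) p)))
                    (≼-trans (Via-≼ β∈ω₂ (Agreement.Nice.hπ n₀) m₀ ht₀ r₀ (λ r p → proj₂ (to (hX r) p)))
                      (GIS⇒≼ω₁ (Agreement.Nice.gis n₀)))) }

          def-Via-M : Def₂ (λ β M → β ∈ ω₂ → ∀[ T ∈ M ] ∀ r → Via β T r → r ∈ M)
          def-Via-M = auto

          def-Via-M′ : ∀ β → Def₂ (λ T M → ∀ r → Via β T r → r ∈ M)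
          def-Via-M′ β = auto

          𝔸-Via : 𝔸 (λ M → ∀[ β ∈ M ] (β ∈ ω₂ → ∀[ T ∈ M ] ∀ r → Via β T r → r ∈ M))
          𝔸-Via = 𝔸-diag (λ β M → β ∈ ω₂ → ∀[ T ∈ M ] ∀ r → Via β T r → r ∈ M) {{def-Via-M}} λ β _ → case em {β ∈ ω₂} of λ
            { (no n) → 𝔸-all λ M _ p → ⊥-elim (n p)
            ; (yes p) → 𝔸-map (λ M _ f _ → f) (𝔸-diag (λ T M → ∀ r → Via β T r → r ∈ M) {{def-Via-M′ β}} λ T _ → Via-Small p) }

          def-TSet-M : Def₂ (λ β M → β ∈ ω₂ → ∀ T → TSet β T → T ∈ M)
          def-TSet-M = auto
            where
            instance
              _ : Atom₂→ def-TSet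
              _ = atom₂→ def-TSet

          𝔸-TSet : 𝔸 (λ M → ∀[ β ∈ M ] (β ∈ ω₂ → ∀ T → TSet β T → T ∈ M))
          𝔸-TSet = 𝔸-diag (λ β M → β ∈ ω₂ → ∀ T → TSet β T → T ∈ M) {{def-TSet-M}} λ β _ → case em {β ∈ ω₂} of λ
            { (no n) → 𝔸-all λ M _ p → ⊥-elim (n p) ; (yes p) → 𝔸-map (λ M _ f _ → f) (Level.count p srp) }

          -- Codes are subsets of α, so a level above α can be replaced by α. A model containing α
          -- contains all remaining levels.
          lower : ∀ {M β z r} → β ∈ ω₂ → InModel M β z → w [ r ]≈ z → ∃[ β′ ] (β′ ≤ α × InModel M β′ z)
          lower {β = β} β∈ω₂ d@((m , ht) , z⊆β , c) s = case ≤-or-> (∈ω₂-Ordinal β∈ω₂) (∈ω₂-Ordinal α∈ω₂) of λ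
            { (inj₁ p) → β , p , d
            ; (inj₂ p) → α , inj₂ refl , (m , Agreement.Nice.Ht-below (niceA _ (proj₁ m)) ht p) , w-⊆ _ _ s , c }

          record-set : ∀ β M → ∃[ T ] Records β M T
          record-set β M = sep ω₁ (λ i → ∃[ s ] (IsPiece s β i × HC M s))

          reals-in : ∀ {M} → Good M → α ∈ M → (∀[ β ∈ M ] (β ∈ ω₂ → ∀ T → TSet β T → T ∈ M)) →
                     (∀[ β ∈ M ] (β ∈ ω₂ → ∀[ T ∈ M ] ∀ r → Via β T r → r ∈ M)) → q ⊆ M
          reals-in {M} g α∈M cT cV r r∈q = case w-cov r r∈q of λ (z , s , M₁ , β , β∈ω₂ , d) → case lower β∈ω₂ d s of λ (β′ , p , d′) →
            let β′∈ω₂ : β′ ∈ ω₂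
                β′∈ω₂ = case p of λ { (inj₁ t) → ∈ω₂⇒⊆ω₂ α∈ω₂ β′ t ; (inj₂ refl) → α∈ω₂ }
                β′∈M : β′ ∈ M
                β′∈M = case p of λ { (inj₁ t) → Good⇒⊆ g α∈M α∈ω₂ β′ t ; (inj₂ refl) → α∈M }
            in case record-set β′ M₁ of λ (T , hT) →
            cV β′ β′∈M β′∈ω₂ T (cT β′ β′∈M β′∈ω₂ T (TSet← (proj₁ (proj₁ d′)) (proj₂ (proj₁ d′)) hT)) r (r∈q , M₁ , z , d′ , hT , s)

          fixed : ∀ {M π} → Col M π → ω₁ ⊆ M → ∀ i → i ∈ ω₁ → π [ i ]≈ i
          fixed {M} {π} hπ s = ∈-ind ω₁ (λ i → π [ i ]≈ i) λ i i∈ω₁ ih → case proj₁ hπ i (s i i∈ω₁) of λ (v , r) →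
            subst (π [ i ]≈_) (⊆-antisym
              (λ z p → case to (proj₂ (proj₂ hπ i v r) z) p of λ (u , _ , u∈i , t) →
                subst (_∈ i) (Col-fun hπ (ih u u∈i (proj₁ Ordinal-ω₁ i i∈ω₁ u u∈i)) t) u∈i)
              (λ z p → let z∈ω₁ = proj₁ Ordinal-ω₁ i i∈ω₁ z p in from (proj₂ (proj₂ hπ i v r) z) (z , s z z∈ω₁ , p , ih z p z∈ω₁))) r

          fixed-⊆ : ∀ {M π c} → Col M π → ω₁ ⊆ M → c ⊆ ω₁ → c ∈ M → π [ c ]≈ c
          fixed-⊆ {M} {π} {c} hπ s c⊆ω₁ c∈M = case proj₁ hπ c c∈M of λ (v , r) → subst (π [ c ]≈_) (⊆-antisym
            (λ z p → case to (proj₂ (proj₂ hπ c v r) z) p of λ (u , _ , u∈c , t) → subst (_∈ c) (Col-fun hπ (fixed hπ s u (c⊆ω₁ u u∈c)) t) u∈c)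
            (λ z p → from (proj₂ (proj₂ hπ c v r) z) (z , s z (c⊆ω₁ z p) , p , fixed hπ s z (c⊆ω₁ z p)))) r

          -- Once M contains all reals, approximation puts every subset of ω₁ into its collapse.
          guess : ∀ {M} (n : Agreement.Nice cd M) → q ⊆ M → (∀[ r ∈ M ] ∀[ ρ ∈ ω₁ ] ∀ c → RealCode ρ r c → c ∈ M) → ∀ B → B ⊆ ω₁ → InH M B
          guess {M} n q⊆M dec B B⊆ω₁ = approximation gis ω₁ (GIS⇒ω₁∈H gis) B B⊆ω₁ λ z z∈H cz →
            -- A countable `z` meets ω₁ below some ρ, so z ∩ B = z ∩ (B ∩ ρ), and B ∩ ρ is decoded
            -- from a real of M.
            case sep z (_∈ ω₁) of λ (z₀ , hz₀) →
            case ω₁-bounded (≼-trans (⊆⇒≼ λ v p → proj₁ (to (hz₀ v) p)) cz) (λ v p → proj₂ (to (hz₀ v) p)) of λ (ρ , ρ∈ω₁ , z₀⊆ρ) →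
            case sep ρ (_∈ B) of λ (c , hc) → case real ρ∈ω₁ (λ v p → proj₁ (to (hc v) p)) of λ (r , r∈ , e) →
            case Agreement.Single.InH-∩ cd n z∈H (InH← (fixed-⊆ hπ (GIS⇒ω₁⊆ gis) (λ v p → B⊆ω₁ v (proj₂ (to (hc v) p)))
              (dec r (q⊆M r (from (hq r) (to (Coding.hq cd r) r∈))) ρ ρ∈ω₁ c e))) of λ (x , x∈H , hx) →
            x , x∈H , λ v → mk⇔ (λ p → case to (hx v) p of λ (v∈z , v∈c) → v∈z , proj₂ (to (hc v) v∈c))
              λ (v∈z , v∈B) → from (hx v) (v∈z , from (hc v) (z₀⊆ρ v (from (hz₀ v) (v∈z , B⊆ω₁ v v∈B)) , v∈B))
            where open Agreement.Nice n using (gis; hπ; InH←)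

          -- Cantor's argument: the collapse of M has size ω₁.
          cantor : ∀ {M} → Agreement.Nice cd M → ¬ (∀ B → B ⊆ ω₁ → InH M B)
          cantor {M} n all = case enumerate gis of λ (m , en) →
            case sep ω₁ (λ i → ∃[ x ] ∃[ a ] (m [ x ]≈ i × (π [ x ]≈ a × i ∉ a))) of λ (D , hD) →
            case InH→ (all D λ i p → proj₁ (to (hD i) p)) of λ (x₀ , r₀) → case Enumeration.m-tot en x₀ (π-dom r₀) of λ (i₀ , i₀∈ω₁ , s₀) →
            let out : i₀ ∉ D
                out p = case to (hD i₀) p of λ { (_ , x , a , s , r , i₀∉a) → case Enumeration.m-inj en s₀ s of λ
                  { refl → case π-fun r₀ r of λ { refl → i₀∉a p } } }
            in out (from (hD i₀) (i₀∈ω₁ , x₀ , D , s₀ , r₀ , out))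
            where open Agreement.Nice n using (gis; π; π-dom; π-fun; InH→)

          impossible : ⊥
          impossible = case good (𝔸-∧ (Agreement.𝔸-Nice cd) (𝔸-∧ (𝔸-fine (ω₂⊆h α α∈ω₂)) (𝔸-∧ 𝔸-TSet (𝔸-∧ 𝔸-Via 𝔸-RealCode)))) of
            λ (M , g , n , α∈M , cT , cV , dec) → cantor n (guess n (reals-in g α∈M cT cV) dec)

      opaque
        contradiction : ⊥
        contradiction = case family of λ (F , hF) → case continuum srp F (λ α p _ → family-Meets hF α p) of
          λ (α , α∈ω₂ , q , w , hq , fw , w-⊆ , w-inj) → Coded.impossible α q w α∈ω₂ hq
            (λ r p → case Fn.tot fw r p of λ (z , s) → z , s , proj₂ (to (hF z) (Fn.cod fw s))) w-⊆ w-inj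

    opaque
      contradiction : ⊥
      contradiction = case models of λ (A , niceA , 𝔸A) → case tall A niceA 𝔸A of λ (κ , high) → At.contradiction A κ niceA high

theorem27 : ∀ {ℓ} → ExcludedMiddle ℓ → (𝔐 : Structure ℓ) →
    let open SetTheory 𝔐 in
    ZFC → ∀ ω ω₁ ω₂ → IsOmega ω → IsSuccessorCardinal ω₁ ω → IsSuccessorCardinal ω₂ ω₁ →
    let open Alephs ω ω₁ ω₂ in
    SRP[ω₂] → TreeProperty[ω₂] →
    ¬ (∃[ θ ] ∃[ h ] ∃[ Z ] ∃[ I ]
         (IsIdeal θ h Z I × ConcentratesOn Z I GIS × BoundsCompleteness h Z I))
theorem27 em 𝔐 zfc ω ω₁ ω₂ isω isω₁ isω₂ srp _ (θ , h , Z , I , ideal , conc , bounds) =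
  Models.Final.contradiction em 𝔐 zfc ℵ 𝔍 srp
  where
  ℵ : Cardinals 𝔐
  ℵ = record { ω = ω ; ω₁ = ω₁ ; ω₂ = ω₂ ; isω = isω ; isω₁ = isω₁ ; isω₂ = isω₂ }
  𝔍 : Ideal 𝔐 ℵ
  𝔍 = record { θ = θ ; h = h ; Z = Z ; I = I ; ideal = ideal ; conc = conc ; bounds = bounds }
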